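{- For every $\alpha>0$ there exist $\beta>0$ and a sequence of graphs $(G_j)_{j\ge 1}$, where $G_j$ has $n_j$ vertices and $n_j\to\infty$, such that, as $j\to\infty$: \begin{itemize} \item $|G_j| \geq \beta \binom{n_j}{2}$ for all $j$; \item $\tau_3(G_j) > (1-o(1))\,|G_j|/2$; \item $\nu_3(G_j) < (1+\alpha)\,|G_j|/4$ for all $j$. \end{itemize}
   Context: All graphs are finite, simple and undirected; $|G|$ denotes the number of edges of $G$. $\tau_3(G)$ is the minimum size of a set of edges of $G$ meeting every triangle of $G$, and $\nu_3(G)$ is the maximum number of pairwise edge-disjoint triangles in $G$. The $o(1)$ refers to a quantity tending to $0$ as $j\to\infty$ (equivalently $n_j\to\infty$). -}

module Defs where

open import Level using (0ℓ)
open import Data.Nat.Base as ℕ using (ℕ)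
open import Data.Integer.Base using (+_)
open import Data.Rational.Base using (ℚ; 0ℚ; _<_; _/_; ∣_∣)
open import Data.Fin.Base as Fin using (Fin)
import Data.Fin.Properties as Fin
open import Data.List.Base
  using (List; []; _∷_; [_]; _++_; map; filter; length; allFin; cartesianProduct)
open import Data.List.Extrema.Nat using (min; max)
open import Data.List.Relation.Unary.All using (All; all?)
open import Data.List.Relation.Unary.Any using (Any; any?)
open import Data.List.Relation.Unary.AllPairs using (AllPairs; allPairs?)
open import Data.List.Relation.Binary.Disjoint.Propositional using (Disjoint)
import Data.List.Relation.Binary.Disjoint.DecPropositional as DecDisjoint
open import Data.List.Membership.Propositional using (_∈_)
import Data.List.Membership.DecPropositional as DecMembership
open import Data.Product.Base using (_×_; _,_; ∃-syntax)
open import Data.Product.Properties using (≡-dec)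
open import Relation.Binary.Core using (Rel)
open import Relation.Binary.Definitions
  using (Decidable; DecidableEquality; Symmetric; Irreflexive)
open import Relation.Binary.PropositionalEquality.Core using (_≡_)
open import Relation.Nullary.Decidable using (_×-dec_)
open import Relation.Unary as U using (Pred)

record Graph (n : ℕ) : Set₁ where
  field
    Adj    : Rel (Fin n) 0ℓ
    adj?   : Decidable Adj
    sym    : Symmetric Adj
    irrefl : Irreflexive _≡_ Adj

-- An unordered pair {i, j} of distinct vertices is represented by (i , j)
-- with i < j, and an unordered triple by its increasing enumeration, so that
-- each edge and each triangle has exactly one representative.

Pair Triple : ℕ → Set
Pair   n = Fin n × Fin n
Triple n = Fin n × Fin n × Fin n

_≟ₚ_ : ∀ {n} → DecidableEquality (Pair n)
_≟ₚ_ = ≡-dec Fin._≟_ Fin._≟_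

tripleEdges : ∀ {n} → Triple n → List (Pair n)
tripleEdges (i , j , k) = (i , j) ∷ (i , k) ∷ (j , k) ∷ []

module _ {n : ℕ} (G : Graph n) where
  open Graph G

  IsEdge : Pred (Pair n) 0ℓ
  IsEdge (i , j) = i Fin.< j × Adj i j

  isEdge? : U.Decidable IsEdge
  isEdge? (i , j) = (i Fin.<? j) ×-dec adj? i j

  IsTriangle : Pred (Triple n) 0ℓ
  IsTriangle t = All IsEdge (tripleEdges t)

  isTriangle? : U.Decidable IsTriangle
  isTriangle? t = all? isEdge? (tripleEdges t)

  edges : List (Pair n)
  edges = filter isEdge? (cartesianProduct (allFin n) (allFin n))

  triangles : List (Triple n)
  triangles =
    filter isTriangle?
      (cartesianProduct (allFin n) (cartesianProduct (allFin n) (allFin n)))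

  numEdges : ℕ
  numEdges = length edges

-- When xs has no repetitions, sublists xs lists each subset of xs exactly
-- once, and the size of the subset is the length of the sublist.

sublists : ∀ {A : Set} → List A → List (List A)
sublists []       = [ [] ]
sublists (x ∷ xs) = map (x ∷_) (sublists xs) ++ sublists xs

module _ {n : ℕ} where
  open DecMembership (_≟ₚ_ {n}) using (_∈?_)
  open DecDisjoint (_≟ₚ_ {n}) using (disjoint?)

  Meets : List (Pair n) → Pred (Triple n) 0ℓ
  Meets F t = Any (_∈ F) (tripleEdges t)

  meets? : ∀ F → U.Decidable (Meets F)
  meets? F t = any? (_∈? F) (tripleEdges t)

  EdgeDisjoint : Rel (Triple n) 0ℓ
  EdgeDisjoint s t = Disjoint (tripleEdges s) (tripleEdges t)

  edgeDisjoint? : Decidable EdgeDisjoint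
  edgeDisjoint? s t = disjoint? (tripleEdges s) (tripleEdges t)

  IsTriangleCover : Graph n → Pred (List (Pair n)) 0ℓ
  IsTriangleCover G F = All (Meets F) (triangles G)

  isTriangleCover? : ∀ G → U.Decidable (IsTriangleCover G)
  isTriangleCover? G F = all? (meets? F) (triangles G)

  IsTrianglePacking : Pred (List (Triple n)) 0ℓ
  IsTrianglePacking = AllPairs EdgeDisjoint

  isTrianglePacking? : U.Decidable IsTrianglePacking
  isTrianglePacking? = allPairs? edgeDisjoint?

  -- The first arguments of min and max do not affect the result: the whole
  -- edge set is itself a cover, and the empty set is itself a packing.

  τ₃ : Graph n → ℕ
  τ₃ G =
    min (numEdges G)
        (map length (filter (isTriangleCover? G) (sublists (edges G))))

  ν₃ : Graph n → ℕ
  ν₃ G =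
    max 0 (map length (filter isTrianglePacking? (sublists (triangles G))))

fromℕ : ℕ → ℚ
fromℕ k = + k / 1

TendsToInfinity : (ℕ → ℕ) → Set
TendsToInfinity n = ∀ M → ∃[ J ] (∀ j → J ℕ.≤ j → M ℕ.≤ n j)

TendsToZero : (ℕ → ℚ) → Set
TendsToZero ε = ∀ δ → 0ℚ < δ → ∃[ J ] (∀ j → J ℕ.≤ j → ∣ ε j ∣ < δ)

{-# OPTIONS --safe #-}

-- The graph is a union of two edge-disjoint graphs A and M with the same number of edges on the same
-- vertices. A is quasirandom, and the quadratic form of M dominates that of the constant matrix of
-- the same density. Let T = TA ∪ TM be triangle-free and U(x) the TA-neighbourhood of x, of size a(x).
-- With f the vector a(v)^(-1/2) on U(x), the quadratic form of M at f is bounded below by the density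
-- of M times (∑ f)²; summing over x and using a(x)/a(v) + a(v)/a(x) ≥ 2 this is at least, up to scale,
-- the number of edges of TA. It only involves edges uv of M outside TM, and quasirandomness of A bounds
-- the codegree of u and v in TA by the density of A times √(a(u) a(v)), so it is at most |M| - |TM|.
-- Hence |T| ≤ |M| + o(n²) = |G| / 2 + o(n²), that is, τ₃ is at least |G| / 2 - o(n²).
--
-- M is made of clusters (C, inside the clusters) and of quasirandom bipartite graphs (B) along
-- the edges of a bounded triangle-free graph whose least eigenvalue is small compared to its degree,
-- so that few C-edges make the form positive. That graph is the union of many copies of the Cayley
-- graph of (ℤ/p)² with connection set ± (x, x²), p ≡ 2 mod 3. Giving weight 0 to B, 1/2 to A, and 1
-- to C and to the few A-edges closing a path of two B-edges yields a fractional triangle cover, so ν₃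
-- is at most about |A| / 2 = |G| / 4.

module Submission where

open import Defs
open import Relation.Binary.PropositionalEquality

-- All estimates are proved over the integers with explicit scale factors; division is postponed to
-- the end. Spectral facts are replaced by second moments: functions rotated by amounts whose
-- pairwise differences are injective decorrelate exactly, which bounds both the Cayley graph and
-- the colouring. The root of a(v) becomes an integer s with a(v) + n/t ≤ s² ≤ a(v) + 4n/t; the
-- added n/t keeps vertices of small degree from carrying large weight, and (3n)! is a common
-- multiple of all s.
--
-- The condition p ≡ 2 mod 3 makes x² + xy + y² anisotropic modulo p, which rules out triangles
-- whose three arcs form a directed cycle.
--
-- The order of choices matters: α fixes q, then p, κ and the number of copies, hence β. Only then
-- come t = j + 1 and a prime P ≥ t⁴, so the error is O(1/t) with a constant depending on q alone.
-- The two corrections to the weight |A| / 2, from closed paths and from C, are each at most a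
-- fraction 1/(4q) of it: the first because there are 16q copies, the second because p is large
-- against κ, which is about √p.

module Integral where

  import Data.Fin.Properties as Fin
  import Data.List.Membership.DecPropositional as DecMembership
  import Data.List.Relation.Unary.All.Properties as All
  import Data.Nat.DivMod as ℕ
  import Data.Nat.Divisibility as ℕ
  import Data.Nat.ListAction as List
  import Data.Nat.ListAction.Properties as List
  import Data.Nat.Properties as ℕ
  import Data.Nat.Tactic.RingSolver as ℕSolver
  import Relation.Unary as U
  open import Data.Bool.Base using (if_then_else_)
  open import Data.Empty using (⊥; ⊥-elim)
  open import Data.Fin.Base as Fin using (Fin; zero; suc; toℕ; fromℕ<; combine; remQuot)
  open import Data.Fin.Properties
    using (_≟_; suc-injective; toℕ<n; toℕ-fromℕ<; toℕ-injective; remQuot-combine; combine-remQuot)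
  open import Data.Integer.Base hiding (suc; pred)
  open import Data.Integer.DivMod using (_%ℕ_; _/ℕ_; a≡a%ℕn+[a/ℕn]*n; n%ℕd<d)
  open import Data.Integer.Divisibility.Signed
  open import Data.Integer.Properties hiding (_≟_)
  open import Data.Integer.Tactic.RingSolver using (solve-∀)
  open import Data.List.Base
    using (List; []; _∷_; _++_; map; filter; foldr; length; tabulate; allFin; cartesianProduct)
  open import Data.List.Extrema.Nat using (argmin-all; argmax-all)
  open import Data.List.Membership.Propositional using (_∈_; find)
  open import Data.List.Membership.Propositional.Properties using (∈-filter⁺; ∈-cartesianProduct⁺; ∈-allFin)
  open import Data.List.Relation.Unary.All as All using (All; []; _∷_)
  open import Data.List.Relation.Unary.AllPairs using ([]; _∷_)
  open import Data.List.Relation.Unary.Any as Any using (here; there)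
  open import Data.Nat.Base as ℕ using (ℕ; zero; suc; _!)
  open import Data.Nat.Primality using (Prime; euclidsLemma; prime⇒nonZero; prime⇒nonTrivial)
  open import Data.Nat.Primality.Factorisation using (PrimeFactorisation; factorise)
  open import Data.Product.Base using (Σ-syntax; _×_; _,_; proj₁; proj₂)
  open import Data.Product.Properties using (,-injectiveˡ; ,-injectiveʳ)
  open import Data.Sum.Base as Sum using (_⊎_; inj₁; inj₂)
  open import Function.Base using (_∘_; id; case_of_)
  open import Relation.Binary.Definitions using (tri<; tri≈; tri>)
  open import Relation.Nullary
  open import Relation.Nullary.Decidable using (_×-dec_; ¬?; toWitnessFalse)
  import Algebra.Properties.Semiring.Sum +-*-semiring as FinSum

  -- Integer inequalities

  sub-nonneg : ∀ {x y} → x ≤ y → 0ℤ ≤ y - x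
  sub-nonneg = i≤j⇒0≤j-i

  from-sub : ∀ {x y d} → 0ℤ ≤ d → y ≡ x + d → x ≤ y
  from-sub {x} {y} {d} 0≤d refl = begin
    x       ≡⟨ +-identityʳ x ⟨
    x + 0ℤ  ≤⟨ +-monoʳ-≤ x 0≤d ⟩
    x + d   ∎
    where open ≤-Reasoning

  +-nonneg : ∀ {x y} → 0ℤ ≤ x → 0ℤ ≤ y → 0ℤ ≤ x + y
  +-nonneg = +-mono-≤

  *-nonneg : ∀ {x y} → 0ℤ ≤ x → 0ℤ ≤ y → 0ℤ ≤ x * y
  *-nonneg {+ m} {+ n} _ _ rewrite sym (pos-* m n) = +≤+ ℕ.z≤n

  pos-nonneg : ∀ {n} → 0ℤ ≤ + n
  pos-nonneg = +≤+ ℕ.z≤n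

  square-nonneg : ∀ x → 0ℤ ≤ x * x
  square-nonneg (+ n)    = *-nonneg {+ n} pos-nonneg pos-nonneg
  square-nonneg -[1+ n ] = +≤+ ℕ.z≤n

  *-monoˡ : ∀ c {x y} → 0ℤ ≤ c → x ≤ y → c * x ≤ c * y
  *-monoˡ (+ n) _ x≤y = *-monoˡ-≤-nonNeg (+ n) x≤y

  *-mono : ∀ {a b c d} → 0ℤ ≤ a → 0ℤ ≤ d → a ≤ b → c ≤ d → a * c ≤ b * d
  *-mono {a} {b} {c} {d} 0≤a 0≤d a≤b c≤d = ≤-trans (*-monoˡ a 0≤a c≤d)
    (subst₂ _≤_ (*-comm d a) (*-comm d b) (*-monoˡ d 0≤d a≤b))

  *-cancel : ∀ {c x y} → 0ℤ < c → c * x ≤ c * y → x ≤ y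
  *-cancel {c} {x} {y} 0<c = *-cancelˡ-≤-pos x y c {{positive 0<c}}

  *-pos : ∀ {x y} → 0ℤ < x → 0ℤ < y → 0ℤ < x * y
  *-pos {+ suc m} {+ suc n} _ _ = +<+ (ℕ.s≤s ℕ.z≤n)
  *-pos {+ zero} (+<+ ())
  *-pos {+ suc m} {+ zero} _ (+<+ ())

  -- Sums of integers over Fin n

  -- opaque, so that equations between sums can be unified summand by summand
  opaque
    ∑ : ∀ {n} → (Fin n → ℤ) → ℤ
    ∑ = FinSum.sum

  ∑-syntax : ∀ {n} → (Fin n → ℤ) → ℤ
  ∑-syntax = ∑
  infixr 8 ∑-syntax
  syntax ∑-syntax (λ i → x) = ∑[ i ] x

  opaque
    unfolding ∑

    ∑-zero : (f : Fin 0 → ℤ) → ∑ f ≡ 0ℤ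
    ∑-zero f = refl

    ∑-suc : ∀ {n} (f : Fin (suc n) → ℤ) → ∑ f ≡ f zero + ∑ (f ∘ suc)
    ∑-suc f = refl

    ∑-cong : ∀ {n} {f g : Fin n → ℤ} → (∀ i → f i ≡ g i) → ∑ f ≡ ∑ g
    ∑-cong = FinSum.sum-cong-≗

    ∑-+ : ∀ {n} (f g : Fin n → ℤ) → ∑[ i ] (f i + g i) ≡ ∑ f + ∑ g
    ∑-+ = FinSum.∑-distrib-+

    ∑-comm : ∀ {m n} (f : Fin m → Fin n → ℤ) → ∑[ i ] ∑[ j ] f i j ≡ ∑[ j ] ∑[ i ] f i j
    ∑-comm = FinSum.∑-comm

    ∑-*ˡ : ∀ {n} c (f : Fin n → ℤ) → ∑[ i ] (c * f i) ≡ c * ∑ f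
    ∑-*ˡ c f = sym (FinSum.*-distribˡ-sum c f)

    ∑-*ʳ : ∀ {n} c (f : Fin n → ℤ) → ∑[ i ] (f i * c) ≡ ∑ f * c
    ∑-*ʳ c f = sym (FinSum.*-distribʳ-sum c f)

    ∑-neg : ∀ {n} (f : Fin n → ℤ) → ∑[ i ] (- f i) ≡ - ∑ f
    ∑-neg {zero}  f = refl
    ∑-neg {suc n} f = trans (cong (_+_ (- f zero)) (∑-neg (f ∘ suc))) (sym (neg-distrib-+ (f zero) (∑ (f ∘ suc))))

    ∑-mono : ∀ {n} {f g : Fin n → ℤ} → (∀ i → f i ≤ g i) → ∑ f ≤ ∑ g
    ∑-mono {zero}  f≤g = ≤-refl
    ∑-mono {suc n} f≤g = +-mono-≤ (f≤g zero) (∑-mono (f≤g ∘ suc))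

    ∑-const : ∀ n c → ∑ {n} (λ _ → c) ≡ + n * c
    ∑-const zero    c = refl
    ∑-const (suc n) c = trans (cong (_+_ c) (∑-const n c)) (sym (suc-* (+ n) c))

  ∑-minus : ∀ {n} (f g : Fin n → ℤ) → ∑[ i ] (f i - g i) ≡ ∑ f - ∑ g
  ∑-minus f g = trans (∑-+ f (λ i → - g i)) (cong (_+_ (∑ f)) (∑-neg g))

  ∑-0 : ∀ {n} {f : Fin n → ℤ} → (∀ i → f i ≡ 0ℤ) → ∑ f ≡ 0ℤ
  ∑-0 {n} f≡0 = trans (∑-cong f≡0) (trans (∑-const n 0ℤ) (*-zeroʳ (+ n)))

  ∑-nonneg : ∀ {n} {f : Fin n → ℤ} → (∀ i → 0ℤ ≤ f i) → 0ℤ ≤ ∑ f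
  ∑-nonneg {n} {f} 0≤f = subst (_≤ ∑ f) (∑-0 {n} (λ _ → refl)) (∑-mono 0≤f)

  ∑-prod : ∀ {m n} (f : Fin m → ℤ) (g : Fin n → ℤ) → ∑[ i ] ∑[ j ] (f i * g j) ≡ ∑ f * ∑ g
  ∑-prod f g = trans (∑-cong (λ i → ∑-*ˡ (f i) g)) (∑-*ʳ (∑ g) f)

  term≤∑ : ∀ {n} (f : Fin n → ℤ) → (∀ i → 0ℤ ≤ f i) → ∀ i → f i ≤ ∑ f
  term≤∑ f 0≤f zero = subst₂ _≤_ (+-identityʳ (f zero)) (sym (∑-suc f)) (+-monoʳ-≤ (f zero) (∑-nonneg (0≤f ∘ suc)))
  term≤∑ f 0≤f (suc i) = subst₂ _≤_ (+-identityˡ (f (suc i))) (sym (∑-suc f))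
    (+-mono-≤ (0≤f zero) (term≤∑ (f ∘ suc) (0≤f ∘ suc) i))

  -- Twice the difference of the two sides is the double sum of (f i - f j)².
  cauchy : ∀ {n} (f : Fin n → ℤ) → ∑ f * ∑ f ≤ + n * ∑[ i ] (f i * f i)
  cauchy {n} f = *-cancel {+ 2} (+<+ (ℕ.s≤s ℕ.z≤n)) (from-sub (∑-nonneg λ i → ∑-nonneg λ j → square-nonneg (f i - f j)) eq)
    where
    open ≡-Reasoning
    q = ∑[ i ] (f i * f i)
    expand : ∀ a b → (a - b) * (a - b) ≡ (a * a - + 2 * (a * b)) + b * b
    expand = solve-∀
    inner : ∀ i → ∑[ j ] ((f i - f j) * (f i - f j)) ≡ (+ n * (f i * f i) - + 2 * (f i * ∑ f)) + q
    inner i = begin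
      ∑[ j ] ((f i - f j) * (f i - f j))
        ≡⟨ ∑-cong (λ j → expand (f i) (f j)) ⟩
      ∑[ j ] ((f i * f i - + 2 * (f i * f j)) + f j * f j)
        ≡⟨ ∑-+ (λ j → f i * f i - + 2 * (f i * f j)) (λ j → f j * f j) ⟩
      ∑[ j ] (f i * f i - + 2 * (f i * f j)) + q
        ≡⟨ cong (λ z → z + q) (∑-minus (λ j → f i * f i) (λ j → + 2 * (f i * f j))) ⟩
      (∑ {n} (λ j → f i * f i) - ∑[ j ] (+ 2 * (f i * f j))) + q
        ≡⟨ cong (λ z → z + q) (cong₂ _-_ (∑-const n (f i * f i))
             (trans (∑-*ˡ (+ 2) (λ j → f i * f j)) (cong (+ 2 *_) (∑-*ˡ (f i) f)))) ⟩
      (+ n * (f i * f i) - + 2 * (f i * ∑ f)) + q ∎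
    total : ∑[ i ] ∑[ j ] ((f i - f j) * (f i - f j)) ≡ (+ n * q - + 2 * (∑ f * ∑ f)) + + n * q
    total = begin
      ∑[ i ] ∑[ j ] ((f i - f j) * (f i - f j))
        ≡⟨ ∑-cong inner ⟩
      ∑[ i ] ((+ n * (f i * f i) - + 2 * (f i * ∑ f)) + q)
        ≡⟨ ∑-+ (λ i → + n * (f i * f i) - + 2 * (f i * ∑ f)) (λ _ → q) ⟩
      ∑[ i ] (+ n * (f i * f i) - + 2 * (f i * ∑ f)) + ∑ {n} (λ _ → q)
        ≡⟨ cong₂ _+_ (∑-minus (λ i → + n * (f i * f i)) (λ i → + 2 * (f i * ∑ f))) (∑-const n q) ⟩
      (∑[ i ] (+ n * (f i * f i)) - ∑[ i ] (+ 2 * (f i * ∑ f))) + + n * q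
        ≡⟨ cong (λ z → z + + n * q) (cong₂ _-_ (∑-*ˡ (+ n) (λ i → f i * f i))
             (trans (∑-*ˡ (+ 2) (λ i → f i * ∑ f)) (cong (+ 2 *_) (∑-*ʳ (∑ f) f)))) ⟩
      (+ n * q - + 2 * (∑ f * ∑ f)) + + n * q ∎
    fin : ∀ a b → + 2 * a ≡ + 2 * b + ((a - + 2 * b) + a)
    fin = solve-∀
    eq : + 2 * (+ n * q) ≡ + 2 * (∑ f * ∑ f) + ∑[ i ] ∑[ j ] ((f i - f j) * (f i - f j))
    eq = trans (fin (+ n * q) (∑ f * ∑ f)) (cong (_+_ (+ 2 * (∑ f * ∑ f))) (sym total))

  -- Iverson bracket

  ⟦_⟧ : ∀ {a} {A : Set a} → Dec A → ℤ
  ⟦ d ⟧ = if does d then 1ℤ else 0ℤ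

  ⟦⟧-nonneg : ∀ {a} {A : Set a} (d : Dec A) → 0ℤ ≤ ⟦ d ⟧
  ⟦⟧-nonneg (yes _) = +≤+ ℕ.z≤n
  ⟦⟧-nonneg (no _)  = +≤+ ℕ.z≤n

  ⟦⟧≤1 : ∀ {a} {A : Set a} (d : Dec A) → ⟦ d ⟧ ≤ 1ℤ
  ⟦⟧≤1 (yes _) = ≤-refl
  ⟦⟧≤1 (no _)  = +≤+ ℕ.z≤n

  ⟦⟧-yes : ∀ {a} {A : Set a} (d : Dec A) → A → ⟦ d ⟧ ≡ 1ℤ
  ⟦⟧-yes (yes _) _ = refl
  ⟦⟧-yes (no ¬a) a = ⊥-elim (¬a a)

  ⟦⟧-no : ∀ {a} {A : Set a} (d : Dec A) → ¬ A → ⟦ d ⟧ ≡ 0ℤ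
  ⟦⟧-no (yes a) ¬a = ⊥-elim (¬a a)
  ⟦⟧-no (no _)  _  = refl

  ⟦⟧-⇔ : ∀ {a b} {A : Set a} {B : Set b} (d : Dec A) (e : Dec B) → (A → B) → (B → A) → ⟦ d ⟧ ≡ ⟦ e ⟧
  ⟦⟧-⇔ (yes a) e f g = sym (⟦⟧-yes e (f a))
  ⟦⟧-⇔ (no ¬a) e f g = sym (⟦⟧-no e (¬a ∘ g))

  ⟦⟧-mono : ∀ {a b} {A : Set a} {B : Set b} (d : Dec A) (e : Dec B) → (A → B) → ⟦ d ⟧ ≤ ⟦ e ⟧
  ⟦⟧-mono (yes a) e f = ≤-reflexive (sym (⟦⟧-yes e (f a)))
  ⟦⟧-mono (no _)  e f = ⟦⟧-nonneg e

  ∑-δ : ∀ {n} (a : Fin n) (f : Fin n → ℤ) → ∑[ z ] (⟦ a ≟ z ⟧ * f z) ≡ f a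
  ∑-δ zero f = trans (∑-suc (λ z → ⟦ zero ≟ z ⟧ * f z)) (trans (cong₂ _+_ (*-identityˡ (f zero))
    (∑-0 (λ z → *-zeroˡ (f (suc z))))) (+-identityʳ (f zero)))
  ∑-δ (suc a) f = trans (∑-suc (λ z → ⟦ suc a ≟ z ⟧ * f z)) (trans (cong₂ _+_ (*-zeroˡ (f zero)) (∑-δ a (f ∘ suc))) (+-identityˡ (f (suc a))))

  ∑-δ1 : ∀ {n} (a : Fin n) → ∑[ z ] ⟦ a ≟ z ⟧ ≡ 1ℤ
  ∑-δ1 a = trans (∑-cong (λ z → sym (*-identityʳ ⟦ a ≟ z ⟧))) (∑-δ a (λ _ → 1ℤ))

  -- An injection has at most one preimage of each point; the numbers of preimages
  -- add up to n, so each is exactly one.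
  ∑-injective : ∀ {n} (g : Fin n → Fin n) → (∀ {x y} → g x ≡ g y → x ≡ y) →
    (f : Fin n → ℤ) → ∑[ y ] f (g y) ≡ ∑ f
  ∑-injective {n} g inj f = begin
    ∑[ y ] f (g y)                             ≡⟨ ∑-cong (λ y → sym (∑-δ (g y) f)) ⟩
    ∑[ y ] ∑[ z ] (⟦ g y ≟ z ⟧ * f z)          ≡⟨ ∑-comm (λ y z → ⟦ g y ≟ z ⟧ * f z) ⟩
    ∑[ z ] ∑[ y ] (⟦ g y ≟ z ⟧ * f z)          ≡⟨ ∑-cong (λ z → ∑-*ʳ (f z) (λ y → ⟦ g y ≟ z ⟧)) ⟩
    ∑[ z ] (c z * f z)                         ≡⟨ ∑-cong (λ z → trans (cong (_* f z) (c≡1 z)) (*-identityˡ (f z))) ⟩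
    ∑ f                                        ∎
    where
    open ≡-Reasoning
    c : Fin n → ℤ
    c z = ∑[ y ] ⟦ g y ≟ z ⟧
    c≤1 : ∀ z → c z ≤ 1ℤ
    c≤1 z = count-≤1 (λ y → g y ≟ z) (λ p q → inj (trans p (sym q)))
      where
      count-≤1 : ∀ {k} {A : Fin k → Set} (d : ∀ y → Dec (A y)) → (∀ {x y} → A x → A y → x ≡ y) → ∑[ y ] ⟦ d y ⟧ ≤ 1ℤ
      count-≤1 {zero} d u = subst (_≤ 1ℤ) (sym (∑-zero (λ y → ⟦ d y ⟧))) (+≤+ ℕ.z≤n)
      count-≤1 {suc k} {A} d u = subst (_≤ 1ℤ) (sym (∑-suc (λ y → ⟦ d y ⟧))) (head-or-tail (d zero))
        where
        head-or-tail : (d₀ : Dec (A zero)) → ⟦ d₀ ⟧ + ∑[ y ] ⟦ d (suc y) ⟧ ≤ 1ℤ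
        head-or-tail (no _) = subst (_≤ 1ℤ) (sym (+-identityˡ _)) (count-≤1 (d ∘ suc) (λ p q → suc-injective (u p q)))
        head-or-tail (yes a) = ≤-reflexive (cong (_+_ 1ℤ) (∑-0 (λ y → ⟦⟧-no (d (suc y)) (λ b → case u a b of λ ()))))
    deficit : ∑[ z ] (1ℤ - c z) ≡ 0ℤ
    deficit = begin
      ∑[ z ] (1ℤ - c z)        ≡⟨ ∑-minus (λ _ → 1ℤ) c ⟩
      ∑ {n} (λ _ → 1ℤ) - ∑ c   ≡⟨ cong (_-_ (∑ {n} (λ _ → 1ℤ))) (trans (∑-comm (λ z y → ⟦ g y ≟ z ⟧)) (∑-cong (λ y → ∑-δ1 (g y)))) ⟩
      ∑ {n} (λ _ → 1ℤ) - ∑ {n} (λ _ → 1ℤ)  ≡⟨ +-inverseʳ (∑ {n} (λ _ → 1ℤ)) ⟩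
      0ℤ ∎
    c≡1 : ∀ z → c z ≡ 1ℤ
    c≡1 z = ≤-antisym (c≤1 z) (0≤i-j⇒j≤i (subst (λ x → 0ℤ ≤ c z - x) refl
      (subst (0ℤ ≤_) (flip-sub 1ℤ (c z)) (neg-mono-≤ (subst (1ℤ - c z ≤_) deficit
        (term≤∑ (λ z → 1ℤ - c z) (λ z → sub-nonneg (c≤1 z)) z))))))
      where
      flip-sub : ∀ x y → - (x - y) ≡ y - x
      flip-sub = solve-∀

  -- Residues

  %-≡⇒∣ : ∀ a b n .{{_ : ℕ.NonZero n}} → a ℕ.% n ≡ b ℕ.% n → + n ∣ + a - + b
  %-≡⇒∣ a b n eq = divides (+ (a ℕ./ n) - + (b ℕ./ n)) (begin
    + a - + b
      ≡⟨ cong₂ _-_ (split a) (split b) ⟩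
    (+ (a ℕ.% n) + + (a ℕ./ n) * + n) - (+ (b ℕ.% n) + + (b ℕ./ n) * + n)
      ≡⟨ cong (λ r → (+ r + + (a ℕ./ n) * + n) - (+ (b ℕ.% n) + + (b ℕ./ n) * + n)) eq ⟩
    (+ (b ℕ.% n) + + (a ℕ./ n) * + n) - (+ (b ℕ.% n) + + (b ℕ./ n) * + n)
      ≡⟨ simplify (+ (b ℕ.% n)) (+ (a ℕ./ n)) (+ (b ℕ./ n)) (+ n) ⟩
    (+ (a ℕ./ n) - + (b ℕ./ n)) * + n ∎)
    where
    open ≡-Reasoning
    split : ∀ c → + c ≡ + (c ℕ.% n) + + (c ℕ./ n) * + n
    split c = trans (cong +_ (ℕ.m≡m%n+[m/n]*n c n)) (cong (_+_ (+ (c ℕ.% n))) (pos-* (c ℕ./ n) n))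
    simplify : ∀ r x y m → (r + x * m) - (r + y * m) ≡ (x - y) * m
    simplify = solve-∀

  ∣-prime : ∀ {p} → Prime p → ∀ x y → + p ∣ x * y → (+ p ∣ x) ⊎ (+ p ∣ y)
  ∣-prime {p} pr x y d = Sum.map ∣ᵤ⇒∣ ∣ᵤ⇒∣
    (euclidsLemma ∣ x ∣ ∣ y ∣ pr (subst (λ k → p ℕ.∣ k) (abs-* x y) (∣⇒∣ᵤ d)))

  -- Two representatives below `n` differ by less than `n` in absolute value, so only the difference
  -- zero is divisible.
  Fin-∤ : ∀ {n} (a b : Fin n) → a ≢ b → ¬ (+ n ∣ + toℕ a - + toℕ b)
  Fin-∤ {n} a b a≢b d with ∣ + toℕ a - + toℕ b ∣ in eq | ∣⇒∣ᵤ d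
  ... | zero  | _  = a≢b (toℕ-injective (+-injective (i-j≡0⇒i≡j (+ toℕ a) (+ toℕ b) (∣i∣≡0⇒i≡0 eq))))
  ... | suc k | n∣k = ℕ.>⇒∤ (subst (ℕ._< n) eq bound) n∣k
    where
    bound : ∣ + toℕ a - + toℕ b ∣ ℕ.< n
    bound rewrite m-n≡m⊖n (toℕ a) (toℕ b) = ℕ.≤-<-trans (∣m⊝n∣≤m⊔n (toℕ a) (toℕ b)) (ℕ.⊔-pres-<m (toℕ<n a) (toℕ<n b))

  module _ {n : ℕ} .{{_ : ℕ.NonZero n}} where

    rot : ℕ → Fin n → Fin n
    rot k y = fromℕ< (ℕ.m%n<n (k ℕ.+ toℕ y) n)

    toℕ-rot : ∀ k y → toℕ (rot k y) ≡ (k ℕ.+ toℕ y) ℕ.% n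
    toℕ-rot k y = toℕ-fromℕ< (ℕ.m%n<n (k ℕ.+ toℕ y) n)

    rot-≡⇒∣ : ∀ k k′ y y′ → rot k y ≡ rot k′ y′ → + n ∣ (+ k + + toℕ y) - (+ k′ + + toℕ y′)
    rot-≡⇒∣ k k′ y y′ eq = %-≡⇒∣ (k ℕ.+ toℕ y) (k′ ℕ.+ toℕ y′) n
      (trans (sym (toℕ-rot k y)) (trans (cong toℕ eq) (toℕ-rot k′ y′)))

    rot-injective : ∀ k {y y′} → rot k y ≡ rot k y′ → y ≡ y′
    rot-injective k {y} {y′} eq with y ≟ y′
    ... | yes p = p
    ... | no y≢y′ = ⊥-elim (Fin-∤ y y′ y≢y′ (subst (+ n ∣_) (cancel (+ k) (+ toℕ y) (+ toℕ y′)) (rot-≡⇒∣ k k y y′ eq)))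
      where
      cancel : ∀ k y y′ → (k + y) - (k + y′) ≡ y - y′
      cancel = solve-∀

    ∑-rot : ∀ k (f : Fin n → ℤ) → ∑[ y ] f (rot k y) ≡ ∑ f
    ∑-rot k = ∑-injective (rot k) (rot-injective k)

    rot-rot : ∀ d k y → rot d (rot k y) ≡ rot (d ℕ.+ k) y
    rot-rot d k y = toℕ-injective (begin
      toℕ (rot d (rot k y))
        ≡⟨ toℕ-rot d (rot k y) ⟩
      (d ℕ.+ toℕ (rot k y)) ℕ.% n
        ≡⟨ cong (λ z → (d ℕ.+ z) ℕ.% n) (toℕ-rot k y) ⟩
      (d ℕ.+ (k ℕ.+ toℕ y) ℕ.% n) ℕ.% n
        ≡⟨ ℕ.%-distribˡ-+ d ((k ℕ.+ toℕ y) ℕ.% n) n ⟩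
      (d ℕ.% n ℕ.+ (k ℕ.+ toℕ y) ℕ.% n ℕ.% n) ℕ.% n
        ≡⟨ cong (λ z → (d ℕ.% n ℕ.+ z) ℕ.% n) (ℕ.m%n%n≡m%n (k ℕ.+ toℕ y) n) ⟩
      (d ℕ.% n ℕ.+ (k ℕ.+ toℕ y) ℕ.% n) ℕ.% n
        ≡⟨ ℕ.%-distribˡ-+ d (k ℕ.+ toℕ y) n ⟨
      (d ℕ.+ (k ℕ.+ toℕ y)) ℕ.% n
        ≡⟨ cong (ℕ._% n) (ℕ.+-assoc d k (toℕ y)) ⟨
      (d ℕ.+ k ℕ.+ toℕ y) ℕ.% n
        ≡⟨ toℕ-rot (d ℕ.+ k) y ⟨
      toℕ (rot (d ℕ.+ k) y) ∎)
      where open ≡-Reasoning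

    -- the rotation by k′ - k, written without subtraction
    rot-diff : ℕ → ℕ → Fin n → Fin n
    rot-diff k k′ = rot (k′ ℕ.+ (n ℕ.∸ 1) ℕ.* k)

    rot-diff-rot : ∀ k k′ y → rot-diff k k′ (rot k y) ≡ rot k′ y
    rot-diff-rot k k′ y = trans (rot-rot (k′ ℕ.+ (n ℕ.∸ 1) ℕ.* k) k y) (toℕ-injective (begin
      toℕ (rot (k′ ℕ.+ (n ℕ.∸ 1) ℕ.* k ℕ.+ k) y)
        ≡⟨ toℕ-rot (k′ ℕ.+ (n ℕ.∸ 1) ℕ.* k ℕ.+ k) y ⟩
      (k′ ℕ.+ (n ℕ.∸ 1) ℕ.* k ℕ.+ k ℕ.+ toℕ y) ℕ.% n
        ≡⟨ cong (ℕ._% n) (trans (regroup (n ℕ.∸ 1) k k′ (toℕ y)) (cong (λ z → k′ ℕ.+ toℕ y ℕ.+ k ℕ.* z) (ℕ.m+[n∸m]≡n (ℕ.>-nonZero⁻¹ n)))) ⟩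
      (k′ ℕ.+ toℕ y ℕ.+ k ℕ.* n) ℕ.% n
        ≡⟨ ℕ.[m+kn]%n≡m%n (k′ ℕ.+ toℕ y) k n ⟩
      (k′ ℕ.+ toℕ y) ℕ.% n
        ≡⟨ toℕ-rot k′ y ⟨
      toℕ (rot k′ y) ∎))
      where
      open ≡-Reasoning
      regroup : ∀ m k k′ y → k′ ℕ.+ m ℕ.* k ℕ.+ k ℕ.+ y ≡ k′ ℕ.+ y ℕ.+ k ℕ.* (1 ℕ.+ m)
      regroup = ℕSolver.solve-∀

    -- Second moment of a family of functions on ℤ/n, the a-th one being rotated by k a y:
    -- distinct members are uncorrelated as soon as all differences k a′ - k a are injective mod n.
    module _ {N : ℕ} (k : Fin N → Fin n → ℕ)
      (k-inj : ∀ {a a′ y y′} → a ≢ a′ → y ≢ y′ →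
        ¬ (+ n ∣ (+ k a′ y - + k a y) - (+ k a′ y′ - + k a y′)))
      (G : Fin N → Fin n → ℤ) where

      correlation : Fin N → Fin N → ℤ
      correlation a a′ = ∑[ y ] ∑[ z ] (G a (rot (k a y) z) * G a′ (rot (k a′ y) z))

      correlation-diag : ∀ a → correlation a a ≡ + n * ∑[ z ] (G a z * G a z)
      correlation-diag a = trans (∑-cong (λ y → ∑-rot (k a y) (λ z → G a z * G a z))) (∑-const n _)

      -- For each `y`, rotating the summation variable leaves `G a z * G a′ (d y z)`. For fixed `z`
      -- the map sending `y` to `d y z` is a permutation, because the difference of the two
      -- rotations is injective in `y`; so the double sum factors.
      correlation-off : ∀ {a a′} → a ≢ a′ → correlation a a′ ≡ ∑ (G a) * ∑ (G a′)
      correlation-off {a} {a′} a≢a′ = begin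
        ∑[ y ] ∑[ z ] (G a (rot (k a y) z) * G a′ (rot (k a′ y) z))
          ≡⟨ ∑-cong (λ y → ∑-cong (λ z → cong (λ w → G a (rot (k a y) z) * G a′ w) (sym (rot-diff-rot (k a y) (k a′ y) z)))) ⟩
        ∑[ y ] ∑[ z ] (G a (rot (k a y) z) * G a′ (d y (rot (k a y) z)))
          ≡⟨ ∑-cong (λ y → ∑-rot (k a y) (λ z → G a z * G a′ (d y z))) ⟩
        ∑[ y ] ∑[ z ] (G a z * G a′ (d y z))
          ≡⟨ ∑-comm (λ y z → G a z * G a′ (d y z)) ⟩
        ∑[ z ] ∑[ y ] (G a z * G a′ (d y z))
          ≡⟨ ∑-cong (λ z → trans (∑-*ˡ (G a z) (λ y → G a′ (d y z)))
               (cong (G a z *_) (∑-injective (λ y → d y z) (d-inj z) (G a′)))) ⟩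
        ∑[ z ] (G a z * ∑ (G a′))
          ≡⟨ ∑-*ʳ (∑ (G a′)) (G a) ⟩
        ∑ (G a) * ∑ (G a′) ∎
        where
        open ≡-Reasoning
        d : Fin n → Fin n → Fin n
        d y = rot-diff (k a y) (k a′ y)
        m = n ℕ.∸ 1
        d-inj : ∀ z {y y′} → d y z ≡ d y′ z → y ≡ y′
        d-inj z {y} {y′} eq with y ≟ y′
        ... | yes p = p
        ... | no y≢y′ = ⊥-elim (k-inj a≢a′ y≢y′ (subst (+ n ∣_) (simplify (+ k a y) (+ k a′ y) (+ k a y′) (+ k a′ y′) (+ m) (+ toℕ z))
                (∣m∣n⇒∣m-n (subst (+ n ∣_) (cong₂ (λ u v → (u + + toℕ z) - (v + + toℕ z)) (cast y) (cast y′)) (rot-≡⇒∣ _ _ z z eq))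
                  (subst (_∣ (1ℤ + + m) * (+ k a y - + k a y′)) (cong +_ (ℕ.m+[n∸m]≡n (ℕ.>-nonZero⁻¹ n)))
                    (∣m⇒∣m*n (+ k a y - + k a y′) ∣-refl)))))
          where
          cast : ∀ y → + (k a′ y ℕ.+ m ℕ.* k a y) ≡ + k a′ y + + m * + k a y
          cast y = cong (_+_ (+ k a′ y)) (pos-* m (k a y))
          simplify : ∀ p p′ q q′ m z → ((p′ + m * p) + z - ((q′ + m * q) + z)) - (1ℤ + m) * (p - q) ≡ (p′ - p) - (q′ - q)
          simplify = solve-∀

      -- The off-diagonal product formula is used for all pairs `a`, `a′`, and the diagonal is then
      -- corrected by `e a`. For functions of mean zero only the diagonal survives.
      second-moment : ∑[ y ] ∑[ z ] (∑[ a ] G a (rot (k a y) z) * ∑[ a ] G a (rot (k a y) z))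
        ≡ (+ n * ∑[ a ] ∑[ z ] (G a z * G a z) + ∑[ a ] ∑ (G a) * ∑[ a ] ∑ (G a)) - ∑[ a ] (∑ (G a) * ∑ (G a))
      second-moment = begin
        ∑[ y ] ∑[ z ] (∑[ a ] G a (rot (k a y) z) * ∑[ a ] G a (rot (k a y) z))
          ≡⟨ ∑-cong (λ y → ∑-cong (λ z → ∑-prod (λ a → G a (rot (k a y) z)) (λ a → G a (rot (k a y) z)))) ⟨
        ∑[ y ] ∑[ z ] ∑[ a ] ∑[ a′ ] c y z a a′
          ≡⟨ ∑-cong (λ y → ∑-comm (λ z a → ∑[ a′ ] c y z a a′)) ⟩
        ∑[ y ] ∑[ a ] ∑[ z ] ∑[ a′ ] c y z a a′
          ≡⟨ ∑-comm (λ y a → ∑[ z ] ∑[ a′ ] c y z a a′) ⟩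
        ∑[ a ] ∑[ y ] ∑[ z ] ∑[ a′ ] c y z a a′
          ≡⟨ ∑-cong (λ a → ∑-cong (λ y → ∑-comm (λ z a′ → c y z a a′))) ⟩
        ∑[ a ] ∑[ y ] ∑[ a′ ] ∑[ z ] c y z a a′
          ≡⟨ ∑-cong (λ a → ∑-comm (λ y a′ → ∑[ z ] c y z a a′)) ⟩
        ∑[ a ] ∑[ a′ ] correlation a a′
          ≡⟨ ∑-cong (λ a → ∑-cong (λ a′ → split a a′)) ⟩
        ∑[ a ] ∑[ a′ ] (s a * s a′ + ⟦ a ≟ a′ ⟧ * e a)
          ≡⟨ ∑-cong (λ a → trans (∑-+ (λ a′ → s a * s a′) (λ a′ → ⟦ a ≟ a′ ⟧ * e a)) (cong (_+_ (∑[ a′ ] (s a * s a′))) (∑-δ a (λ _ → e a)))) ⟩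
        ∑[ a ] (∑[ a′ ] (s a * s a′) + e a)
          ≡⟨ ∑-+ (λ a → ∑[ a′ ] (s a * s a′)) e ⟩
        ∑[ a ] ∑[ a′ ] (s a * s a′) + ∑ e
          ≡⟨ cong₂ _+_ (∑-prod s s) (trans (∑-minus (λ a → + n * q a) (λ a → s a * s a)) (cong (_- ∑[ a ] (s a * s a)) (∑-*ˡ (+ n) q))) ⟩
        ∑ s * ∑ s + (+ n * ∑ q - ∑[ a ] (s a * s a))
          ≡⟨ rearrange (∑ s * ∑ s) (+ n * ∑ q) _ ⟩
        (+ n * ∑ q + ∑ s * ∑ s) - ∑[ a ] (s a * s a) ∎
        where
        open ≡-Reasoning
        c : Fin n → Fin n → Fin N → Fin N → ℤ
        c y z a a′ = G a (rot (k a y) z) * G a′ (rot (k a′ y) z)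
        s q e : Fin N → ℤ
        s a = ∑ (G a)
        q a = ∑[ z ] (G a z * G a z)
        e a = + n * q a - s a * s a
        rearrange : ∀ x y z → x + (y - z) ≡ (y + x) - z
        rearrange = solve-∀
        on-diag : ∀ x y → x ≡ y + 1ℤ * (x - y)
        on-diag = solve-∀
        split : ∀ a a′ → correlation a a′ ≡ s a * s a′ + ⟦ a ≟ a′ ⟧ * e a
        split a a′ with a ≟ a′
        ... | yes refl = trans (correlation-diag a) (on-diag (+ n * q a) (s a * s a))
        ... | no a≢a′ = trans (correlation-off a≢a′) (sym (trans (cong (_+_ (s a * s a′)) (*-zeroˡ (e a))) (+-identityʳ _)))

  -- Double sums

  ∑₂ : ∀ {m n} → (Fin m → Fin n → ℤ) → ℤ
  ∑₂ f = ∑[ i ] ∑ (f i)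

  ∑₂-cong : ∀ {m n} {f g : Fin m → Fin n → ℤ} → (∀ i j → f i j ≡ g i j) → ∑₂ f ≡ ∑₂ g
  ∑₂-cong f≡g = ∑-cong (λ i → ∑-cong (f≡g i))

  ∑₂-mono : ∀ {m n} {f g : Fin m → Fin n → ℤ} → (∀ i j → f i j ≤ g i j) → ∑₂ f ≤ ∑₂ g
  ∑₂-mono f≤g = ∑-mono (λ i → ∑-mono (f≤g i))

  ∑₂-nonneg : ∀ {m n} {f : Fin m → Fin n → ℤ} → (∀ i j → 0ℤ ≤ f i j) → 0ℤ ≤ ∑₂ f
  ∑₂-nonneg 0≤f = ∑-nonneg (λ i → ∑-nonneg (0≤f i))

  ∑₂-+ : ∀ {m n} (f g : Fin m → Fin n → ℤ) → ∑₂ (λ i j → f i j + g i j) ≡ ∑₂ f + ∑₂ g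
  ∑₂-+ f g = trans (∑-cong (λ i → ∑-+ (f i) (g i))) (∑-+ (λ i → ∑ (f i)) (λ i → ∑ (g i)))

  ∑₂-minus : ∀ {m n} (f g : Fin m → Fin n → ℤ) → ∑₂ (λ i j → f i j - g i j) ≡ ∑₂ f - ∑₂ g
  ∑₂-minus f g = trans (∑-cong (λ i → ∑-minus (f i) (g i))) (∑-minus (λ i → ∑ (f i)) (λ i → ∑ (g i)))

  ∑₂-*ˡ : ∀ {m n} c (f : Fin m → Fin n → ℤ) → ∑₂ (λ i j → c * f i j) ≡ c * ∑₂ f
  ∑₂-*ˡ c f = trans (∑-cong (λ i → ∑-*ˡ c (f i))) (∑-*ˡ c (λ i → ∑ (f i)))

  ∑₂-const : ∀ m n c → ∑₂ {m} {n} (λ _ _ → c) ≡ + m * (+ n * c)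
  ∑₂-const m n c = trans (∑-cong {m} (λ _ → ∑-const n c)) (∑-const m (+ n * c))

  ∑₂-linear : ∀ {m n} α (f : Fin m → Fin n → ℤ) β (g : Fin m → Fin n → ℤ) γ (h : Fin m → Fin n → ℤ) δ →
    ∑₂ (λ i j → α * f i j + β * g i j + γ * h i j + δ) ≡ α * ∑₂ f + β * ∑₂ g + γ * ∑₂ h + + m * (+ n * δ)
  ∑₂-linear {m} {n} α f β g γ h δ = begin
    ∑₂ (λ i j → α * f i j + β * g i j + γ * h i j + δ)
      ≡⟨ ∑₂-+ (λ i j → α * f i j + β * g i j + γ * h i j) (λ _ _ → δ) ⟩
    ∑₂ (λ i j → α * f i j + β * g i j + γ * h i j) + ∑₂ {m} {n} (λ _ _ → δ)
      ≡⟨ cong₂ _+_ (∑₂-+ (λ i j → α * f i j + β * g i j) (λ i j → γ * h i j)) (∑₂-const m n δ) ⟩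
    ∑₂ (λ i j → α * f i j + β * g i j) + ∑₂ (λ i j → γ * h i j) + + m * (+ n * δ)
      ≡⟨ cong (λ z → z + + m * (+ n * δ)) (cong₂ _+_
           (trans (∑₂-+ (λ i j → α * f i j) (λ i j → β * g i j)) (cong₂ _+_ (∑₂-*ˡ α f) (∑₂-*ˡ β g))) (∑₂-*ˡ γ h)) ⟩
    α * ∑₂ f + β * ∑₂ g + γ * ∑₂ h + + m * (+ n * δ) ∎
    where open ≡-Reasoning

  -- The planar Cayley graph on ℤ/p × ℤ/p

  -- Rotations take natural numbers, so the square (a - b)² is formed from the absolute difference.
  dist² : ∀ {n} → Fin n → Fin n → ℕ
  dist² a b = ℕ.∣ toℕ a - toℕ b ∣ ℕ.* ℕ.∣ toℕ a - toℕ b ∣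

  dist²-ℤ : ∀ {n} (a b : Fin n) → + dist² a b ≡ (+ toℕ a - + toℕ b) * (+ toℕ a - + toℕ b)
  dist²-ℤ a b = trans (pos-* ℕ.∣ toℕ a - toℕ b ∣ ℕ.∣ toℕ a - toℕ b ∣) (square (toℕ a) (toℕ b))
    where
    flip : ∀ x y → (x - y) * (x - y) ≡ (y - x) * (y - x)
    flip = solve-∀
    distance : ∀ x y → x ℕ.≤ y → + ℕ.∣ x - y ∣ ≡ + y - + x
    distance x y x≤y = trans (cong +_ (ℕ.m≤n⇒∣m-n∣≡n∸m x≤y)) (sym (trans (m-n≡m⊖n y x) (⊖-≥ x≤y)))
    square : ∀ x y → + ℕ.∣ x - y ∣ * + ℕ.∣ x - y ∣ ≡ (+ x - + y) * (+ x - + y)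
    square x y with ℕ.≤-total x y
    ... | inj₁ x≤y = trans (cong₂ _*_ (distance x y x≤y) (distance x y x≤y)) (flip (+ y) (+ x))
    ... | inj₂ y≤x rewrite ℕ.∣-∣-comm x y = cong₂ _*_ (distance y x y≤x) (distance y x y≤x)

  module Planar {p : ℕ} (p-prime : Prime p) (p∤2 : ¬ (+ p ∣ + 2)) where

    private instance
      p≢0 : ℕ.NonZero p
      p≢0 = prime⇒nonZero p-prime

    -- Polarisation: (a′ - y)² - (a - y)² is affine in y, so its increment is 2 (a - a′)(y - y′), a
    -- product of three factors prime to p.
    dist²-inj : ∀ {a a′ y y′ : Fin p} → a ≢ a′ → y ≢ y′ →
      ¬ (+ p ∣ (+ dist² a′ y - + dist² a y) - (+ dist² a′ y′ - + dist² a y′))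
    dist²-inj {a} {a′} {y} {y′} a≢a′ y≢y′ d
      with ∣-prime p-prime _ _ (subst (+ p ∣_) expand d)
      where
      polarize : ∀ a a′ y y′ → ((a′ - y) * (a′ - y) - (a - y) * (a - y)) - ((a′ - y′) * (a′ - y′) - (a - y′) * (a - y′))
        ≡ + 2 * ((a - a′) * (y - y′))
      polarize = solve-∀
      expand : (+ dist² a′ y - + dist² a y) - (+ dist² a′ y′ - + dist² a y′) ≡ + 2 * ((+ toℕ a - + toℕ a′) * (+ toℕ y - + toℕ y′))
      expand = trans (cong₂ _-_ (cong₂ _-_ (dist²-ℤ a′ y) (dist²-ℤ a y)) (cong₂ _-_ (dist²-ℤ a′ y′) (dist²-ℤ a y′)))
        (polarize (+ toℕ a) (+ toℕ a′) (+ toℕ y) (+ toℕ y′))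
    ... | inj₁ d₂ = p∤2 d₂
    ... | inj₂ d₁ with ∣-prime p-prime (+ toℕ a - + toℕ a′) (+ toℕ y - + toℕ y′) d₁
    ...   | inj₁ da = Fin-∤ a a′ a≢a′ da
    ...   | inj₂ dy = Fin-∤ y y′ y≢y′ dy

    -- One direction of the Cayley graph: the sum of `F` over the points (a, b) + (x, x²), indexed
    -- by a′ = a + x.
    shift : (Fin p → Fin p → ℤ) → Fin p → Fin p → ℤ
    shift F a b = ∑[ a′ ] F a′ (rot (dist² a′ a) b)

    -- The rows of `F` form a family rotated by squares, so `second-moment` applies. The square of
    -- the total vanishes, and the squares of the row sums enter with a favourable sign.
    shift-second-moment : ∀ F → ∑₂ F ≡ 0ℤ →
      ∑₂ (λ a b → shift F a b * shift F a b) ≤ + p * ∑₂ (λ a b → F a b * F a b)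
    shift-second-moment F ∑F≡0 = from-sub (∑-nonneg (λ a → square-nonneg (∑ (F a)))) (sym (begin
      ∑₂ (λ a b → shift F a b * shift F a b) + r
        ≡⟨ cong (_+ r) (second-moment dist² dist²-inj F) ⟩
      ((+ p * q + ∑₂ F * ∑₂ F) - r) + r
        ≡⟨ cong (λ z → ((+ p * q + z * z) - r) + r) ∑F≡0 ⟩
      ((+ p * q + 0ℤ * 0ℤ) - r) + r
        ≡⟨ simplify (+ p * q) r ⟩
      + p * q ∎))
      where
      open ≡-Reasoning
      q = ∑₂ (λ a b → F a b * F a b)
      r = ∑[ a ] (∑ (F a) * ∑ (F a))
      simplify : ∀ x y → ((x + 0ℤ) - y) + y ≡ x
      simplify = solve-∀

    ∑-shift : ∀ F → ∑₂ (shift F) ≡ + p * ∑₂ F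
    ∑-shift F = begin
      ∑[ a ] ∑[ b ] ∑[ a′ ] F a′ (rot (dist² a′ a) b)
        ≡⟨ ∑-cong (λ a → ∑-comm (λ b a′ → F a′ (rot (dist² a′ a) b))) ⟩
      ∑[ a ] ∑[ a′ ] ∑[ b ] F a′ (rot (dist² a′ a) b)
        ≡⟨ ∑-cong (λ a → ∑-cong (λ a′ → ∑-rot (dist² a′ a) (F a′))) ⟩
      ∑ {p} (λ _ → ∑₂ F)
        ≡⟨ ∑-const p (∑₂ F) ⟩
      + p * ∑₂ F ∎
      where open ≡-Reasoning

    -- Apart from the constant functions, the singular values of the shift operator are at most √p,
    -- so adding κ ≥ √p on the diagonal makes its quadratic form dominate that of the constants.
    shift-form-lower : ∀ κ → 0ℤ < κ → + p ≤ κ * κ → ∀ F →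
      (+ p + κ) * (∑₂ F * ∑₂ F) ≤ + p * + p * (κ * ∑₂ (λ a b → F a b * F a b) + ∑₂ (λ a b → F a b * shift F a b))
    shift-form-lower κ 0<κ p≤κ² F = *-cancel 0<p (*-cancel 0<p (from-sub form-nonneg total))
      where
      open ≡-Reasoning
      π σ q c : ℤ
      π = + p
      σ = ∑₂ F
      q = ∑₂ (λ a b → F a b * F a b)
      c = ∑₂ (λ a b → F a b * shift F a b)
      0<p : 0ℤ < π
      0<p = +<+ (ℕ.>-nonZero⁻¹ p)
      -- The projection of `F` to mean zero, multiplied by p² to stay integral.
      e : Fin p → Fin p → ℤ
      e a b = π * π * F a b - σ
      pad₁ : ∀ π x σ → π * π * x - σ ≡ π * π * x + 0ℤ * x + 0ℤ * x + - σ
      pad₁ = solve-∀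
      unpad₁ : ∀ π σ → π * π * σ + 0ℤ * σ + 0ℤ * σ + π * (π * - σ) ≡ 0ℤ
      unpad₁ = solve-∀
      ∑e≡0 : ∑₂ e ≡ 0ℤ
      ∑e≡0 = trans (∑₂-cong (λ a b → pad₁ π (F a b) σ))
        (trans (∑₂-linear (π * π) F 0ℤ F 0ℤ F (- σ)) (unpad₁ π σ))
      shift-e : ∀ a b → shift e a b ≡ π * π * shift F a b - π * σ
      shift-e a b = trans (∑-minus (λ a′ → π * π * F a′ (rot (dist² a′ a) b)) (λ _ → σ))
        (cong₂ _-_ (∑-*ˡ (π * π) (λ a′ → F a′ (rot (dist² a′ a) b))) (∑-const p σ))
      ∑ee : ∑₂ (λ a b → e a b * e a b) ≡ π * π * (π * π * q - σ * σ)
      ∑ee = trans (∑₂-cong (λ a b → pad π (F a b) σ))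
        (trans (∑₂-linear (π * π * π * π) (λ a b → F a b * F a b) (- + 2 * (π * π * σ)) F 0ℤ F (σ * σ)) (unpad π q σ))
        where
        pad : ∀ π x σ → (π * π * x - σ) * (π * π * x - σ) ≡ π * π * π * π * (x * x) + (- + 2 * (π * π * σ)) * x + 0ℤ * x + σ * σ
        pad = solve-∀
        unpad : ∀ π q σ → π * π * π * π * q + (- + 2 * (π * π * σ)) * σ + 0ℤ * σ + π * (π * (σ * σ)) ≡ π * π * (π * π * q - σ * σ)
        unpad = solve-∀
      ∑eDe : ∑₂ (λ a b → e a b * shift e a b) ≡ π * π * (π * π * c - π * (σ * σ))
      ∑eDe = trans (∑₂-cong (λ a b → trans (cong (e a b *_) (shift-e a b)) (pad π (F a b) (shift F a b) σ)))
        (trans (∑₂-linear (π * π * π * π) (λ a b → F a b * shift F a b) (- (π * π * π * σ)) F (- (π * π * σ)) (shift F) (π * (σ * σ)))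
          (trans (cong (λ z → π * π * π * π * c + (- (π * π * π * σ)) * σ + (- (π * π * σ)) * z + π * (π * (π * (σ * σ)))) (∑-shift F)) (unpad π c σ)))
        where
        pad : ∀ π x y σ → (π * π * x - σ) * (π * π * y - π * σ)
          ≡ π * π * π * π * (x * y) + (- (π * π * π * σ)) * x + (- (π * π * σ)) * y + π * (σ * σ)
        pad = solve-∀
        unpad : ∀ π c σ → π * π * π * π * c + (- (π * π * π * σ)) * σ + (- (π * π * σ)) * (π * σ) + π * (π * (π * (σ * σ)))
          ≡ π * π * (π * π * c - π * (σ * σ))
        unpad = solve-∀
      expand : ∑₂ (λ a b → (κ * e a b + shift e a b) * (κ * e a b + shift e a b))
        ≡ κ * κ * ∑₂ (λ a b → e a b * e a b) + + 2 * κ * ∑₂ (λ a b → e a b * shift e a b) + 1ℤ * ∑₂ (λ a b → shift e a b * shift e a b) + π * (π * 0ℤ)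
      expand = trans (∑₂-cong (λ a b → pad κ (e a b) (shift e a b)))
        (∑₂-linear (κ * κ) (λ a b → e a b * e a b) (+ 2 * κ) (λ a b → e a b * shift e a b) 1ℤ (λ a b → shift e a b * shift e a b) 0ℤ)
        where
        pad : ∀ κ x y → (κ * x + y) * (κ * x + y) ≡ κ * κ * (x * x) + + 2 * κ * (x * y) + 1ℤ * (y * y) + 0ℤ
        pad = solve-∀
      E C S : ℤ
      E = ∑₂ (λ a b → e a b * e a b)
      C = ∑₂ (λ a b → e a b * shift e a b)
      S = ∑₂ (λ a b → shift e a b * shift e a b)
      -- The sum of the squares of `κ * e + shift e` is κ² E + 2 κ C + S, and S ≤ p E ≤ κ² E bounds
      -- it by 2 κ (κ E + C).
      form-nonneg : 0ℤ ≤ κ * E + C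
      form-nonneg = *-cancel 0<κ (*-cancel {+ 2} (+<+ (ℕ.s≤s ℕ.z≤n))
        (from-sub (+-nonneg (∑₂-nonneg (λ a b → square-nonneg (κ * e a b + shift e a b)))
          (+-nonneg (sub-nonneg (shift-second-moment e ∑e≡0))
             (*-nonneg (sub-nonneg p≤κ²) (∑₂-nonneg (λ a b → square-nonneg (e a b))))))
         (trans (regroup κ π E C S) (cong (λ z → + 2 * (κ * 0ℤ) + (z + ((π * E - S) + (κ * κ - π) * E))) (sym expand)))))
        where
        regroup : ∀ κ π E C S → + 2 * (κ * (κ * E + C)) ≡
          + 2 * (κ * 0ℤ) + ((κ * κ * E + + 2 * κ * C + 1ℤ * S + π * (π * 0ℤ)) + ((π * E - S) + (κ * κ - π) * E))
        regroup = solve-∀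
      total : π * (π * (π * π * (κ * q + c))) ≡ π * (π * ((π + κ) * (σ * σ))) + (κ * E + C)
      total = trans (regroup κ (π * π) π q c σ)
        (cong (_+_ (π * (π * ((π + κ) * (σ * σ))))) (cong₂ (λ x y → κ * x + y) (sym ∑ee) (sym ∑eDe)))
        where
        regroup : ∀ κ w π q c σ → π * (π * (w * (κ * q + c))) ≡ π * (π * ((π + κ) * (σ * σ))) + (κ * (π * π * (w * q - σ * σ)) + π * π * (w * c - π * (σ * σ)))
        regroup = solve-∀

  -- The pseudorandom colouring of pairs of points of ℤ/P × ℤ/P

  module Colouring {P : ℕ} (P-prime : Prime P) where

    private instance
      P≢0 : ℕ.NonZero P
      P≢0 = prime⇒nonZero P-prime

    -- The residue x₁ y₁ + x₂ + y₂. Varying y₂ alone runs through all colours, and for distinct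
    -- first coordinates of x the difference of the rotations is injective in y₁.
    colour : Fin P → Fin P → Fin P → Fin P → Fin P
    colour x₁ x₂ y₁ y₂ = rot (toℕ x₁ ℕ.* toℕ y₁ ℕ.+ toℕ x₂) y₂

    colour-sym : ∀ x₁ x₂ y₁ y₂ → colour x₁ x₂ y₁ y₂ ≡ colour y₁ y₂ x₁ x₂
    colour-sym x₁ x₂ y₁ y₂ = toℕ-injective (trans (toℕ-rot _ y₂) (trans
      (cong (ℕ._% P) (exchange (toℕ x₁) (toℕ x₂) (toℕ y₁) (toℕ y₂))) (sym (toℕ-rot _ x₂))))
      where
      exchange : ∀ x₁ x₂ y₁ y₂ → x₁ ℕ.* y₁ ℕ.+ x₂ ℕ.+ y₂ ≡ y₁ ℕ.* x₁ ℕ.+ y₂ ℕ.+ x₂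
      exchange = ℕSolver.solve-∀

    ∑-colour : ∀ (g : Fin P → ℤ) x₁ x₂ → ∑₂ (λ y₁ y₂ → g (colour x₁ x₂ y₁ y₂)) ≡ + P * ∑ g
    ∑-colour g x₁ x₂ = trans (∑-cong (λ y₁ → ∑-rot (toℕ x₁ ℕ.* toℕ y₁ ℕ.+ toℕ x₂) g)) (∑-const P (∑ g))

    private
      prod : Fin P → Fin P → ℕ
      prod a y = toℕ a ℕ.* toℕ y

      prod-inj : ∀ {a a′ y y′ : Fin P} → a ≢ a′ → y ≢ y′ →
        ¬ (+ P ∣ (+ prod a′ y - + prod a y) - (+ prod a′ y′ - + prod a y′))
      prod-inj {a} {a′} {y} {y′} a≢a′ y≢y′ d
        with ∣-prime P-prime _ _ (subst (+ P ∣_) expand d)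
        where
        factor : ∀ a a′ y y′ → (a′ * y - a * y) - (a′ * y′ - a * y′) ≡ (a′ - a) * (y - y′)
        factor = solve-∀
        expand : (+ prod a′ y - + prod a y) - (+ prod a′ y′ - + prod a y′) ≡ (+ toℕ a′ - + toℕ a) * (+ toℕ y - + toℕ y′)
        expand = trans (cong₂ _-_ (cong₂ _-_ (pos-* (toℕ a′) (toℕ y)) (pos-* (toℕ a) (toℕ y)))
                                 (cong₂ _-_ (pos-* (toℕ a′) (toℕ y′)) (pos-* (toℕ a) (toℕ y′))))
          (factor (+ toℕ a) (+ toℕ a′) (+ toℕ y) (+ toℕ y′))
      ... | inj₁ da = Fin-∤ a′ a (a≢a′ ∘ sym) da
      ... | inj₂ dy = Fin-∤ y y′ y≢y′ dy

    -- Any function of the colour with mean zero is a matrix of norm at most P² √P.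
    colour-discrepancy : ∀ (g : Fin P → ℤ) → ∑ g ≡ 0ℤ → (∀ z → g z * g z ≤ + P * + P) → ∀ (f : Fin P → Fin P → ℤ) →
      ∑₂ (λ y₁ y₂ → ∑₂ (λ x₁ x₂ → f x₁ x₂ * g (colour x₁ x₂ y₁ y₂)) * ∑₂ (λ x₁ x₂ → f x₁ x₂ * g (colour x₁ x₂ y₁ y₂)))
        ≤ + P * + P * + P * + P * + P * ∑₂ (λ x₁ x₂ → f x₁ x₂ * f x₁ x₂)
    colour-discrepancy g ∑g≡0 g²≤ f = begin
      ∑₂ (λ y₁ y₂ → row y₁ y₂ * row y₁ y₂)
        ≡⟨ ∑₂-cong (λ y₁ y₂ → cong (λ z → z * z) (∑-cong (λ x₁ → ∑-cong (λ x₂ → cong (λ z → f x₁ x₂ * g z) (colour-rot x₁ x₂ y₁ y₂))))) ⟩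
      ∑₂ (λ y₁ y₂ → ∑[ x₁ ] G x₁ (rot (prod x₁ y₁) y₂) * ∑[ x₁ ] G x₁ (rot (prod x₁ y₁) y₂))
        ≡⟨ second-moment prod prod-inj G ⟩
      (+ P * ∑₂ (λ a z → G a z * G a z) + ∑₂ G * ∑₂ G) - ∑[ a ] (∑ (G a) * ∑ (G a))
        ≡⟨ cong₂ (λ u v → (+ P * ∑₂ (λ a z → G a z * G a z) + u * u) - v) (∑-0 ∑G≡0) (∑-0 (λ a → cong (λ z → z * z) (∑G≡0 a))) ⟩
      (+ P * ∑₂ (λ a z → G a z * G a z) + 0ℤ * 0ℤ) - 0ℤ
        ≡⟨ drop-zeros _ ⟩
      + P * ∑₂ (λ a z → G a z * G a z)
        ≤⟨ *-monoˡ (+ P) pos-nonneg (∑₂-mono G²≤) ⟩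
      + P * ∑₂ (λ a (z : Fin P) → + P * (+ P * + P * ∑[ x₂ ] (f a x₂ * f a x₂)))
        ≡⟨ cong (+ P *_) (∑-cong (λ a → ∑-const P _)) ⟩
      + P * ∑[ a ] (+ P * (+ P * (+ P * + P * ∑[ x₂ ] (f a x₂ * f a x₂))))
        ≡⟨ cong (+ P *_) (trans (∑-cong (λ a → regroup (+ P) (∑[ x₂ ] (f a x₂ * f a x₂)))) (∑-*ˡ (+ P * + P * + P * + P) (λ a → ∑[ x₂ ] (f a x₂ * f a x₂)))) ⟩
      + P * (+ P * + P * + P * + P * ∑₂ (λ x₁ x₂ → f x₁ x₂ * f x₁ x₂))
        ≡⟨ regroup′ (+ P) (∑₂ (λ x₁ x₂ → f x₁ x₂ * f x₁ x₂)) ⟩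
      + P * + P * + P * + P * + P * ∑₂ (λ x₁ x₂ → f x₁ x₂ * f x₁ x₂) ∎
      where
      open ≤-Reasoning
      row : Fin P → Fin P → ℤ
      row y₁ y₂ = ∑₂ (λ x₁ x₂ → f x₁ x₂ * g (colour x₁ x₂ y₁ y₂))
      -- The coordinate x₂ only rotates the argument, so it is summed out first. What remains is a
      -- family indexed by x₁ and rotated by x₁ y₁; its members have mean zero, so its second moment
      -- is purely diagonal.
      G : Fin P → Fin P → ℤ
      G a z = ∑[ x₂ ] (f a x₂ * g (rot (toℕ x₂) z))
      colour-rot : ∀ x₁ x₂ y₁ y₂ → colour x₁ x₂ y₁ y₂ ≡ rot (toℕ x₂) (rot (prod x₁ y₁) y₂)
      colour-rot x₁ x₂ y₁ y₂ = trans (cong (λ k → rot k y₂) (ℕ.+-comm (prod x₁ y₁) (toℕ x₂))) (sym (rot-rot (toℕ x₂) (prod x₁ y₁) y₂))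

      ∑G≡0 : ∀ a → ∑ (G a) ≡ 0ℤ
      ∑G≡0 a = trans (∑-comm (λ z x₂ → f a x₂ * g (rot (toℕ x₂) z))) (∑-0 (λ x₂ →
        trans (∑-*ˡ (f a x₂) (λ z → g (rot (toℕ x₂) z))) (trans (cong (f a x₂ *_) (trans (∑-rot (toℕ x₂) g) ∑g≡0)) (*-zeroʳ (f a x₂)))))
      G²≤ : ∀ a z → G a z * G a z ≤ + P * (+ P * + P * ∑[ x₂ ] (f a x₂ * f a x₂))
      G²≤ a z = ≤-trans (cauchy (λ x₂ → f a x₂ * g (rot (toℕ x₂) z))) (*-monoˡ (+ P) pos-nonneg
        (≤-trans (∑-mono (λ x₂ → from-sub (*-nonneg (square-nonneg (f a x₂)) (sub-nonneg (g²≤ (rot (toℕ x₂) z)))) (split (f a x₂) (g (rot (toℕ x₂) z)) (+ P * + P))))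
          (≤-reflexive (∑-*ˡ (+ P * + P) (λ x₂ → f a x₂ * f a x₂)))))
        where
        split : ∀ x y c → c * (x * x) ≡ (x * y) * (x * y) + x * x * (c - y * y)
        split = solve-∀
      drop-zeros : ∀ x → (x + 0ℤ) - 0ℤ ≡ x
      drop-zeros = solve-∀
      regroup : ∀ P x → P * (P * (P * P * x)) ≡ P * P * P * P * x
      regroup = solve-∀
      regroup′ : ∀ P x → P * (P * P * P * P * x) ≡ P * P * P * P * P * x
      regroup′ = solve-∀

  -- Triangle-free subgraphs of A ∪ M, where A is quasirandom and the quadratic form of M
  -- dominates that of the constant matrix of the same density

  module TriangleFree {n : ℕ}
    (A M TA TM : Fin n → Fin n → ℤ)
    -- `R / P` is the common density of `A` and `M`; `s v` approximates the square root of the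
    -- degree in `TA`, and `φ v` is its reciprocal scaled by `Λ`. The precision is governed by `t`;
    -- `θ` is the weight in a completed square; `c₁` and `c₂` bound the discrepancies of `M` and
    -- `A`, and `c₃` the resulting error at one vertex.
    (P R t θ c₁ c₂ c₃ Λ : ℤ) (s φ : Fin n → ℤ)
    (0≤P : 0ℤ ≤ P) (0≤R : 0ℤ ≤ R) (0≤t : 0ℤ ≤ t) (0<θ : 0ℤ < θ) (0≤c₁ : 0ℤ ≤ c₁) (0≤c₃ : 0ℤ ≤ c₃)
    (0<Λ : 0ℤ < Λ) (0<n : 0ℤ < + n)
    (TA-sym : ∀ v w → TA v w ≡ TA w v) (0≤TA : ∀ v w → 0ℤ ≤ TA v w) (TA≤1 : ∀ v w → TA v w ≤ 1ℤ)
    (TA≤A : ∀ v w → TA v w ≤ A v w)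
    (M-sym : ∀ v w → M v w ≡ M w v) (M≤1 : ∀ v w → M v w ≤ 1ℤ)
    (TM-sym : ∀ v w → TM v w ≡ TM w v) (0≤TM : ∀ v w → 0ℤ ≤ TM v w) (TM≤M : ∀ v w → TM v w ≤ M v w)
    (triangle-free : ∀ x v w → TA x v * TA x w * TM v w ≡ 0ℤ)
    (M-form : ∀ (f : Fin n → ℤ) →
      t * t * R * (∑ f * ∑ f) ≤ t * t * P * ∑₂ (λ v w → f v * f w * M v w) + c₁ * ∑[ v ] (f v * f v))
    (A-discrepancy : ∀ (f : Fin n → ℤ) →
      ∑[ w ] ((P * ∑[ v ] (f v * A v w) - R * ∑ f) * (P * ∑[ v ] (f v * A v w) - R * ∑ f)) ≤ c₂ * ∑[ v ] (f v * f v))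
    (0≤c₂ : 0ℤ ≤ c₂)
    (constants : θ * θ * + n + t * t * t * t * (c₂ * + n) ≤ + 2 * θ * c₃)
    (0<s : ∀ v → 0ℤ < s v) (φs≡Λ : ∀ v → φ v * s v ≡ Λ)
    (degree≤s² : ∀ v → ∑ (TA v) ≤ s v * s v) (n≤ts² : ∀ v → + n ≤ t * (s v * s v))
    where

    a : Fin n → ℤ
    a v = ∑ (TA v)

    w : Fin n → Fin n → ℤ
    w u v = M u v - TM u v

    W : ℤ
    W = ∑₂ w

    f : Fin n → Fin n → ℤ
    f x v = TA x v * φ v

    -- Counts pairs of TA-edges xu, xv with uv in M, weighted by 1 / s u s v with s² ≈ degree. Such an
    -- edge uv is not in TM, which gives the upper bound; the quadratic form of M gives the lower bound.
    Ω : ℤ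
    Ω = ∑[ x ] ∑₂ (λ u v → f x u * f x v * M u v)

    0≤w : ∀ u v → 0ℤ ≤ w u v
    0≤w u v = sub-nonneg (TM≤M u v)

    w≤1 : ∀ u v → w u v ≤ 1ℤ
    w≤1 u v = from-sub (+-nonneg (sub-nonneg (M≤1 u v)) (0≤TM u v)) (split (M u v) (TM u v))
      where
      split : ∀ x y → 1ℤ ≡ (x - y) + ((1ℤ - x) + y)
      split = solve-∀

    w-sym : ∀ u v → w u v ≡ w v u
    w-sym u v = cong₂ _-_ (M-sym u v) (TM-sym u v)

    square-≤-self : ∀ {x} → 0ℤ ≤ x → x ≤ 1ℤ → x * x ≤ x
    square-≤-self {x} 0≤x x≤1 = from-sub (*-nonneg 0≤x (sub-nonneg x≤1)) (split x)
      where
      split : ∀ x → x ≡ x * x + x * (1ℤ - x)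
      split = solve-∀

    0≤a : ∀ v → 0ℤ ≤ a v
    0≤a v = ∑-nonneg (0≤TA v)

    φ²s²≡Λ² : ∀ v → φ v * φ v * (s v * s v) ≡ Λ * Λ
    φ²s²≡Λ² v = trans (regroup (φ v) (s v)) (cong (λ z → z * z) (φs≡Λ v))
      where
      regroup : ∀ x y → x * x * (y * y) ≡ (x * y) * (x * y)
      regroup = solve-∀

    φ²a≤Λ² : ∀ v → φ v * φ v * a v ≤ Λ * Λ
    φ²a≤Λ² v = subst (φ v * φ v * a v ≤_) (φ²s²≡Λ² v) (*-monoˡ (φ v * φ v) (square-nonneg (φ v)) (degree≤s² v))

    φ²n≤tΛ² : ∀ v → φ v * φ v * + n ≤ t * (Λ * Λ)
    φ²n≤tΛ² v = subst (φ v * φ v * + n ≤_) (trans (regroup (φ v) t (s v)) (cong (t *_) (φ²s²≡Λ² v)))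
      (*-monoˡ (φ v * φ v) (square-nonneg (φ v)) (n≤ts² v))
      where
      regroup : ∀ x t y → x * x * (t * (y * y)) ≡ t * (x * x * (y * y))
      regroup = solve-∀

    -- This is where the lower bound n ≤ t s² pays off: the discrepancy errors are weighted by φ²,
    -- and vertices of tiny degree would otherwise make their sum uncontrollable.
    ∑φ²≤tΛ² : ∑[ v ] (φ v * φ v) ≤ t * (Λ * Λ)
    ∑φ²≤tΛ² = *-cancel 0<n (subst₂ _≤_ (trans (∑-*ʳ (+ n) (λ v → φ v * φ v)) (*-comm _ (+ n))) (∑-const n (t * (Λ * Λ)))
      (∑-mono φ²n≤tΛ²))

    ∑f²≤nΛ² : ∑₂ (λ x v → f x v * f x v) ≤ + n * (Λ * Λ)
    ∑f²≤nΛ² = begin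
      ∑₂ (λ x v → f x v * f x v)
        ≤⟨ ∑₂-mono (λ x v → subst₂ _≤_ (regroup (TA x v) (φ v)) (cong (φ v * φ v *_) (TA-sym x v))
             (*-monoˡ (φ v * φ v) (square-nonneg (φ v)) (square-≤-self (0≤TA x v) (TA≤1 x v)))) ⟩
      ∑₂ (λ x v → φ v * φ v * TA v x)
        ≡⟨ ∑-comm (λ x v → φ v * φ v * TA v x) ⟩
      ∑₂ (λ v x → φ v * φ v * TA v x)
        ≡⟨ ∑-cong (λ v → ∑-*ˡ (φ v * φ v) (TA v)) ⟩
      ∑[ v ] (φ v * φ v * a v)
        ≤⟨ ∑-mono φ²a≤Λ² ⟩
      ∑ {n} (λ _ → Λ * Λ)
        ≡⟨ ∑-const n (Λ * Λ) ⟩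
      + n * (Λ * Λ) ∎
      where
      open ≤-Reasoning
      regroup : ∀ x y → y * y * (x * x) ≡ x * y * (x * y)
      regroup = solve-∀

    -- s x / s v + s v / s x ≥ 2, scaled by Λ
    am-gm : ∀ x v → + 2 * Λ ≤ s x * φ v + s v * φ x
    am-gm x v = *-cancel (*-pos (0<s x) (0<s v)) (from-sub (*-nonneg (<⇒≤ 0<Λ) (square-nonneg (s x - s v)))
      (trans (regroup (s x) (s v) (φ x) (φ v)) (trans (cong₂ (λ y z → s x * s x * y + s v * s v * z) (φs≡Λ v) (φs≡Λ x)) (split Λ (s x) (s v)))))
      where
      regroup : ∀ x v φx φv → x * v * (x * φv + v * φx) ≡ x * x * (φv * v) + v * v * (φx * x)
      regroup = solve-∀
      split : ∀ l x v → x * x * l + v * v * l ≡ x * v * (+ 2 * l) + l * ((x - v) * (x - v))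
      split = solve-∀

    -- Every `TA`-edge occurs in both orientations; adding the two contributions produces the
    -- symmetric expression bounded by `am-gm`.
    ∑a≤∑sf : Λ * ∑ a ≤ ∑₂ (λ x v → s x * f x v)
    ∑a≤∑sf = *-cancel {+ 2} (+<+ (ℕ.s≤s ℕ.z≤n)) (begin
      + 2 * (Λ * ∑ a)
        ≡⟨ *-assoc (+ 2) Λ (∑ a) ⟨
      + 2 * Λ * ∑ a
        ≡⟨ ∑₂-*ˡ (+ 2 * Λ) TA ⟨
      ∑₂ (λ x v → + 2 * Λ * TA x v)
        ≤⟨ ∑₂-mono (λ x v → subst₂ _≤_ (*-comm (TA x v) _) (split (TA x v) (s x) (s v) (φ x) (φ v)) (*-monoˡ (TA x v) (0≤TA x v) (am-gm x v))) ⟩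
      ∑₂ (λ x v → s x * (TA x v * φ v) + s v * (TA x v * φ x))
        ≡⟨ ∑₂-+ (λ x v → s x * (TA x v * φ v)) (λ x v → s v * (TA x v * φ x)) ⟩
      ∑₂ (λ x v → s x * f x v) + ∑₂ (λ x v → s v * (TA x v * φ x))
        ≡⟨ cong (_+_ (∑₂ (λ x v → s x * f x v))) (trans (∑-comm (λ x v → s v * (TA x v * φ x)))
             (∑₂-cong (λ v x → cong (λ z → s v * (z * φ x)) (TA-sym x v)))) ⟩
      ∑₂ (λ x v → s x * f x v) + ∑₂ (λ x v → s x * f x v)
        ≡⟨ double (∑₂ (λ x v → s x * f x v)) ⟩
      + 2 * ∑₂ (λ x v → s x * f x v) ∎)
      where
      open ≤-Reasoning
      split : ∀ y sx sv φx φv → y * (sx * φv + sv * φx) ≡ sx * (y * φv) + sv * (y * φx)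
      split = solve-∀
      double : ∀ x → x + x ≡ + 2 * x
      double = solve-∀

    -- Linearises the square by y² ≥ 2 Λ s y - Λ² s². The comparison point Λ s is the value of
    -- `∑ (f x)` when `TA` is regular and s² is the degree, so nothing is lost in the model case.
    ∑[∑f]²-lower : Λ * Λ * (+ 2 * ∑ a - ∑[ x ] (s x * s x)) ≤ ∑[ x ] (∑ (f x) * ∑ (f x))
    ∑[∑f]²-lower = begin
      Λ * Λ * (+ 2 * ∑ a - ∑[ x ] (s x * s x))
        ≡⟨ regroup Λ (∑ a) (∑[ x ] (s x * s x)) ⟩
      + 2 * Λ * (Λ * ∑ a) - Λ * Λ * ∑[ x ] (s x * s x)
        ≤⟨ +-monoˡ-≤ (- (Λ * Λ * ∑[ x ] (s x * s x))) (*-monoˡ (+ 2 * Λ) (*-nonneg {+ 2} pos-nonneg (<⇒≤ 0<Λ)) ∑a≤∑sf) ⟩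
      + 2 * Λ * ∑₂ (λ x v → s x * f x v) - Λ * Λ * ∑[ x ] (s x * s x)
        ≡⟨ cong₂ _-_ (trans (cong (+ 2 * Λ *_) (∑-cong (λ x → ∑-*ˡ (s x) (f x)))) (sym (∑-*ˡ (+ 2 * Λ) (λ x → s x * ∑ (f x)))))
                    (sym (∑-*ˡ (Λ * Λ) (λ x → s x * s x))) ⟩
      ∑[ x ] (+ 2 * Λ * (s x * ∑ (f x))) - ∑[ x ] (Λ * Λ * (s x * s x))
        ≡⟨ ∑-minus (λ x → + 2 * Λ * (s x * ∑ (f x))) (λ x → Λ * Λ * (s x * s x)) ⟨
      ∑[ x ] (+ 2 * Λ * (s x * ∑ (f x)) - Λ * Λ * (s x * s x))
        ≤⟨ ∑-mono (λ x → from-sub (square-nonneg (∑ (f x) - Λ * s x)) (complete (∑ (f x)) Λ (s x))) ⟩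
      ∑[ x ] (∑ (f x) * ∑ (f x)) ∎
      where
      open ≤-Reasoning
      regroup : ∀ l a q → l * l * (+ 2 * a - q) ≡ + 2 * l * (l * a) - l * l * q
      regroup = solve-∀
      complete : ∀ y l x → y * y ≡ + 2 * l * (x * y) - l * l * (x * x) + (y - l * x) * (y - l * x)
      complete = solve-∀

    Ω-lower : t * t * R * (Λ * Λ * (+ 2 * ∑ a - ∑[ x ] (s x * s x))) ≤ t * t * P * Ω + c₁ * (+ n * (Λ * Λ))
    Ω-lower = begin
      t * t * R * (Λ * Λ * (+ 2 * ∑ a - ∑[ x ] (s x * s x)))
        ≤⟨ *-monoˡ (t * t * R) (*-nonneg (square-nonneg t) 0≤R) ∑[∑f]²-lower ⟩
      t * t * R * ∑[ x ] (∑ (f x) * ∑ (f x))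
        ≡⟨ ∑-*ˡ (t * t * R) (λ x → ∑ (f x) * ∑ (f x)) ⟨
      ∑[ x ] (t * t * R * (∑ (f x) * ∑ (f x)))
        ≤⟨ ∑-mono (λ x → M-form (f x)) ⟩
      ∑[ x ] (t * t * P * ∑₂ (λ u v → f x u * f x v * M u v) + c₁ * ∑[ v ] (f x v * f x v))
        ≡⟨ trans (∑-+ (λ x → t * t * P * ∑₂ (λ u v → f x u * f x v * M u v)) (λ x → c₁ * ∑[ v ] (f x v * f x v)))
             (cong₂ _+_ (∑-*ˡ (t * t * P) (λ x → ∑₂ (λ u v → f x u * f x v * M u v))) (∑-*ˡ c₁ (λ x → ∑[ v ] (f x v * f x v)))) ⟩
      t * t * P * Ω + c₁ * ∑₂ (λ x v → f x v * f x v)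
        ≤⟨ +-monoʳ-≤ (t * t * P * Ω) (*-monoˡ c₁ 0≤c₁ ∑f²≤nΛ²) ⟩
      t * t * P * Ω + c₁ * (+ n * (Λ * Λ)) ∎
      where open ≤-Reasoning

    g : Fin n → Fin n → Fin n → ℤ
    g x u v = TA x u * TA x v * w u v * (φ u * φ u)

    -- Triangle-freeness enters here: `TA x u * TA x v * TM u v` vanishes, so `M` may be replaced by
    -- `w`. Then 2 φu φv ≤ φu² + φv² separates the weights, at no cost when they are equal.
    Ω≤∑g : Ω ≤ ∑[ x ] ∑₂ (g x)
    Ω≤∑g = ∑-mono (λ x → *-cancel {+ 2} (+<+ (ℕ.s≤s ℕ.z≤n)) (begin
      + 2 * ∑₂ (λ u v → f x u * f x v * M u v)
        ≡⟨ ∑₂-*ˡ (+ 2) (λ u v → f x u * f x v * M u v) ⟨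
      ∑₂ (λ u v → + 2 * (f x u * f x v * M u v))
        ≤⟨ ∑₂-mono (pointwise x) ⟩
      ∑₂ (λ u v → g x u v + g x v u)
        ≡⟨ ∑₂-+ (g x) (λ u v → g x v u) ⟩
      ∑₂ (g x) + ∑₂ (λ u v → g x v u)
        ≡⟨ cong (_+_ (∑₂ (g x))) (∑-comm (λ u v → g x v u)) ⟩
      ∑₂ (g x) + ∑₂ (g x)
        ≡⟨ double (∑₂ (g x)) ⟩
      + 2 * ∑₂ (g x) ∎))
      where
      open ≤-Reasoning
      double : ∀ x → x + x ≡ + 2 * x
      double = solve-∀
      pointwise : ∀ x u v → + 2 * (f x u * f x v * M u v) ≤ g x u v + g x v u
      pointwise x u v = from-sub (*-nonneg (*-nonneg (*-nonneg (0≤TA x u) (0≤TA x v)) (0≤w u v)) (square-nonneg (φ u - φ v)))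
        (trans (cong (λ z → g x u v + TA x v * TA x u * z * (φ v * φ v)) (w-sym v u))
          (trans (split (TA x u) (TA x v) (φ u) (φ v) (M u v) (TM u v))
            (trans (cong (λ z → + 2 * (f x u * f x v * M u v) - + 2 * φ u * φ v * z + TA x u * TA x v * w u v * ((φ u - φ v) * (φ u - φ v))) (triangle-free x u v))
              (cleanup (+ 2 * (f x u * f x v * M u v)) (+ 2 * φ u * φ v) (TA x u * TA x v * w u v * ((φ u - φ v) * (φ u - φ v)))))))
        where
        split : ∀ a b φu φv m k → a * b * (m - k) * (φu * φu) + b * a * (m - k) * (φv * φv)
          ≡ + 2 * (a * φu * (b * φv) * m) - + 2 * φu * φv * (a * b * k) + a * b * (m - k) * ((φu - φv) * (φu - φv))
        split = solve-∀
        cleanup : ∀ x y z → x - y * 0ℤ + z ≡ x + z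
        cleanup = solve-∀

    ε : Fin n → Fin n → ℤ
    ε u v = P * ∑[ x ] (TA u x * A x v) - R * a u

    -- Of the two `TA`-edges at `x`, the one to `v` is relaxed to an `A`-edge. Quasirandomness then
    -- predicts the number of such `x` as R / P times the degree of `u`, with scaled error `ε u v`;
    -- the weight φ² cancels that degree.
    P∑g≤ : P * ∑[ x ] ∑₂ (g x) ≤ R * (Λ * Λ) * W + ∑[ u ] (φ u * φ u * ∑[ v ] (w u v * ε u v))
    P∑g≤ = begin
      P * ∑[ x ] ∑₂ (g x)
        ≤⟨ *-monoˡ P 0≤P (∑-mono (λ x → ∑₂-mono (pointwise x))) ⟩
      P * ∑[ x ] ∑₂ (λ u v → φ u * φ u * (w u v * (TA u x * A x v)))
        ≡⟨ cong (P *_) (trans (∑-comm (λ x u → ∑[ v ] (φ u * φ u * (w u v * (TA u x * A x v)))))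
             (∑-cong (λ u → ∑-comm (λ x v → φ u * φ u * (w u v * (TA u x * A x v)))))) ⟩
      P * ∑₂ (λ u v → ∑[ x ] (φ u * φ u * (w u v * (TA u x * A x v))))
        ≡⟨ ∑₂-*ˡ P (λ u v → ∑[ x ] (φ u * φ u * (w u v * (TA u x * A x v)))) ⟨
      ∑₂ (λ u v → P * ∑[ x ] (φ u * φ u * (w u v * (TA u x * A x v))))
        ≡⟨ ∑₂-cong (λ u v → trans (cong (P *_) (trans (∑-*ˡ (φ u * φ u) (λ x → w u v * (TA u x * A x v)))
             (cong (φ u * φ u *_) (∑-*ˡ (w u v) (λ x → TA u x * A x v)))))
             (introduce-ε P R (φ u) (w u v) (a u) (∑[ x ] (TA u x * A x v)))) ⟩
      ∑₂ (λ u v → R * (φ u * φ u * a u) * w u v + φ u * φ u * (w u v * ε u v))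
        ≡⟨ ∑₂-+ (λ u v → R * (φ u * φ u * a u) * w u v) (λ u v → φ u * φ u * (w u v * ε u v)) ⟩
      ∑₂ (λ u v → R * (φ u * φ u * a u) * w u v) + ∑₂ (λ u v → φ u * φ u * (w u v * ε u v))
        ≤⟨ +-mono-≤ (∑₂-mono (λ u v → subst₂ _≤_ (*-comm (w u v) _) (*-comm (w u v) _)
              (*-monoˡ (w u v) (0≤w u v) (*-monoˡ R 0≤R (φ²a≤Λ² u))))) (≤-reflexive (∑-cong (λ u → ∑-*ˡ (φ u * φ u) (λ v → w u v * ε u v)))) ⟩
      ∑₂ (λ u v → R * (Λ * Λ) * w u v) + ∑[ u ] (φ u * φ u * ∑[ v ] (w u v * ε u v))
        ≡⟨ cong (λ z → z + ∑[ u ] (φ u * φ u * ∑[ v ] (w u v * ε u v))) (∑₂-*ˡ (R * (Λ * Λ)) w) ⟩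
      R * (Λ * Λ) * W + ∑[ u ] (φ u * φ u * ∑[ v ] (w u v * ε u v)) ∎
      where
      open ≤-Reasoning
      pointwise : ∀ x u v → g x u v ≤ φ u * φ u * (w u v * (TA u x * A x v))
      pointwise x u v = subst₂ _≤_ (trans (regroup (φ u) (w u v) (TA u x) (TA x v))
          (cong (λ z → z * TA x v * w u v * (φ u * φ u)) (TA-sym u x))) refl
        (*-monoˡ (φ u * φ u) (square-nonneg (φ u)) (*-monoˡ (w u v) (0≤w u v) (*-monoˡ (TA u x) (0≤TA u x) (TA≤A x v))))
        where
        regroup : ∀ φ w y z → φ * φ * (w * (y * z)) ≡ y * z * w * (φ * φ)
        regroup = solve-∀
      introduce-ε : ∀ P R φ w a y → P * (φ * φ * (w * y)) ≡ R * (φ * φ * a) * w + φ * φ * (w * (P * y - R * a))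
      introduce-ε = solve-∀

    -- Completing the square gives 2 θ t² w ε ≤ θ² w² + t⁴ ε². Here w² ≤ 1, and ∑ ε² is the
    -- discrepancy of `A` against the row `TA u`.
    ∑wε≤ : ∀ u → t * t * ∑[ v ] (w u v * ε u v) ≤ c₃
    ∑wε≤ u = *-cancel 0<θ (*-cancel {+ 2} (+<+ (ℕ.s≤s ℕ.z≤n)) (begin
      + 2 * (θ * (t * t * ∑[ v ] (w u v * ε u v)))
        ≡⟨ trans (regroup₁ θ t _) (sym (∑-*ˡ (+ 2 * θ * (t * t)) (λ v → w u v * ε u v))) ⟩
      ∑[ v ] (+ 2 * θ * (t * t) * (w u v * ε u v))
        ≤⟨ ∑-mono (λ v → ≤-trans (from-sub (square-nonneg (θ * w u v - t * t * ε u v)) (complete θ t (w u v) (ε u v)))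
              (+-monoˡ-≤ (t * t * t * t * (ε u v * ε u v)) (*-monoˡ (θ * θ) (square-nonneg θ)
                (≤-trans (square-≤-self (0≤w u v) (w≤1 u v)) (w≤1 u v))))) ⟩
      ∑[ v ] (θ * θ * 1ℤ + t * t * t * t * (ε u v * ε u v))
        ≡⟨ trans (∑-+ (λ _ → θ * θ * 1ℤ) (λ v → t * t * t * t * (ε u v * ε u v)))
             (cong₂ _+_ (∑-const n (θ * θ * 1ℤ)) (∑-*ˡ (t * t * t * t) (λ v → ε u v * ε u v))) ⟩
      + n * (θ * θ * 1ℤ) + t * t * t * t * ∑[ v ] (ε u v * ε u v)
        ≤⟨ +-monoʳ-≤ (+ n * (θ * θ * 1ℤ)) (*-monoˡ (t * t * t * t) t⁴≥0 (≤-trans (A-discrepancy (TA u)) (*-monoˡ c₂ 0≤c₂ ∑TA²≤n))) ⟩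
      + n * (θ * θ * 1ℤ) + t * t * t * t * (c₂ * + n)
        ≡⟨ cong (λ z → z + t * t * t * t * (c₂ * + n)) (regroup₂ (+ n) θ) ⟩
      θ * θ * + n + t * t * t * t * (c₂ * + n)
        ≤⟨ constants ⟩
      + 2 * θ * c₃
        ≡⟨ *-assoc (+ 2) θ c₃ ⟩
      + 2 * (θ * c₃) ∎))
      where
      open ≤-Reasoning
      regroup₁ : ∀ θ t y → + 2 * (θ * (t * t * y)) ≡ + 2 * θ * (t * t) * y
      regroup₁ = solve-∀
      regroup₂ : ∀ n θ → n * (θ * θ * 1ℤ) ≡ θ * θ * n
      regroup₂ = solve-∀
      complete : ∀ θ t w e → θ * θ * (w * w) + t * t * t * t * (e * e) ≡ + 2 * θ * (t * t) * (w * e) + (θ * w - t * t * e) * (θ * w - t * t * e)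
      complete = solve-∀
      t⁴≥0 : 0ℤ ≤ t * t * t * t
      t⁴≥0 = *-nonneg (*-nonneg (square-nonneg t) 0≤t) 0≤t
      ∑TA²≤n : ∑[ x ] (TA u x * TA u x) ≤ + n
      ∑TA²≤n = subst (∑[ x ] (TA u x * TA u x) ≤_) (trans (∑-const n 1ℤ) (*-identityʳ (+ n)))
        (∑-mono (λ x → ≤-trans (square-≤-self (0≤TA u x) (TA≤1 u x)) (TA≤1 u x)))

    Ω-upper : t * t * P * Ω ≤ t * t * R * (Λ * Λ) * W + t * (Λ * Λ) * c₃
    Ω-upper = begin
      t * t * P * Ω
        ≤⟨ *-monoˡ (t * t * P) (*-nonneg (square-nonneg t) 0≤P) Ω≤∑g ⟩
      t * t * P * ∑[ x ] ∑₂ (g x)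
        ≡⟨ *-assoc (t * t) P _ ⟩
      t * t * (P * ∑[ x ] ∑₂ (g x))
        ≤⟨ *-monoˡ (t * t) (square-nonneg t) P∑g≤ ⟩
      t * t * (R * (Λ * Λ) * W + ∑[ u ] (φ u * φ u * ∑[ v ] (w u v * ε u v)))
        ≡⟨ trans (regroup₁ t R Λ W (∑[ u ] (φ u * φ u * ∑[ v ] (w u v * ε u v))))
             (cong (_+_ (t * t * R * (Λ * Λ) * W)) (trans (sym (∑-*ˡ (t * t) (λ u → φ u * φ u * ∑[ v ] (w u v * ε u v))))
               (∑-cong (λ u → regroup₂ t (φ u) (∑[ v ] (w u v * ε u v)))))) ⟩
      t * t * R * (Λ * Λ) * W + ∑[ u ] (φ u * φ u * (t * t * ∑[ v ] (w u v * ε u v)))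
        ≤⟨ +-monoʳ-≤ (t * t * R * (Λ * Λ) * W) (∑-mono (λ u → *-monoˡ (φ u * φ u) (square-nonneg (φ u)) (∑wε≤ u))) ⟩
      t * t * R * (Λ * Λ) * W + ∑[ u ] (φ u * φ u * c₃)
        ≡⟨ cong (_+_ (t * t * R * (Λ * Λ) * W)) (trans (∑-*ʳ c₃ (λ u → φ u * φ u)) (*-comm _ c₃)) ⟩
      t * t * R * (Λ * Λ) * W + c₃ * ∑[ u ] (φ u * φ u)
        ≤⟨ +-monoʳ-≤ (t * t * R * (Λ * Λ) * W) (≤-trans (*-monoˡ c₃ 0≤c₃ ∑φ²≤tΛ²) (≤-reflexive (*-comm c₃ _))) ⟩
      t * t * R * (Λ * Λ) * W + t * (Λ * Λ) * c₃ ∎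
      where
      open ≤-Reasoning
      regroup₁ : ∀ t R l W y → t * t * (R * (l * l) * W + y) ≡ t * t * R * (l * l) * W + t * t * y
      regroup₁ = solve-∀
      regroup₂ : ∀ t φ y → t * t * (φ * φ * y) ≡ φ * φ * (t * t * y)
      regroup₂ = solve-∀

    -- `Ω-lower` against `Ω-upper`, with Λ² cancelled. When ∑ s² is close to ∑ `TA`, the bracket is
    -- close to the excess of `TA` and `TM` together over `M`.
    triangle-free-bound : t * t * R * (+ 2 * ∑₂ TA - ∑[ x ] (s x * s x) + ∑₂ TM - ∑₂ M) ≤ c₁ * + n + t * c₃
    triangle-free-bound = *-cancel (*-pos 0<Λ 0<Λ) (begin
      Λ * Λ * (t * t * R * (+ 2 * ∑ a - S + ∑₂ TM - ∑₂ M))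
        ≡⟨ regroup Λ t R (∑ a) S (∑₂ TM) (∑₂ M) ⟩
      t * t * R * (Λ * Λ * (+ 2 * ∑ a - S)) - t * t * R * (Λ * Λ) * (∑₂ M - ∑₂ TM)
        ≡⟨ cong (λ z → t * t * R * (Λ * Λ * (+ 2 * ∑ a - S)) - t * t * R * (Λ * Λ) * z) (∑₂-minus M TM) ⟨
      t * t * R * (Λ * Λ * (+ 2 * ∑ a - S)) - t * t * R * (Λ * Λ) * W
        ≤⟨ +-monoˡ-≤ (- (t * t * R * (Λ * Λ) * W)) (≤-trans Ω-lower (+-monoˡ-≤ (c₁ * (+ n * (Λ * Λ))) Ω-upper)) ⟩
      t * t * R * (Λ * Λ) * W + t * (Λ * Λ) * c₃ + c₁ * (+ n * (Λ * Λ)) - t * t * R * (Λ * Λ) * W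
        ≡⟨ cancel (t * t * R * (Λ * Λ) * W) t Λ c₃ c₁ (+ n) ⟩
      Λ * Λ * (c₁ * + n + t * c₃) ∎)
      where
      open ≤-Reasoning
      S = ∑[ x ] (s x * s x)
      regroup : ∀ l t R a S x y → l * l * (t * t * R * (+ 2 * a - S + x - y)) ≡ t * t * R * (l * l * (+ 2 * a - S)) - t * t * R * (l * l) * (y - x)
      regroup = solve-∀
      cancel : ∀ w t l c₃ c₁ n → w + t * (l * l) * c₃ + c₁ * (n * (l * l)) - w ≡ l * l * (c₁ * n + t * c₃)
      cancel = solve-∀

  -- Sums over products of index sets

  ∑-++ : ∀ {m n} (f : Fin (m ℕ.+ n) → ℤ) → ∑ f ≡ ∑[ i ] f (i Fin.↑ˡ n) + ∑[ j ] f (m Fin.↑ʳ j)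
  ∑-++ {zero}  {n} f = sym (trans (cong (λ z → z + ∑ f) (∑-zero (λ i → f (i Fin.↑ˡ n)))) (+-identityˡ (∑ f)))
  ∑-++ {suc m} {n} f = trans (∑-suc f) (trans (cong (_+_ (f zero)) (∑-++ {m} {n} (f ∘ suc)))
    (trans (sym (+-assoc (f zero) _ _)) (cong (λ z → z + ∑[ j ] f (suc m Fin.↑ʳ j)) (sym (∑-suc (λ i → f (i Fin.↑ˡ n)))))))

  ∑-combine : ∀ {m n} (f : Fin (m ℕ.* n) → ℤ) → ∑ f ≡ ∑₂ (λ i j → f (combine {m} {n} i j))
  ∑-combine {zero}  f = trans (∑-zero f) (sym (∑-zero _))
  ∑-combine {suc m} {n} f = trans (∑-++ {n} {m ℕ.* n} f) (trans (cong (_+_ (∑[ j ] f (j Fin.↑ˡ (m ℕ.* n)))) (∑-combine {m} {n} (f ∘ (n Fin.↑ʳ_))))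
    (sym (∑-suc (λ i → ∑[ j ] f (combine {suc m} {n} i j)))))

  ∑-threshold : ∀ {n} s → s ℕ.≤ n → ∑[ z ] ⟦ toℕ {n} z ℕ.<? s ⟧ ≡ + s
  ∑-threshold {zero} zero _ = ∑-zero _
  ∑-threshold {suc n} zero _ = ∑-0 (λ z → ⟦⟧-no (toℕ z ℕ.<? 0) (λ ()))
  ∑-threshold {suc n} (suc s) (ℕ.s≤s s≤n) = trans (∑-suc (λ z → ⟦ toℕ z ℕ.<? suc s ⟧))
    (cong (_+_ 1ℤ) (trans (∑-cong (λ z → ⟦⟧-⇔ (suc (toℕ z) ℕ.<? suc s) (toℕ z ℕ.<? s) ℕ.s<s⁻¹ ℕ.s<s)) (∑-threshold {n} s s≤n)))

  -- Natural-valued because the edge weights built from it serve as colour thresholds.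
  ⟦_⟧ₙ : ∀ {a} {A : Set a} → Dec A → ℕ
  ⟦ d ⟧ₙ = if does d then 1 else 0

  +⟦⟧ₙ : ∀ {a} {A : Set a} (d : Dec A) → + ⟦ d ⟧ₙ ≡ ⟦ d ⟧
  +⟦⟧ₙ (yes _) = refl
  +⟦⟧ₙ (no _)  = refl

  ⟦⟧ₙ-sym : ∀ {n} (x y : Fin n) → ⟦ x ≟ y ⟧ₙ ≡ ⟦ y ≟ x ⟧ₙ
  ⟦⟧ₙ-sym x y = +-injective (trans (+⟦⟧ₙ (x ≟ y)) (trans (⟦⟧-⇔ (x ≟ y) (y ≟ x) sym sym) (sym (+⟦⟧ₙ (y ≟ x)))))

  -- c₀ disjoint copies of the planar Cayley graph, with loops of weight 2κ added

  module Clusters {p : ℕ} (p-prime : Prime p) (p∤2 : ¬ (+ p ∣ + 2)) (c₀ κ : ℕ) where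

    private instance
      p≢0 : ℕ.NonZero p
      p≢0 = prime⇒nonZero p-prime

    open Planar p-prime p∤2

    m : ℕ
    m = c₀ ℕ.* (p ℕ.* p)

    cluster : Fin c₀ → Fin p → Fin p → Fin m
    cluster c a b = combine c (combine a b)

    copy : Fin m → Fin c₀
    copy i = proj₁ (remQuot (p ℕ.* p) i)

    coord₁ coord₂ : Fin m → Fin p
    coord₁ i = proj₁ (remQuot {p} p (proj₂ (remQuot {c₀} (p ℕ.* p) i)))
    coord₂ i = proj₂ (remQuot {p} p (proj₂ (remQuot {c₀} (p ℕ.* p) i)))

    copy-cluster : ∀ c a b → copy (cluster c a b) ≡ c
    copy-cluster c a b = cong proj₁ (remQuot-combine c (combine a b))

    coord₁-cluster : ∀ c a b → coord₁ (cluster c a b) ≡ a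
    coord₁-cluster c a b = trans (cong (λ z → proj₁ (remQuot {p} p (proj₂ z))) (remQuot-combine c (combine a b))) (cong proj₁ (remQuot-combine a b))

    coord₂-cluster : ∀ c a b → coord₂ (cluster c a b) ≡ b
    coord₂-cluster c a b = trans (cong (λ z → proj₂ (remQuot {p} p (proj₂ z))) (remQuot-combine c (combine a b))) (cong proj₂ (remQuot-combine a b))

    cluster-eta : ∀ i → cluster (copy i) (coord₁ i) (coord₂ i) ≡ i
    cluster-eta i = trans (cong (combine (copy i)) (combine-remQuot {p} p _)) (combine-remQuot {c₀} (p ℕ.* p) i)

    cluster-injective : ∀ {i j} → copy i ≡ copy j → coord₁ i ≡ coord₁ j → coord₂ i ≡ coord₂ j → i ≡ j
    cluster-injective {i} {j} eq eq₁ eq₂ = trans (sym (cluster-eta i))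
      (trans (cong₂ (λ c (a , b) → cluster c a b) eq (cong₂ _,_ eq₁ eq₂)) (cluster-eta j))

    ∑-cluster : (f : Fin m → ℤ) → ∑ f ≡ ∑[ c ] ∑₂ (λ a b → f (cluster c a b))
    ∑-cluster f = trans (∑-combine {c₀} {p ℕ.* p} f) (∑-cong (λ c → ∑-combine {p} {p} (λ z → f (combine c z))))

    arc? : ∀ (i j : Fin m) → Dec (rot (dist² (coord₁ j) (coord₁ i)) (coord₂ i) ≡ coord₂ j)
    arc? i j = rot (dist² (coord₁ j) (coord₁ i)) (coord₂ i) ≟ coord₂ j

    -- The identity of ℤ/p × ℤ/p lies in the connection set, so a loop counts twice.
    E : Fin m → Fin m → ℕ
    E i j = ⟦ copy i ≟ copy j ⟧ₙ ℕ.* (⟦ arc? i j ⟧ₙ ℕ.+ ⟦ arc? j i ⟧ₙ)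

    loop : Fin m → Fin m → ℕ
    loop i j = ⟦ copy i ≟ copy j ⟧ₙ ℕ.* (⟦ coord₁ i ≟ coord₁ j ⟧ₙ ℕ.* ⟦ coord₂ i ≟ coord₂ j ⟧ₙ)

    -- In each copy this is 2 κ times the identity plus the shift operator and its transpose, so its
    -- quadratic form is twice `form`.
    weight : Fin m → Fin m → ℕ
    weight i j = 2 ℕ.* κ ℕ.* loop i j ℕ.+ E i j

    arc : Fin p → Fin p → Fin p → Fin p → ℤ
    arc a b a′ b′ = ⟦ rot (dist² a′ a) b ≟ b′ ⟧

    private
      same : Fin p → Fin p → Fin p → Fin p → ℤ
      same a b a′ b′ = ⟦ a ≟ a′ ⟧ * ⟦ b ≟ b′ ⟧

      +E : ∀ c a b c′ a′ b′ → + E (cluster c a b) (cluster c′ a′ b′) ≡ ⟦ c ≟ c′ ⟧ * (arc a b a′ b′ + arc a′ b′ a b)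
      +E c a b c′ a′ b′ rewrite copy-cluster c a b | copy-cluster c′ a′ b′ | coord₁-cluster c a b | coord₁-cluster c′ a′ b′
        | coord₂-cluster c a b | coord₂-cluster c′ a′ b′ = trans (pos-* ⟦ c ≟ c′ ⟧ₙ _)
          (cong₂ _*_ (+⟦⟧ₙ (c ≟ c′)) (cong₂ _+_ (+⟦⟧ₙ (rot (dist² a′ a) b ≟ b′)) (+⟦⟧ₙ (rot (dist² a a′) b′ ≟ b))))

      +weight : ∀ c a b c′ a′ b′ → + weight (cluster c a b) (cluster c′ a′ b′) ≡
        ⟦ c ≟ c′ ⟧ * (+ 2 * + κ * same a b a′ b′ + (arc a b a′ b′ + arc a′ b′ a b))
      +weight c a b c′ a′ b′ = trans (cong₂ _+_ (trans (pos-* (2 ℕ.* κ) (loop i j)) (cong₂ _*_ (pos-* 2 κ) +loop)) (+E c a b c′ a′ b′))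
        (regroup ⟦ c ≟ c′ ⟧ (+ κ) (same a b a′ b′) (arc a b a′ b′ + arc a′ b′ a b))
        where
        i = cluster c a b
        j = cluster c′ a′ b′
        +loop : + loop i j ≡ ⟦ c ≟ c′ ⟧ * same a b a′ b′
        +loop rewrite copy-cluster c a b | copy-cluster c′ a′ b′ | coord₁-cluster c a b | coord₁-cluster c′ a′ b′
          | coord₂-cluster c a b | coord₂-cluster c′ a′ b′ = trans (pos-* ⟦ c ≟ c′ ⟧ₙ _)
            (cong₂ _*_ (+⟦⟧ₙ (c ≟ c′)) (trans (pos-* ⟦ a ≟ a′ ⟧ₙ ⟦ b ≟ b′ ⟧ₙ) (cong₂ _*_ (+⟦⟧ₙ (a ≟ a′)) (+⟦⟧ₙ (b ≟ b′)))))
        regroup : ∀ x k y z → + 2 * k * (x * y) + x * z ≡ x * (+ 2 * k * y + z)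
        regroup = solve-∀

    ∑₂-same : ∀ (F : Fin p → Fin p → ℤ) a b → ∑₂ (λ a′ b′ → same a b a′ b′ * F a′ b′) ≡ F a b
    ∑₂-same F a b = trans (∑-cong (λ a′ → trans (∑-cong (λ b′ → *-assoc ⟦ a ≟ a′ ⟧ ⟦ b ≟ b′ ⟧ (F a′ b′)))
      (trans (∑-*ˡ ⟦ a ≟ a′ ⟧ (λ b′ → ⟦ b ≟ b′ ⟧ * F a′ b′)) (cong (⟦ a ≟ a′ ⟧ *_) (∑-δ b (F a′)))))) (∑-δ a (λ a′ → F a′ b))

    ∑₂-arc : ∀ (F : Fin p → Fin p → ℤ) a b → ∑₂ (λ a′ b′ → arc a b a′ b′ * F a′ b′) ≡ shift F a b
    ∑₂-arc F a b = ∑-cong (λ a′ → ∑-δ (rot (dist² a′ a) b) (F a′))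

    form : (Fin p → Fin p → ℤ) → ℤ
    form F = + κ * ∑₂ (λ a b → F a b * F a b) + ∑₂ (λ a b → F a b * shift F a b)

    copy-form : ∀ (F : Fin p → Fin p → ℤ) → ∑₂ (λ a b → ∑₂ (λ a′ b′ → (+ 2 * + κ * same a b a′ b′ + (arc a b a′ b′ + arc a′ b′ a b)) * (F a b * F a′ b′))) ≡ + 2 * form F
    copy-form F = begin
      ∑₂ (λ a b → ∑₂ (λ a′ b′ → (+ 2 * + κ * same a b a′ b′ + (arc a b a′ b′ + arc a′ b′ a b)) * (F a b * F a′ b′)))
        ≡⟨ ∑₂-cong (λ a b → trans (∑₂-cong (λ a′ b′ → split (+ κ) (same a b a′ b′) (arc a b a′ b′) (arc a′ b′ a b) (F a b) (F a′ b′)))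
             (trans (∑₂-+ (λ a′ b′ → + 2 * + κ * F a b * (same a b a′ b′ * F a′ b′) + F a b * (arc a b a′ b′ * F a′ b′)) (λ a′ b′ → F a′ b′ * (arc a′ b′ a b * F a b)))
               (cong (λ z → z + ∑₂ (λ a′ b′ → F a′ b′ * (arc a′ b′ a b * F a b))) (trans
                 (∑₂-+ (λ a′ b′ → + 2 * + κ * F a b * (same a b a′ b′ * F a′ b′)) (λ a′ b′ → F a b * (arc a b a′ b′ * F a′ b′)))
                 (cong₂ _+_ (trans (∑₂-*ˡ (+ 2 * + κ * F a b) (λ a′ b′ → same a b a′ b′ * F a′ b′)) (cong (+ 2 * + κ * F a b *_) (∑₂-same F a b)))
                   (trans (∑₂-*ˡ (F a b) (λ a′ b′ → arc a b a′ b′ * F a′ b′)) (cong (F a b *_) (∑₂-arc F a b)))))))) ⟩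
      ∑₂ (λ a b → + 2 * + κ * F a b * F a b + F a b * shift F a b + ∑₂ (λ a′ b′ → F a′ b′ * (arc a′ b′ a b * F a b)))
        ≡⟨ ∑₂-+ (λ a b → + 2 * + κ * F a b * F a b + F a b * shift F a b) (λ a b → ∑₂ (λ a′ b′ → F a′ b′ * (arc a′ b′ a b * F a b))) ⟩
      ∑₂ (λ a b → + 2 * + κ * F a b * F a b + F a b * shift F a b) + ∑₂ (λ a b → ∑₂ (λ a′ b′ → F a′ b′ * (arc a′ b′ a b * F a b)))
        ≡⟨ cong₂ _+_ (trans (∑₂-+ (λ a b → + 2 * + κ * F a b * F a b) (λ a b → F a b * shift F a b))
              (cong (λ z → z + c) (trans (∑₂-cong (λ a b → *-assoc (+ 2 * + κ) (F a b) (F a b))) (∑₂-*ˡ (+ 2 * + κ) (λ a b → F a b * F a b)))))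
            (trans (∑₂-comm (λ a b a′ b′ → F a′ b′ * (arc a′ b′ a b * F a b)))
              (∑₂-cong (λ a′ b′ → trans (∑₂-*ˡ (F a′ b′) (λ a b → arc a′ b′ a b * F a b)) (cong (F a′ b′ *_) (∑₂-arc F a′ b′))))) ⟩
      + 2 * + κ * q + c + c
        ≡⟨ collect (+ κ) q c ⟩
      + 2 * form F ∎
      where
      open ≡-Reasoning
      q = ∑₂ (λ a b → F a b * F a b)
      c = ∑₂ (λ a b → F a b * shift F a b)
      ∑₂-comm : ∀ {k l k′ l′} (h : Fin k → Fin l → Fin k′ → Fin l′ → ℤ) → ∑₂ (λ a b → ∑₂ (λ a′ b′ → h a b a′ b′)) ≡ ∑₂ (λ a′ b′ → ∑₂ (λ a b → h a b a′ b′))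
      ∑₂-comm h = trans (∑-cong (λ a → ∑-comm (λ b a′ → ∑ (h a b a′)))) (trans (∑-comm (λ a a′ → ∑[ b ] ∑ (h a b a′)))
        (∑-cong (λ a′ → trans (∑-cong (λ a → ∑-comm (λ b b′ → h a b a′ b′))) (∑-comm (λ a b′ → ∑[ b ] h a b a′ b′)))))
      split : ∀ k s x y f g → (+ 2 * k * s + (x + y)) * (f * g) ≡ + 2 * k * f * (s * g) + f * (x * g) + g * (y * f)
      split = solve-∀
      collect : ∀ k q c → + 2 * k * q + c + c ≡ + 2 * (k * q + c)
      collect = solve-∀

    weight-form : ∀ (F : Fin m → ℤ) → ∑₂ (λ i j → + weight i j * (F i * F j)) ≡ ∑[ c ] (+ 2 * form (λ a b → F (cluster c a b)))
    weight-form F = begin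
      ∑₂ (λ i j → + weight i j * (F i * F j))
        ≡⟨ trans (∑-cluster _) (∑-cong (λ c → ∑₂-cong (λ a b → ∑-cluster _))) ⟩
      ∑[ c ] ∑₂ (λ a b → ∑[ c′ ] ∑₂ (λ a′ b′ → + weight (cluster c a b) (cluster c′ a′ b′) * (F (cluster c a b) * F (cluster c′ a′ b′))))
        ≡⟨ ∑-cong (λ c → ∑₂-cong (λ a b → ∑-cong (λ c′ → trans
             (∑₂-cong (λ a′ b′ → trans (cong (_* (F (cluster c a b) * F (cluster c′ a′ b′))) (+weight c a b c′ a′ b′)) (*-assoc ⟦ c ≟ c′ ⟧ _ _)))
             (∑₂-*ˡ ⟦ c ≟ c′ ⟧ (X c a b c′))))) ⟩
      ∑[ c ] ∑₂ (λ a b → ∑[ c′ ] (⟦ c ≟ c′ ⟧ * ∑₂ (X c a b c′)))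
        ≡⟨ ∑-cong (λ c → ∑₂-cong (λ a b → ∑-δ c (λ c′ → ∑₂ (X c a b c′)))) ⟩
      ∑[ c ] ∑₂ (λ a b → ∑₂ (X c a b c))
        ≡⟨ ∑-cong (λ c → copy-form (λ a b → F (cluster c a b))) ⟩
      ∑[ c ] (+ 2 * form (λ a b → F (cluster c a b))) ∎
      where
      open ≡-Reasoning
      X : ∀ c a b c′ a′ b′ → ℤ
      X c a b c′ a′ b′ = (+ 2 * + κ * same a b a′ b′ + (arc a b a′ b′ + arc a′ b′ a b)) * (F (cluster c a b) * F (cluster c′ a′ b′))

    ρ : ℕ
    ρ = 2 ℕ.* (p ℕ.+ κ)

    -- `shift-form-lower` in each copy, then Cauchy-Schwarz over the `c₀` copies. The constant
    -- matrix with entries ρ / m, whose form is on the left up to the factor m, has the same total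
    -- as `weight`.
    weight-form-lower : 0 ℕ.< κ → p ℕ.≤ κ ℕ.* κ → ∀ (F : Fin m → ℤ) →
      + ρ * (∑ F * ∑ F) ≤ + m * ∑₂ (λ i j → + weight i j * (F i * F j))
    weight-form-lower 0<κ p≤κ² F = begin
      + ρ * (∑ F * ∑ F)
        ≡⟨ cong₂ _*_ (pos-* 2 (p ℕ.+ κ)) (cong (λ z → z * z) (∑-cluster F)) ⟩
      + 2 * (+ p + + κ) * (∑ σ * ∑ σ)
        ≤⟨ *-monoˡ (+ 2 * (+ p + + κ)) (*-nonneg {+ 2} {+ p + + κ} pos-nonneg pos-nonneg) (cauchy σ) ⟩
      + 2 * (+ p + + κ) * (+ c₀ * ∑[ c ] (σ c * σ c))
        ≡⟨ trans (regroup₁ (+ p + + κ) (+ c₀) (∑[ c ] (σ c * σ c))) (cong (λ z → + 2 * + c₀ * z) (sym (∑-*ˡ (+ p + + κ) (λ c → σ c * σ c)))) ⟩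
      + 2 * + c₀ * ∑[ c ] ((+ p + + κ) * (σ c * σ c))
        ≤⟨ *-monoˡ (+ 2 * + c₀) (*-nonneg {+ 2} {+ c₀} pos-nonneg pos-nonneg)
             (∑-mono (λ c → shift-form-lower (+ κ) (+<+ 0<κ) (subst (+ p ≤_) (pos-* κ κ) (+≤+ p≤κ²)) (λ a b → F (cluster c a b)))) ⟩
      + 2 * + c₀ * ∑[ c ] (+ p * + p * form (λ a b → F (cluster c a b)))
        ≡⟨ trans (cong (λ z → + 2 * + c₀ * z) (∑-*ˡ (+ p * + p) (λ c → form (λ a b → F (cluster c a b)))))
             (trans (regroup₂ (+ c₀) (+ p) (∑[ c ] form (λ a b → F (cluster c a b)))) (cong₂ _*_ (sym +m) (sym (trans (weight-form F) (∑-*ˡ (+ 2) (λ c → form (λ a b → F (cluster c a b)))))))) ⟩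
      + m * ∑₂ (λ i j → + weight i j * (F i * F j)) ∎
      where
      open ≤-Reasoning
      σ : Fin c₀ → ℤ
      σ c = ∑₂ (λ a b → F (cluster c a b))
      +m : + m ≡ + c₀ * (+ p * + p)
      +m = trans (pos-* c₀ (p ℕ.* p)) (cong (+ c₀ *_) (pos-* p p))
      regroup₁ : ∀ x c s → + 2 * x * (c * s) ≡ + 2 * c * (x * s)
      regroup₁ = solve-∀
      regroup₂ : ∀ c p s → + 2 * c * (p * p * s) ≡ c * (p * p) * (+ 2 * s)
      regroup₂ = solve-∀

    E-sym : ∀ i j → E i j ≡ E j i
    E-sym i j = cong₂ ℕ._*_ (⟦⟧ₙ-sym (copy i) (copy j)) (ℕ.+-comm ⟦ arc? i j ⟧ₙ ⟦ arc? j i ⟧ₙ)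

    weight-sym : ∀ i j → weight i j ≡ weight j i
    weight-sym i j = cong₂ (λ x y → 2 ℕ.* κ ℕ.* x ℕ.+ y) (cong₂ ℕ._*_ (⟦⟧ₙ-sym (copy i) (copy j))
      (cong₂ ℕ._*_ (⟦⟧ₙ-sym (coord₁ i) (coord₁ j)) (⟦⟧ₙ-sym (coord₂ i) (coord₂ j)))) (E-sym i j)

    ∑-E : ∀ i → ∑[ j ] + E i j ≡ + 2 * + p
    ∑-E i = trans (cong (λ i → ∑[ j ] + E i j) (sym (cluster-eta i))) (begin
      ∑[ j ] + E (cluster c a b) j
        ≡⟨ ∑-cluster _ ⟩
      ∑[ c′ ] ∑₂ (λ a′ b′ → + E (cluster c a b) (cluster c′ a′ b′))
        ≡⟨ ∑-cong (λ c′ → trans (∑₂-cong (λ a′ b′ → +E c a b c′ a′ b′)) (∑₂-*ˡ ⟦ c ≟ c′ ⟧ (λ a′ b′ → arc a b a′ b′ + arc a′ b′ a b))) ⟩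
      ∑[ c′ ] (⟦ c ≟ c′ ⟧ * ∑₂ (λ a′ b′ → arc a b a′ b′ + arc a′ b′ a b))
        ≡⟨ ∑-δ c (λ _ → ∑₂ (λ a′ b′ → arc a b a′ b′ + arc a′ b′ a b)) ⟩
      ∑₂ (λ a′ b′ → arc a b a′ b′ + arc a′ b′ a b)
        ≡⟨ ∑₂-+ (λ a′ b′ → arc a b a′ b′) (λ a′ b′ → arc a′ b′ a b) ⟩
      ∑₂ (λ a′ b′ → arc a b a′ b′) + ∑₂ (λ a′ b′ → arc a′ b′ a b)
        ≡⟨ cong₂ _+_ (∑-cong (λ a′ → ∑-δ1 (rot (dist² a′ a) b)))
             (∑-cong (λ a′ → trans (∑-rot (dist² a a′) (λ z → ⟦ z ≟ b ⟧)) (trans (∑-cong (λ z → ⟦⟧-⇔ (z ≟ b) (b ≟ z) sym sym)) (∑-δ1 b)))) ⟩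
      ∑ {p} (λ _ → 1ℤ) + ∑ {p} (λ _ → 1ℤ)
        ≡⟨ cong (λ z → z + z) (trans (∑-const p 1ℤ) (*-identityʳ (+ p))) ⟩
      + p + + p
        ≡⟨ double (+ p) ⟩
      + 2 * + p ∎)
      where
      open ≡-Reasoning
      c = copy i
      a = coord₁ i
      b = coord₂ i
      double : ∀ x → x + x ≡ + 2 * x
      double = solve-∀

    -- Read off from `weight-form` at the constant function 1.
    ∑-weight : ∑₂ (λ i j → + weight i j) ≡ + m * + ρ
    ∑-weight = begin
      ∑₂ (λ i j → + weight i j)
        ≡⟨ ∑₂-cong (λ i j → *-identityʳ (+ weight i j)) ⟨
      ∑₂ (λ i j → + weight i j * (1ℤ * 1ℤ))
        ≡⟨ weight-form (λ _ → 1ℤ) ⟩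
      ∑ {c₀} (λ _ → + 2 * (+ κ * ∑₂ {p} {p} (λ _ _ → 1ℤ) + ∑₂ (λ a b → 1ℤ * shift (λ _ _ → 1ℤ) a b)))
        ≡⟨ ∑-cong (λ _ → cong (+ 2 *_) (cong₂ _+_ (cong (+ κ *_) (∑₂-const p p 1ℤ))
             (trans (∑₂-cong (λ a b → trans (*-identityˡ _) (∑-const p 1ℤ))) (∑₂-const p p (+ p * 1ℤ))))) ⟩
      ∑ {c₀} (λ _ → + 2 * (+ κ * (+ p * (+ p * 1ℤ)) + + p * (+ p * (+ p * 1ℤ))))
        ≡⟨ ∑-const c₀ _ ⟩
      + c₀ * (+ 2 * (+ κ * (+ p * (+ p * 1ℤ)) + + p * (+ p * (+ p * 1ℤ))))
        ≡⟨ regroup (+ c₀) (+ p) (+ κ) ⟩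
      + c₀ * (+ p * + p) * (+ 2 * (+ p + + κ))
        ≡⟨ cong₂ _*_ (trans (pos-* c₀ (p ℕ.* p)) (cong (+ c₀ *_) (pos-* p p))) (pos-* 2 (p ℕ.+ κ)) ⟨
      + m * + ρ ∎
      where
      open ≡-Reasoning
      regroup : ∀ c p k → c * (+ 2 * (k * (p * (p * 1ℤ)) + p * (p * (p * 1ℤ)))) ≡ c * (p * p) * (+ 2 * (p + k))
      regroup = solve-∀

    weight≤ : ∀ i j → weight i j ℕ.≤ 2 ℕ.* κ ℕ.+ 2
    weight≤ i j = ℕ.+-mono-≤ (ℕ.≤-trans (ℕ.*-monoʳ-≤ (2 ℕ.* κ) loop≤1) (ℕ.≤-reflexive (ℕ.*-identityʳ (2 ℕ.* κ))))
      (ℕ.*-mono-≤ (⟦⟧ₙ≤1 (copy i ≟ copy j)) (ℕ.+-mono-≤ (⟦⟧ₙ≤1 (arc? i j)) (⟦⟧ₙ≤1 (arc? j i))))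
      where
      ⟦⟧ₙ≤1 : ∀ {A : Set} (d : Dec A) → ⟦ d ⟧ₙ ℕ.≤ 1
      ⟦⟧ₙ≤1 (yes _) = ℕ.≤-refl
      ⟦⟧ₙ≤1 (no _)  = ℕ.z≤n
      loop≤1 : loop i j ℕ.≤ 1
      loop≤1 = ℕ.*-mono-≤ (⟦⟧ₙ≤1 (copy i ≟ copy j)) (ℕ.*-mono-≤ (⟦⟧ₙ≤1 (coord₁ i ≟ coord₁ j)) (⟦⟧ₙ≤1 (coord₂ i ≟ coord₂ j)))

  -- The matrices of the graph

  module Matrices {p : ℕ} (p-prime : Prime p) (p∤2 : ¬ (+ p ∣ + 2)) (c₀ κ : ℕ) {P : ℕ} (P-prime : Prime P) (u : ℕ) where

    open Clusters p-prime p∤2 c₀ κ public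
    open Colouring P-prime public

    n : ℕ
    n = m ℕ.* (P ℕ.* P)

    vertex : Fin m → Fin P → Fin P → Fin n
    vertex i x₁ x₂ = combine i (combine x₁ x₂)

    cl : Fin n → Fin m
    cl v = proj₁ (remQuot (P ℕ.* P) v)

    point₁ point₂ : Fin n → Fin P
    point₁ v = proj₁ (remQuot {P} P (proj₂ (remQuot {m} (P ℕ.* P) v)))
    point₂ v = proj₂ (remQuot {P} P (proj₂ (remQuot {m} (P ℕ.* P) v)))

    col : Fin n → Fin n → Fin P
    col v w = colour (point₁ v) (point₂ v) (point₁ w) (point₂ w)

    cl-vertex : ∀ i x₁ x₂ → cl (vertex i x₁ x₂) ≡ i
    cl-vertex i x₁ x₂ = cong proj₁ (remQuot-combine i (combine x₁ x₂))

    points-vertex : ∀ i x₁ x₂ → remQuot {P} P (proj₂ (remQuot {m} (P ℕ.* P) (vertex i x₁ x₂))) ≡ (x₁ , x₂)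
    points-vertex i x₁ x₂ = trans (cong (λ z → remQuot {P} P (proj₂ z)) (remQuot-combine i (combine x₁ x₂))) (remQuot-combine x₁ x₂)

    col-to : ∀ v j y₁ y₂ → col v (vertex j y₁ y₂) ≡ colour (point₁ v) (point₂ v) y₁ y₂
    col-to v j y₁ y₂ = cong (λ (y₁ , y₂) → colour (point₁ v) (point₂ v) y₁ y₂) (points-vertex j y₁ y₂)

    col-vertex : ∀ i x₁ x₂ j y₁ y₂ → col (vertex i x₁ x₂) (vertex j y₁ y₂) ≡ colour x₁ x₂ y₁ y₂
    col-vertex i x₁ x₂ j y₁ y₂ = trans (col-to (vertex i x₁ x₂) j y₁ y₂) (cong (λ (x₁ , x₂) → colour x₁ x₂ y₁ y₂) (points-vertex i x₁ x₂))

    col-sym : ∀ v w → col v w ≡ col w v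
    col-sym v w = colour-sym (point₁ v) (point₂ v) (point₁ w) (point₂ w)

    ∑-vertex : (f : Fin n → ℤ) → ∑ f ≡ ∑[ i ] ∑₂ (λ x₁ x₂ → f (vertex i x₁ x₂))
    ∑-vertex f = trans (∑-combine {m} {P ℕ.* P} f) (∑-cong (λ i → ∑-combine {P} {P} (λ z → f (combine i z))))

    π⁵ : ℤ
    π⁵ = + P * + P * + P * + P * + P

    -- The function of the colour may vary with the pair of clusters, as `M` requires. Each block is
    -- an instance of `colour-discrepancy`; Cauchy-Schwarz over `i` costs one factor m, and summing
    -- over `j` another.
    discrepancy : (g : Fin m → Fin m → Fin P → ℤ) → (∀ i j → ∑ (g i j) ≡ 0ℤ) → (∀ i j z → g i j z * g i j z ≤ + P * + P) →
      ∀ (f : Fin n → ℤ) →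
      ∑[ w ] (∑[ v ] (f v * g (cl v) (cl w) (col v w)) * ∑[ v ] (f v * g (cl v) (cl w) (col v w)))
        ≤ + m * + m * π⁵ * ∑[ v ] (f v * f v)
    discrepancy g ∑g≡0 g²≤ f = begin
      ∑[ w ] (r w * r w)
        ≡⟨ ∑-vertex (λ w → r w * r w) ⟩
      ∑[ j ] ∑₂ (λ y₁ y₂ → r (vertex j y₁ y₂) * r (vertex j y₁ y₂))
        ≡⟨ ∑-cong (λ j → ∑₂-cong (λ y₁ y₂ → cong (λ z → z * z) (r-vertex j y₁ y₂))) ⟩
      ∑[ j ] ∑₂ (λ y₁ y₂ → ∑[ i ] e i j y₁ y₂ * ∑[ i ] e i j y₁ y₂)
        ≤⟨ ∑-mono (λ j → ∑₂-mono (λ y₁ y₂ → cauchy (λ i → e i j y₁ y₂))) ⟩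
      ∑[ j ] ∑₂ (λ y₁ y₂ → + m * ∑[ i ] (e i j y₁ y₂ * e i j y₁ y₂))
        ≡⟨ ∑-cong (λ j → trans (∑₂-*ˡ (+ m) (λ y₁ y₂ → ∑[ i ] (e i j y₁ y₂ * e i j y₁ y₂)))
             (cong (+ m *_) (∑₂-∑-comm (λ y₁ y₂ i → e i j y₁ y₂ * e i j y₁ y₂)))) ⟩
      ∑[ j ] (+ m * ∑[ i ] ∑₂ (λ y₁ y₂ → e i j y₁ y₂ * e i j y₁ y₂))
        ≤⟨ ∑-mono (λ j → *-monoˡ (+ m) pos-nonneg (∑-mono (λ i → colour-discrepancy (g i j) (∑g≡0 i j) (g²≤ i j) (λ x₁ x₂ → f (vertex i x₁ x₂))))) ⟩
      ∑ {m} (λ j → + m * ∑[ i ] (π⁵ * ∑₂ (λ x₁ x₂ → f (vertex i x₁ x₂) * f (vertex i x₁ x₂))))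
        ≡⟨ ∑-const m (+ m * ∑[ i ] (π⁵ * ∑₂ (λ x₁ x₂ → f (vertex i x₁ x₂) * f (vertex i x₁ x₂)))) ⟩
      + m * (+ m * ∑[ i ] (π⁵ * ∑₂ (λ x₁ x₂ → f (vertex i x₁ x₂) * f (vertex i x₁ x₂))))
        ≡⟨ cong (λ z → + m * (+ m * z)) (trans (∑-*ˡ π⁵ (λ i → ∑₂ (λ x₁ x₂ → f (vertex i x₁ x₂) * f (vertex i x₁ x₂)))) (cong (π⁵ *_) (sym (∑-vertex (λ v → f v * f v))))) ⟩
      + m * (+ m * (π⁵ * ∑[ v ] (f v * f v)))
        ≡⟨ regroup (+ m) π⁵ (∑[ v ] (f v * f v)) ⟩
      + m * + m * π⁵ * ∑[ v ] (f v * f v) ∎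
      where
      open ≤-Reasoning
      r : Fin n → ℤ
      r w = ∑[ v ] (f v * g (cl v) (cl w) (col v w))
      e : Fin m → Fin m → Fin P → Fin P → ℤ
      e i j y₁ y₂ = ∑₂ (λ x₁ x₂ → f (vertex i x₁ x₂) * g i j (colour x₁ x₂ y₁ y₂))
      r-vertex : ∀ j y₁ y₂ → r (vertex j y₁ y₂) ≡ ∑[ i ] e i j y₁ y₂
      r-vertex j y₁ y₂ = trans (∑-vertex (λ v → f v * g (cl v) (cl (vertex j y₁ y₂)) (col v (vertex j y₁ y₂))))
        (∑-cong (λ i → ∑₂-cong (λ x₁ x₂ → cong (f (vertex i x₁ x₂) *_)
          (trans (cong (λ k → g k (cl (vertex j y₁ y₂)) (col (vertex i x₁ x₂) (vertex j y₁ y₂))) (cl-vertex i x₁ x₂))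
            (cong₂ (λ j z → g i j z) (cl-vertex j y₁ y₂) (col-vertex i x₁ x₂ j y₁ y₂))))))
      ∑₂-∑-comm : ∀ {k l o} (h : Fin k → Fin l → Fin o → ℤ) → ∑₂ (λ a b → ∑ (h a b)) ≡ ∑[ c ] ∑₂ (λ a b → h a b c)
      ∑₂-∑-comm h = trans (∑-cong (λ a → ∑-comm (h a))) (∑-comm (λ a c → ∑[ b ] h a b c))
      regroup : ∀ m q s → m * (m * (q * s)) ≡ m * m * q * s
      regroup = solve-∀

    -- `u` is a common unit of density. Since `weight` has average ρ / m, the factor m in `sM` makes
    -- its average over all pairs of clusters equal to `sA`, which is why `A` and `M` have the same
    -- size.
    sA : ℕ
    sA = u ℕ.* ρ

    sM : Fin m → Fin m → ℕ
    sM i j = u ℕ.* m ℕ.* weight i j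

    below : ℕ → Fin P → ℤ
    below s z = ⟦ toℕ z ℕ.<? s ⟧

    -- Pairs with one of the first sA colours form A; the next sM i j colours form the part of M
    -- between the clusters i and j.
    A M AM : Fin n → Fin n → ℤ
    A v w = below sA (col v w)
    AM v w = below (sA ℕ.+ sM (cl v) (cl w)) (col v w)
    M v w = AM v w - A v w

    below-mono : ∀ {s s′} → s ℕ.≤ s′ → ∀ z → below s z ≤ below s′ z
    below-mono {s} {s′} s≤s′ z = ⟦⟧-mono (toℕ z ℕ.<? s) (toℕ z ℕ.<? s′) (λ z<s → ℕ.<-≤-trans z<s s≤s′)

    module _ (0<m : 0 ℕ.< m) (thresholds : u ℕ.* (ρ ℕ.+ m ℕ.* (2 ℕ.* κ ℕ.+ 2)) ℕ.≤ P) where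

      sA+sM≤P : ∀ i j → sA ℕ.+ sM i j ℕ.≤ P
      sA+sM≤P i j = ℕ.≤-trans (ℕ.+-monoʳ-≤ sA (ℕ.*-monoʳ-≤ (u ℕ.* m) (weight≤ i j)))
        (ℕ.≤-trans (ℕ.≤-reflexive (regroup u ρ m (2 ℕ.* κ ℕ.+ 2))) thresholds)
        where
        regroup : ∀ u r m k → u ℕ.* r ℕ.+ u ℕ.* m ℕ.* k ≡ u ℕ.* (r ℕ.+ m ℕ.* k)
        regroup = ℕSolver.solve-∀

      sA≤P : Fin m → sA ℕ.≤ P
      sA≤P i = ℕ.≤-trans (ℕ.m≤m+n sA (sM i i)) (sA+sM≤P i i)

      private
        centred-bound : ∀ {x k} → 0ℤ ≤ x → x ≤ 1ℤ → 0ℤ ≤ k → k ≤ + P → (+ P * x - k) * (+ P * x - k) ≤ + P * + P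
        centred-bound {x} {k} 0≤x x≤1 0≤k k≤P = from-sub (*-nonneg
            (+-nonneg (*-nonneg (pos-nonneg {P}) (sub-nonneg x≤1)) 0≤k) (+-nonneg (sub-nonneg k≤P) (*-nonneg (pos-nonneg {P}) 0≤x)))
          (split (+ P) x k)
          where
          split : ∀ P x k → P * P ≡ (P * x - k) * (P * x - k) + (P * (1ℤ - x) + k) * ((P - k) + P * x)
          split = solve-∀

        ∑-centred : (f : Fin P → ℤ) → ∀ k → ∑ f ≡ k → ∑[ z ] (+ P * f z - k) ≡ 0ℤ
        ∑-centred f k ∑f≡k = trans (∑-minus (λ z → + P * f z) (λ _ → k)) (trans (cong₂ _-_ (trans (∑-*ˡ (+ P) f) (cong (+ P *_) ∑f≡k)) (∑-const P k)) (+-inverseʳ (+ P * k)))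

      A-discrepancy : ∀ (f : Fin n → ℤ) →
        ∑[ w ] ((+ P * ∑[ v ] (f v * A v w) - + sA * ∑ f) * (+ P * ∑[ v ] (f v * A v w) - + sA * ∑ f)) ≤ + m * + m * π⁵ * ∑[ v ] (f v * f v)
      A-discrepancy f = ≤-trans (≤-reflexive (∑-cong (λ w → cong (λ z → z * z) (centre w))))
        (discrepancy (λ _ _ z → + P * below sA z - + sA)
          (λ i _ → ∑-centred (below sA) (+ sA) (∑-threshold sA (sA≤P i)))
          (λ i _ z → centred-bound (⟦⟧-nonneg (toℕ z ℕ.<? sA)) (⟦⟧≤1 (toℕ z ℕ.<? sA)) pos-nonneg (+≤+ (sA≤P i))) f)
        where
        split : ∀ f P a s → P * (f * a) - s * f ≡ f * (P * a - s)
        split = solve-∀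
        centre : ∀ w → + P * ∑[ v ] (f v * A v w) - + sA * ∑ f ≡ ∑[ v ] (f v * (+ P * A v w - + sA))
        centre w = trans (cong₂ _-_ (sym (∑-*ˡ (+ P) (λ v → f v * A v w))) (sym (∑-*ˡ (+ sA) f)))
          (trans (sym (∑-minus (λ v → + P * (f v * A v w)) (λ v → + sA * f v))) (∑-cong (λ v → split (f v) (+ P) (A v w) (+ sA))))

      M-density : ∀ i j → ∑[ z ] (below (sA ℕ.+ sM i j) z - below sA z) ≡ + sM i j
      M-density i j = trans (∑-minus (below (sA ℕ.+ sM i j)) (below sA))
        (trans (cong₂ _-_ (∑-threshold (sA ℕ.+ sM i j) (sA+sM≤P i j)) (∑-threshold sA (sA≤P i))) (cancel (+ sA) (+ sM i j)))
        where
        cancel : ∀ x y → (x + y) - x ≡ y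
        cancel = solve-∀

      0≤M : ∀ v w → 0ℤ ≤ M v w
      0≤M v w = sub-nonneg (below-mono (ℕ.m≤m+n sA (sM (cl v) (cl w))) (col v w))

      M≤1 : ∀ v w → M v w ≤ 1ℤ
      M≤1 v w = ≤-trans (from-sub (⟦⟧-nonneg (toℕ (col v w) ℕ.<? sA)) (split (AM v w) (A v w))) (⟦⟧≤1 (toℕ (col v w) ℕ.<? (sA ℕ.+ sM (cl v) (cl w))))
        where
        split : ∀ x y → x ≡ (x - y) + y
        split = solve-∀

      ∑₂-weight : ∀ (f : Fin n → ℤ) → ∑₂ (λ w v → f w * (f v * + weight (cl v) (cl w)))
        ≡ ∑₂ (λ i j → + weight i j * (∑₂ (λ x₁ x₂ → f (vertex i x₁ x₂)) * ∑₂ (λ x₁ x₂ → f (vertex j x₁ x₂))))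
      ∑₂-weight f = begin
        ∑₂ (λ w v → f w * (f v * + weight (cl v) (cl w)))
          ≡⟨ ∑-comm (λ w v → f w * (f v * + weight (cl v) (cl w))) ⟩
        ∑₂ (λ v w → f w * (f v * + weight (cl v) (cl w)))
          ≡⟨ ∑-cong (λ v → trans (∑-vertex (λ w → f w * (f v * + weight (cl v) (cl w))))
               (∑-cong (λ j → trans (∑₂-cong (λ y₁ y₂ → trans (cong (λ z → f (vertex j y₁ y₂) * (f v * + weight (cl v) z)) (cl-vertex j y₁ y₂))
                 (*-comm (f (vertex j y₁ y₂)) _))) (∑₂-*ˡ (f v * + weight (cl v) j) (λ y₁ y₂ → f (vertex j y₁ y₂)))))) ⟩
        ∑[ v ] ∑[ j ] (f v * + weight (cl v) j * F j)
          ≡⟨ ∑-comm (λ v j → f v * + weight (cl v) j * F j) ⟩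
        ∑[ j ] ∑[ v ] (f v * + weight (cl v) j * F j)
          ≡⟨ ∑-cong (λ j → trans (∑-vertex (λ v → f v * + weight (cl v) j * F j))
               (∑-cong (λ i → trans (∑₂-cong (λ x₁ x₂ → trans (cong (λ z → f (vertex i x₁ x₂) * + weight z j * F j) (cl-vertex i x₁ x₂))
                 (regroup₁ (f (vertex i x₁ x₂)) (+ weight i j) (F j))))
                 (trans (∑₂-*ˡ (+ weight i j * F j) (λ x₁ x₂ → f (vertex i x₁ x₂))) (regroup₂ (+ weight i j) (F j) (F i)))))) ⟩
        ∑[ j ] ∑[ i ] (+ weight i j * (F i * F j))
          ≡⟨ ∑-comm (λ j i → + weight i j * (F i * F j)) ⟩
        ∑₂ (λ i j → + weight i j * (F i * F j)) ∎
        where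
        open ≡-Reasoning
        F : Fin m → ℤ
        F i = ∑₂ (λ x₁ x₂ → f (vertex i x₁ x₂))
        regroup₁ : ∀ x y z → x * y * z ≡ y * z * x
        regroup₁ = solve-∀
        regroup₂ : ∀ x y z → x * y * z ≡ x * (z * y)
        regroup₂ = solve-∀

      -- Replacing each block of `M` by its mean `sM i j` / P leaves a form in the cluster sums of
      -- `f`, bounded below by `weight-form-lower`. The deviation `N` is controlled by the square of
      -- `θ * f + t² * r` together with the norm bound `Y≤`.
      M-form : ∀ t → t * t * t * t ≤ + P → 0ℤ ≤ t → 0 ℕ.< κ → p ℕ.≤ κ ℕ.* κ → ∀ (f : Fin n → ℤ) →
        t * t * + sA * (∑ f * ∑ f) ≤ t * t * + P * ∑₂ (λ v w → f v * f w * M v w) + + m * + m * (+ P * + P * + P) * ∑[ v ] (f v * f v)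
      M-form t t⁴≤P 0≤t 0<κ p≤κ² f = *-cancel 0<θ (*-cancel {+ 2} (+<+ (ℕ.s≤s ℕ.z≤n)) (from-sub
          (+-nonneg (*-nonneg (*-nonneg {+ 2} pos-nonneg (*-nonneg (<⇒≤ 0<θ) (*-nonneg (square-nonneg t) (pos-nonneg {u})))) (sub-nonneg main-term))
            (+-nonneg square-terms (*-nonneg slack ∑f²≥0)))
          total))
        where
        π = + P
        -- P³ balances the two ends of the completed square: θ² = P⁶, while t⁴ ≤ P turns t⁴ P⁵ into
        -- at most P⁶.
        θ = π * π * π
        μ = + m
        q = ∑[ v ] (f v * f v)
        g : Fin m → Fin m → Fin P → ℤ
        g i j z = π * (below (sA ℕ.+ sM i j) z - below sA z) - + sM i j
        r : Fin n → ℤ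
        r w = ∑[ v ] (f v * g (cl v) (cl w) (col v w))
        B N Y : ℤ
        B = ∑₂ (λ i j → + weight i j * (∑₂ (λ x₁ x₂ → f (vertex i x₁ x₂)) * ∑₂ (λ x₁ x₂ → f (vertex j x₁ x₂))))
        N = ∑[ w ] (f w * r w)
        Y = ∑[ w ] (r w * r w)
        0<π : 0ℤ < π
        0<π = +<+ (ℕ.>-nonZero⁻¹ P {{prime⇒nonZero P-prime}})
        0<θ : 0ℤ < θ
        0<θ = *-pos (*-pos 0<π 0<π) 0<π
        ∑f²≥0 : 0ℤ ≤ q
        ∑f²≥0 = ∑-nonneg (λ v → square-nonneg (f v))
        Y≤ : Y ≤ μ * μ * π⁵ * q
        Y≤ = discrepancy g (λ i j → ∑-centred (λ z → below (sA ℕ.+ sM i j) z - below sA z) (+ sM i j) (M-density i j))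
          (λ i j z → centred-bound (sub-nonneg (below-mono (ℕ.m≤m+n sA (sM i j)) z))
             (≤-trans (from-sub (⟦⟧-nonneg (toℕ z ℕ.<? sA)) (resplit (below (sA ℕ.+ sM i j) z) (below sA z))) (⟦⟧≤1 (toℕ z ℕ.<? (sA ℕ.+ sM i j))))
             pos-nonneg (+≤+ (ℕ.≤-trans (ℕ.m≤n+m (sM i j) sA) (sA+sM≤P i j)))) f
          where
          resplit : ∀ x y → x ≡ (x - y) + y
          resplit = solve-∀
        main-term : + ρ * (∑ f * ∑ f) ≤ μ * B
        main-term = ≤-trans (≤-reflexive (cong (λ z → + ρ * (z * z)) (∑-vertex f))) (weight-form-lower 0<κ p≤κ² (λ i → ∑₂ (λ x₁ x₂ → f (vertex i x₁ x₂))))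
        decompose : π * ∑₂ (λ v w → f v * f w * M v w) ≡ + u * μ * B + N
        decompose = begin
          π * ∑₂ (λ v w → f v * f w * M v w)
            ≡⟨ ∑₂-*ˡ π (λ v w → f v * f w * M v w) ⟨
          ∑₂ (λ v w → π * (f v * f w * M v w))
            ≡⟨ ∑-comm (λ v w → π * (f v * f w * M v w)) ⟩
          ∑₂ (λ w v → π * (f v * f w * M v w))
            ≡⟨ ∑₂-cong (λ w v → trans (split π (f v) (f w) (M v w) (+ sM (cl v) (cl w)))
                 (cong (λ z → f w * (f v * z) + f w * (f v * g (cl v) (cl w) (col v w))) (+sM (cl v) (cl w)))) ⟩
          ∑₂ (λ w v → f w * (f v * (+ u * μ * + weight (cl v) (cl w))) + f w * (f v * g (cl v) (cl w) (col v w)))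
            ≡⟨ ∑₂-+ (λ w v → f w * (f v * (+ u * μ * + weight (cl v) (cl w)))) (λ w v → f w * (f v * g (cl v) (cl w) (col v w))) ⟩
          ∑₂ (λ w v → f w * (f v * (+ u * μ * + weight (cl v) (cl w)))) + ∑₂ (λ w v → f w * (f v * g (cl v) (cl w) (col v w)))
            ≡⟨ cong₂ _+_ (trans (∑₂-cong (λ w v → pull (f w) (f v) (+ u * μ) (+ weight (cl v) (cl w))))
                 (trans (∑₂-*ˡ (+ u * μ) (λ w v → f w * (f v * + weight (cl v) (cl w)))) (cong (+ u * μ *_) (∑₂-weight f))))
                 (∑-cong (λ w → ∑-*ˡ (f w) (λ v → f v * g (cl v) (cl w) (col v w)))) ⟩
          + u * μ * B + N ∎
          where
          open ≡-Reasoning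
          +sM : ∀ i j → + sM i j ≡ + u * μ * + weight i j
          +sM i j = trans (pos-* (u ℕ.* m) (weight i j)) (cong (_* + weight i j) (pos-* u m))
          split : ∀ π x y M s → π * (x * y * M) ≡ y * (x * s) + y * (x * (π * M - s))
          split = solve-∀
          pull : ∀ x y c z → x * (y * (c * z)) ≡ c * (x * (y * z))
          pull = solve-∀
        S : ℤ
        S = ∑[ w ] ((θ * f w + t * t * r w) * (θ * f w + t * t * r w))
        S≡ : S ≡ θ * θ * q + + 2 * θ * (t * t) * N + t * t * t * t * Y
        S≡ = trans (∑-cong (λ w → square θ (t * t) (f w) (r w)))
          (trans (∑-+ (λ w → θ * θ * (f w * f w) + + 2 * θ * (t * t) * (f w * r w)) (λ w → (t * t) * (t * t) * (r w * r w)))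
            (cong₂ _+_ (trans (∑-+ (λ w → θ * θ * (f w * f w)) (λ w → + 2 * θ * (t * t) * (f w * r w)))
               (cong₂ _+_ (∑-*ˡ (θ * θ) (λ w → f w * f w)) (∑-*ˡ (+ 2 * θ * (t * t)) (λ w → f w * r w))))
               (trans (∑-*ˡ ((t * t) * (t * t)) (λ w → r w * r w)) (cong (_* Y) (sym (*-assoc (t * t) t t))))))
          where
          square : ∀ θ t x y → (θ * x + t * y) * (θ * x + t * y) ≡ θ * θ * (x * x) + + 2 * θ * t * (x * y) + t * t * (y * y)
          square = solve-∀
        t⁴≥0 : 0ℤ ≤ t * t * t * t
        t⁴≥0 = *-nonneg (*-nonneg (square-nonneg t) 0≤t) 0≤t
        square-terms : 0ℤ ≤ S + t * t * t * t * (μ * μ * π⁵ * q - Y)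
        square-terms = +-nonneg (∑-nonneg (λ w → square-nonneg (θ * f w + t * t * r w))) (*-nonneg t⁴≥0 (sub-nonneg Y≤))
        slack : 0ℤ ≤ (μ * μ - 1ℤ) * (θ * θ) + μ * μ * π⁵ * (π - t * t * t * t)
        slack = +-nonneg (*-nonneg (sub-nonneg (*-mono {1ℤ} {μ} {1ℤ} {μ} pos-nonneg pos-nonneg (+≤+ 0<m) (+≤+ 0<m))) (square-nonneg θ))
          (*-nonneg (*-nonneg (square-nonneg μ) (<⇒≤ (*-pos (*-pos 0<θ 0<π) 0<π))) (sub-nonneg t⁴≤P))
        total : + 2 * (θ * (t * t * π * ∑₂ (λ v w → f v * f w * M v w) + μ * μ * θ * q)) ≡
          + 2 * (θ * (t * t * + sA * (∑ f * ∑ f))) +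
            (+ 2 * (θ * (t * t * + u)) * (μ * B - + ρ * (∑ f * ∑ f)) + (S + t * t * t * t * (μ * μ * π⁵ * q - Y) + ((μ * μ - 1ℤ) * (θ * θ) + μ * μ * π⁵ * (π - t * t * t * t)) * q))
        total = trans (cong (λ z → + 2 * (θ * (z + μ * μ * θ * q))) (trans (*-assoc (t * t) π _) (cong (t * t *_) decompose)))
          (trans (regroup π t μ q (+ u) B N (+ ρ) (∑ f * ∑ f) Y)
            (cong₂ (λ x y → + 2 * (θ * (t * t * x * (∑ f * ∑ f))) + (+ 2 * (θ * (t * t * + u)) * (μ * B - + ρ * (∑ f * ∑ f)) + (y + t * t * t * t * (μ * μ * π⁵ * q - Y) + ((μ * μ - 1ℤ) * (θ * θ) + μ * μ * π⁵ * (π - t * t * t * t)) * q)))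
              (sym (pos-* u ρ)) (sym S≡)))
          where
          regroup : ∀ π t μ q u B N ρ F Y → + 2 * (π * π * π * (t * t * (u * μ * B + N) + μ * μ * (π * π * π) * q)) ≡
            + 2 * (π * π * π * (t * t * (u * ρ) * F)) +
            (+ 2 * (π * π * π * (t * t * u)) * (μ * B - ρ * F) + ((π * π * π * (π * π * π) * q + + 2 * (π * π * π) * (t * t) * N + t * t * t * t * Y)
               + t * t * t * t * (μ * μ * (π * π * π * π * π) * q - Y) + ((μ * μ - 1ℤ) * (π * π * π * (π * π * π)) + μ * μ * (π * π * π * π * π) * (π - t * t * t * t)) * q))
          regroup = solve-∀

      ∑₂-A : ∑₂ A ≡ + n * (+ m * (+ P * + sA))
      ∑₂-A = trans (∑-cong A-row) (∑-const n (+ m * (+ P * + sA)))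
        where
        A-row : ∀ v → ∑ (A v) ≡ + m * (+ P * + sA)
        A-row v = trans (∑-vertex (A v)) (trans (∑-cong (λ i → trans (∑₂-cong (λ y₁ y₂ → cong (below sA) (col-to v i y₁ y₂)))
          (trans (∑-colour (below sA) (point₁ v) (point₂ v)) (cong (+ P *_) (∑-threshold sA (sA≤P i)))))) (∑-const m (+ P * + sA)))

      -- The value agrees with `∑₂-A` because `∑-weight` is m ρ: summed over all pairs of clusters,
      -- `sM` gives m² `sA`.
      ∑₂-M : ∑₂ M ≡ + n * (+ m * (+ P * + sA))
      ∑₂-M = begin
        ∑₂ M
          ≡⟨ ∑-vertex (λ v → ∑ (M v)) ⟩
        ∑[ i ] ∑₂ (λ x₁ x₂ → ∑ (M (vertex i x₁ x₂)))
          ≡⟨ ∑-cong (λ i → trans (∑₂-cong (λ x₁ x₂ → trans (M-row (vertex i x₁ x₂)) (cong (λ k → ∑[ j ] (+ P * + sM k j)) (cl-vertex i x₁ x₂))))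
               (∑₂-const P P (∑[ j ] (+ P * + sM i j)))) ⟩
        ∑[ i ] (+ P * (+ P * ∑[ j ] (+ P * + sM i j)))
          ≡⟨ ∑-cong (λ i → trans (cong (λ z → + P * (+ P * z)) (trans (∑-cong (λ j → trans (cong (+ P *_) (trans (pos-* (u ℕ.* m) (weight i j)) (cong (_* + weight i j) (pos-* u m))))
               (sym (*-assoc (+ P) (+ u * + m) (+ weight i j))))) (∑-*ˡ (+ P * (+ u * + m)) (λ j → + weight i j))))
               (regroup₁ (+ P) (+ P * (+ u * + m)) (∑[ j ] + weight i j))) ⟩
        ∑[ i ] (+ P * + P * (+ P * (+ u * + m)) * ∑[ j ] + weight i j)
          ≡⟨ trans (∑-*ˡ (+ P * + P * (+ P * (+ u * + m))) (λ i → ∑[ j ] + weight i j)) (cong (+ P * + P * (+ P * (+ u * + m)) *_) ∑-weight) ⟩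
        + P * + P * (+ P * (+ u * + m)) * (+ m * + ρ)
          ≡⟨ regroup₂ (+ P) (+ u) (+ m) (+ ρ) ⟩
        + m * (+ P * + P) * (+ m * (+ P * (+ u * + ρ)))
          ≡⟨ cong₂ (λ x y → x * (+ m * (+ P * y))) (trans (pos-* m (P ℕ.* P)) (cong (+ m *_) (pos-* P P))) (pos-* u ρ) ⟨
        + n * (+ m * (+ P * + sA)) ∎
        where
        open ≡-Reasoning
        regroup₁ : ∀ P x y → P * (P * (x * y)) ≡ P * P * x * y
        regroup₁ = solve-∀
        regroup₂ : ∀ P u m r → P * P * (P * (u * m)) * (m * r) ≡ m * (P * P) * (m * (P * (u * r)))
        regroup₂ = solve-∀
        M-row : ∀ v → ∑ (M v) ≡ ∑[ j ] (+ P * + sM (cl v) j)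
        M-row v = trans (∑-vertex (M v)) (∑-cong (λ j → trans (∑₂-cong (λ y₁ y₂ → cong₂ (λ k z → below (sA ℕ.+ sM (cl v) k) z - below sA z) (cl-vertex j y₁ y₂) (col-to v j y₁ y₂)))
          (trans (∑-colour (λ z → below (sA ℕ.+ sM (cl v) j) z - below sA z) (point₁ v) (point₂ v)) (cong (+ P *_) (M-density (cl v) j)))))

  -- Integer square roots

  ceil-sqrt : ∀ N → Σ[ s ∈ ℕ ] (N ℕ.≤ s ℕ.* s × s ℕ.* s ℕ.≤ N ℕ.+ 2 ℕ.* s × s ℕ.≤ N)
  ceil-sqrt zero = 0 , ℕ.z≤n , ℕ.z≤n , ℕ.z≤n
  ceil-sqrt (suc N) with ceil-sqrt N
  ... | s , N≤s² , s²≤ , s≤N with suc N ℕ.≤? s ℕ.* s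
  ...   | yes N<s² = s , N<s² , ℕ.m≤n⇒m≤1+n s²≤ , ℕ.m≤n⇒m≤1+n s≤N
  ...   | no N≮s² = suc s , ℕ.≤-trans (ℕ.s≤s N≤s²) (ℕ.≤-trans (ℕ.m≤m+n (suc (s ℕ.* s)) (2 ℕ.* s)) (ℕ.≤-reflexive (sym (square s))))
      , ℕ.≤-trans (ℕ.≤-reflexive (square s)) (ℕ.≤-trans (ℕ.+-monoˡ-≤ (2 ℕ.* s) (ℕ.s≤s (ℕ.≤-pred (ℕ.≰⇒> N≮s²)))) (ℕ.+-monoʳ-≤ (suc N) (ℕ.*-monoʳ-≤ 2 (ℕ.n≤1+n s))))
      , ℕ.s≤s s≤N
      where
      square : ∀ s → suc s ℕ.* suc s ≡ suc (s ℕ.* s) ℕ.+ 2 ℕ.* s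
      square = ℕSolver.solve-∀

  -- A root of N + L with L just above n / t. The summand L bounds s² from below by n / t;
  -- multiplied by t, it costs at most 2 n, and the rounding 2 t s at most another 2 n. The bound s
  -- ≤ 3 n makes (3n)! a multiple of s.
  regularized-sqrt : ∀ n t → 0 ℕ.< n → 0 ℕ.< t → t ℕ.≤ n → 9 ℕ.* (t ℕ.* t) ℕ.≤ n → ∀ N → N ℕ.≤ n →
    Σ[ s ∈ ℕ ] (0 ℕ.< s × N ℕ.≤ s ℕ.* s × n ℕ.≤ t ℕ.* (s ℕ.* s) × t ℕ.* (s ℕ.* s) ℕ.≤ t ℕ.* N ℕ.+ 4 ℕ.* n × s ℕ.≤ 3 ℕ.* n)
  regularized-sqrt n t@(suc _) 0<n 0<t t≤n 9t²≤n N N≤n = s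
    , 0<s , ℕ.≤-trans (ℕ.m≤m+n N L) N+L≤s² , ℕ.≤-trans n≤tL (ℕ.*-monoʳ-≤ t (ℕ.≤-trans (ℕ.m≤n+m L N) N+L≤s²))
    , ts²≤ , s≤3n
    where
    L = suc (n ℕ./ t)
    n≤tL : n ℕ.≤ t ℕ.* L
    n≤tL = ℕ.<⇒≤ (ℕ.<-≤-trans (ℕ.≤-<-trans (ℕ.≤-reflexive (ℕ.m≡m%n+[m/n]*n n t)) (ℕ.+-monoˡ-< (n ℕ./ t ℕ.* t) (ℕ.m%n<n n t)))
      (ℕ.≤-reflexive (ℕ.*-comm L t)))
    tL≤2n : t ℕ.* L ℕ.≤ 2 ℕ.* n
    tL≤2n = ℕ.≤-trans (ℕ.≤-reflexive (ℕ.*-comm t L)) (ℕ.≤-trans (ℕ.+-mono-≤ t≤n (ℕ.m/n*n≤m n t)) (ℕ.≤-reflexive (cong (n ℕ.+_) (sym (ℕ.+-identityʳ n)))))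
    L≤2n : L ℕ.≤ 2 ℕ.* n
    L≤2n = ℕ.≤-trans (ℕ.m≤n*m L t) tL≤2n
    s = proj₁ (ceil-sqrt (N ℕ.+ L))
    N+L≤s² = proj₁ (proj₂ (ceil-sqrt (N ℕ.+ L)))
    s²≤ = proj₁ (proj₂ (proj₂ (ceil-sqrt (N ℕ.+ L))))
    s≤3n : s ℕ.≤ 3 ℕ.* n
    s≤3n = ℕ.≤-trans (proj₂ (proj₂ (proj₂ (ceil-sqrt (N ℕ.+ L))))) (ℕ.+-mono-≤ N≤n L≤2n)
    0<s : 0 ℕ.< s
    0<s with s | N+L≤s²
    ... | zero  | h = ⊥-elim (ℕ.<⇒≱ (ℕ.s≤s ℕ.z≤n) (ℕ.≤-trans (ℕ.m≤n+m L N) h))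
    ... | suc _ | _ = ℕ.s≤s ℕ.z≤n
    -- The crude bound s ≤ 3 n already makes s² ≤ 9 n, and then (t s)² ≤ 9 t² n ≤ n².
    ts≤n : t ℕ.* s ℕ.≤ n
    ts≤n = ℕ.≮⇒≥ λ n<ts → ℕ.<⇒≱ (ℕ.*-mono-< n<ts n<ts) (begin
      t ℕ.* s ℕ.* (t ℕ.* s)        ≡⟨ regroup₁ t s ⟩
      t ℕ.* t ℕ.* (s ℕ.* s)        ≤⟨ ℕ.*-monoʳ-≤ (t ℕ.* t) (begin
        s ℕ.* s                          ≤⟨ s²≤ ⟩
        N ℕ.+ L ℕ.+ 2 ℕ.* s              ≤⟨ ℕ.+-mono-≤ (ℕ.+-mono-≤ N≤n L≤2n) (ℕ.*-monoʳ-≤ 2 s≤3n) ⟩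
        n ℕ.+ 2 ℕ.* n ℕ.+ 2 ℕ.* (3 ℕ.* n)  ≡⟨ regroup₂ n ⟩
        9 ℕ.* n                          ∎) ⟩
      t ℕ.* t ℕ.* (9 ℕ.* n)        ≡⟨ regroup₃ (t ℕ.* t) n ⟩
      9 ℕ.* (t ℕ.* t) ℕ.* n        ≤⟨ ℕ.*-monoˡ-≤ n 9t²≤n ⟩
      n ℕ.* n                      ∎)
      where
      open ℕ.≤-Reasoning
      regroup₁ : ∀ t s → t ℕ.* s ℕ.* (t ℕ.* s) ≡ t ℕ.* t ℕ.* (s ℕ.* s)
      regroup₁ = ℕSolver.solve-∀
      regroup₂ : ∀ n → n ℕ.+ 2 ℕ.* n ℕ.+ 2 ℕ.* (3 ℕ.* n) ≡ 9 ℕ.* n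
      regroup₂ = ℕSolver.solve-∀
      regroup₃ : ∀ t n → t ℕ.* (9 ℕ.* n) ≡ 9 ℕ.* t ℕ.* n
      regroup₃ = ℕSolver.solve-∀
    ts²≤ : t ℕ.* (s ℕ.* s) ℕ.≤ t ℕ.* N ℕ.+ 4 ℕ.* n
    ts²≤ = begin
      t ℕ.* (s ℕ.* s)                             ≤⟨ ℕ.*-monoʳ-≤ t s²≤ ⟩
      t ℕ.* (N ℕ.+ L ℕ.+ 2 ℕ.* s)                 ≡⟨ regroup t N L s ⟩
      t ℕ.* N ℕ.+ (t ℕ.* L ℕ.+ 2 ℕ.* (t ℕ.* s))   ≤⟨ ℕ.+-monoʳ-≤ (t ℕ.* N) (ℕ.+-mono-≤ tL≤2n (ℕ.*-monoʳ-≤ 2 ts≤n)) ⟩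
      t ℕ.* N ℕ.+ (2 ℕ.* n ℕ.+ 2 ℕ.* n)           ≡⟨ cong (t ℕ.* N ℕ.+_) (collect n) ⟩
      t ℕ.* N ℕ.+ 4 ℕ.* n                         ∎
      where
      open ℕ.≤-Reasoning
      regroup : ∀ t N L s → t ℕ.* (N ℕ.+ L ℕ.+ 2 ℕ.* s) ≡ t ℕ.* N ℕ.+ (t ℕ.* L ℕ.+ 2 ℕ.* (t ℕ.* s))
      regroup = ℕSolver.solve-∀
      collect : ∀ n → 2 ℕ.* n ℕ.+ 2 ℕ.* n ≡ 4 ℕ.* n
      collect = ℕSolver.solve-∀

  -- Triangle-free subgraphs of the constructed graph

  module _ {p : ℕ} (p-prime : Prime p) (p∤2 : ¬ (+ p ∣ + 2)) (c₀ κ : ℕ) {P : ℕ} (P-prime : Prime P) (u : ℕ) where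

    open Matrices p-prime p∤2 c₀ κ P-prime u

    -- `T` splits by colour into `TA` and `TM`, to which `triangle-free-bound` applies. As ∑ s²
    -- exceeds ∑ `TA` by at most 4 n² / t, the bracket there becomes the excess of `T` over `M`.
    triangle-free-total : (0<m : 0 ℕ.< m) → u ℕ.* (ρ ℕ.+ m ℕ.* (2 ℕ.* κ ℕ.+ 2)) ℕ.≤ P → 0 ℕ.< κ → p ℕ.≤ κ ℕ.* κ →
      ∀ t → 0 ℕ.< t → t ℕ.* t ℕ.* t ℕ.* t ℕ.≤ P → 9 ℕ.≤ P → ∀ K → P ℕ.≤ K ℕ.* sA →
      (T : Fin n → Fin n → ℤ) → (∀ v w → T v w ≡ T w v) → (∀ v w → 0ℤ ≤ T v w) → (∀ v w → T v w ≤ AM v w) →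
      (∀ v w → T v w * T v w ≡ T v w) → (∀ x v w → T x v * T x w * T v w ≡ 0ℤ) →
      + t * (∑₂ T - ∑₂ M) ≤ (+ 2 * + m * + K + + 4) * (+ n * + n)
    triangle-free-total 0<m thresholds 0<κ p≤κ² t 0<t t⁴≤P 9≤P K P≤KsA T T-sym 0≤T T≤AM T²≡T T-free =
      *-cancel 0<R (*-cancel 0<τ bound)
      where
      τ π R μ ν : ℤ
      τ = + t
      π = + P
      R = + sA
      μ = + m
      ν = + n
      0<P : 0 ℕ.< P
      0<P = ℕ.<-≤-trans (ℕ.s≤s ℕ.z≤n) 9≤P
      0<sA : 0 ℕ.< sA
      0<sA = ℕ.n≢0⇒n>0 λ sA≡0 → ℕ.<⇒≱ 0<P (ℕ.≤-trans P≤KsA (ℕ.≤-reflexive (trans (cong (K ℕ.*_) sA≡0) (ℕ.*-zeroʳ K))))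
      0<τ : 0ℤ < τ
      0<τ = +<+ 0<t
      0<π : 0ℤ < π
      0<π = +<+ 0<P
      0<R : 0ℤ < R
      0<R = +<+ 0<sA
      0<θ : 0ℤ < π * π * π
      0<θ = *-pos (*-pos 0<π 0<π) 0<π
      0<n : 0 ℕ.< n
      0<n = ℕ.*-mono-< 0<m (ℕ.*-mono-< 0<P 0<P)
      t⁴≤ : τ * τ * τ * τ ≤ π
      t⁴≤ = subst (_≤ π) (trans (pos-* (t ℕ.* t ℕ.* t) t) (cong (_* τ) (trans (pos-* (t ℕ.* t) t) (cong (_* τ) (pos-* t t))))) (+≤+ t⁴≤P)
      +n : ν ≡ μ * (π * π)
      +n = trans (pos-* m (P ℕ.* P)) (cong (μ *_) (pos-* P P))
      1≤μ : 1ℤ ≤ μ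
      1≤μ = +≤+ 0<m
      9t²≤n : 9 ℕ.* (t ℕ.* t) ℕ.≤ n
      9t²≤n = begin
        9 ℕ.* (t ℕ.* t)          ≤⟨ ℕ.*-mono-≤ 9≤P (ℕ.m≤m*n (t ℕ.* t) (t ℕ.* t) {{ℕ.>-nonZero (ℕ.*-mono-< 0<t 0<t)}}) ⟩
        P ℕ.* (t ℕ.* t ℕ.* (t ℕ.* t))  ≡⟨ cong (P ℕ.*_) (ℕ.*-assoc (t ℕ.* t) t t) ⟨
        P ℕ.* (t ℕ.* t ℕ.* t ℕ.* t)    ≤⟨ ℕ.*-monoʳ-≤ P t⁴≤P ⟩
        P ℕ.* P                  ≤⟨ ℕ.m≤n*m (P ℕ.* P) m {{ℕ.>-nonZero 0<m}} ⟩
        n                        ∎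
        where open ℕ.≤-Reasoning
      t≤n : t ℕ.≤ n
      t≤n = ℕ.≤-trans (ℕ.m≤m*n t t {{ℕ.>-nonZero 0<t}}) (ℕ.≤-trans (ℕ.m≤n*m (t ℕ.* t) 9) 9t²≤n)

      TA TM : Fin n → Fin n → ℤ
      TA v w = T v w * A v w
      TM v w = T v w * M v w

      0≤A : ∀ v w → 0ℤ ≤ A v w
      0≤A v w = ⟦⟧-nonneg (toℕ (col v w) ℕ.<? sA)
      A≤1 : ∀ v w → A v w ≤ 1ℤ
      A≤1 v w = ⟦⟧≤1 (toℕ (col v w) ℕ.<? sA)
      T≤1 : ∀ v w → T v w ≤ 1ℤ
      T≤1 v w = ≤-trans (T≤AM v w) (⟦⟧≤1 (toℕ (col v w) ℕ.<? (sA ℕ.+ sM (cl v) (cl w))))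
      TX≤X : ∀ {x y} → x ≤ 1ℤ → 0ℤ ≤ y → x * y ≤ y
      TX≤X {x} {y} x≤1 0≤y = from-sub (*-nonneg (sub-nonneg x≤1) 0≤y) (split x y)
        where
        split : ∀ x y → y ≡ x * y + (1ℤ - x) * y
        split = solve-∀
      A-sym : ∀ v w → A v w ≡ A w v
      A-sym v w = cong (below sA) (col-sym v w)
      sM-sym : ∀ i j → sM i j ≡ sM j i
      sM-sym i j = cong (u ℕ.* m ℕ.*_) (weight-sym i j)
      M-sym : ∀ v w → M v w ≡ M w v
      M-sym v w = cong₂ _-_ (cong₂ (λ s z → below (sA ℕ.+ s) z) (sM-sym (cl v) (cl w)) (col-sym v w)) (A-sym v w)
      -- Idempotence squeezes T = T² ≤ T `AM` ≤ T.
      T-split : ∀ v w → TA v w + TM v w ≡ T v w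
      T-split v w = ≤-antisym (≤-trans (≤-reflexive (regroup (T v w) (A v w) (AM v w)))
          (subst (_≤ T v w) (*-comm (AM v w) (T v w)) (TX≤X (⟦⟧≤1 (toℕ (col v w) ℕ.<? (sA ℕ.+ sM (cl v) (cl w)))) (0≤T v w))))
        (≤-trans (≤-reflexive (sym (T²≡T v w))) (≤-trans (*-monoˡ (T v w) (0≤T v w) (T≤AM v w)) (≤-reflexive (sym (regroup (T v w) (A v w) (AM v w))))))
        where
        regroup : ∀ t a x → t * a + t * (x - a) ≡ t * x
        regroup = solve-∀

      a : Fin n → ℤ
      a v = ∑ (TA v)
      0≤a : ∀ v → 0ℤ ≤ a v
      0≤a v = ∑-nonneg (λ w → *-nonneg (0≤T v w) (0≤A v w))
      aₙ : Fin n → ℕ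
      aₙ v = ∣ a v ∣
      +aₙ : ∀ v → + aₙ v ≡ a v
      +aₙ v = 0≤i⇒+∣i∣≡i (0≤a v)
      aₙ≤n : ∀ v → aₙ v ℕ.≤ n
      aₙ≤n v = drop‿+≤+ (subst₂ _≤_ (sym (+aₙ v)) (trans (∑-const n 1ℤ) (*-identityʳ ν))
        (∑-mono (λ w → ≤-trans (TX≤X (T≤1 v w) (0≤A v w)) (A≤1 v w))))
      sqrt = λ v → regularized-sqrt n t 0<n 0<t t≤n 9t²≤n (aₙ v) (aₙ≤n v)
      s : Fin n → ℕ
      s v = proj₁ (sqrt v)
      0<s : ∀ v → 0 ℕ.< s v
      0<s v = proj₁ (proj₂ (sqrt v))
      s∣Λ : ∀ v → s v ℕ.∣ (3 ℕ.* n) !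
      s∣Λ v with s v | 0<s v | proj₂ (proj₂ (proj₂ (proj₂ (proj₂ (sqrt v)))))
      ... | suc k | _ | s≤ = ℕ.∣-trans (ℕ.m∣m*n (k !)) (ℕ.m≤n⇒m!∣n! s≤)
      -- Λ / s v, with the common denominator Λ = (3n)!
      φ : Fin n → ℤ
      φ v = + (ℕ.quotient (s∣Λ v))
      φs≡Λ : ∀ v → φ v * + s v ≡ + ((3 ℕ.* n) !)
      φs≡Λ v = trans (sym (pos-* (ℕ.quotient (s∣Λ v)) (s v))) (cong +_ (sym (ℕ._∣_.equality (s∣Λ v))))

      -- With n = m P², the error c₁ n + t c₃ is (1 + t) m³ P⁵ ≤ 2 t m P n², and P ≤ K `sA` turns
      -- this into the term 2 m K n² of the bound. The remaining 4 n² is the rounding error in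
      -- `∑s²`.
      c₁ c₂ c₃ : ℤ
      c₁ = μ * μ * (π * π * π)
      c₂ = μ * μ * π⁵
      c₃ = μ * μ * μ * π⁵
      0≤π⁵ : 0ℤ ≤ π⁵
      0≤π⁵ = <⇒≤ (*-pos (*-pos 0<θ 0<π) 0<π)
      constants : π * π * π * (π * π * π) * ν + τ * τ * τ * τ * (c₂ * ν) ≤ + 2 * (π * π * π) * c₃
      constants = from-sub (+-nonneg (*-nonneg (*-nonneg (*-nonneg (pos-nonneg {m}) (sub-nonneg (*-mono {1ℤ} {μ} {1ℤ} {μ} pos-nonneg pos-nonneg 1≤μ 1≤μ))) 0≤π⁵) (<⇒≤ 0<θ))
          (*-nonneg (*-nonneg (sub-nonneg t⁴≤) (*-nonneg (square-nonneg μ) 0≤π⁵)) (pos-nonneg {n})))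
        (trans (split μ π τ) (cong (λ z → π * π * π * (π * π * π) * z + τ * τ * τ * τ * (c₂ * z)
          + (μ * (μ * μ - 1ℤ * 1ℤ) * π⁵ * (π * π * π) + (π - τ * τ * τ * τ) * (μ * μ * π⁵) * z)) (sym +n)))
        where
        split : ∀ μ π τ → + 2 * (π * π * π) * (μ * μ * μ * (π * π * π * π * π)) ≡
          π * π * π * (π * π * π) * (μ * (π * π)) + τ * τ * τ * τ * (μ * μ * (π * π * π * π * π) * (μ * (π * π)))
            + (μ * (μ * μ - 1ℤ * 1ℤ) * (π * π * π * π * π) * (π * π * π) + (π - τ * τ * τ * τ) * (μ * μ * (π * π * π * π * π)) * (μ * (π * π)))
        split = solve-∀

      main : τ * τ * R * (+ 2 * ∑₂ TA - ∑[ x ] (+ s x * + s x) + ∑₂ TM - ∑₂ M) ≤ c₁ * ν + τ * c₃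
      main = TriangleFree.triangle-free-bound A M TA TM π R τ (π * π * π) c₁ c₂ c₃ (+ ((3 ℕ.* n) !)) (λ v → + s v) φ
        (<⇒≤ 0<π) (<⇒≤ 0<R) (<⇒≤ 0<τ) 0<θ
        (*-nonneg (square-nonneg μ) (<⇒≤ 0<θ)) (*-nonneg (*-nonneg (square-nonneg μ) (pos-nonneg {m})) 0≤π⁵)
        (+<+ (ℕ.1≤n! (3 ℕ.* n))) (+<+ 0<n)
        (λ v w → cong₂ _*_ (T-sym v w) (A-sym v w)) (λ v w → *-nonneg (0≤T v w) (0≤A v w))
        (λ v w → ≤-trans (TX≤X (T≤1 v w) (0≤A v w)) (A≤1 v w)) (λ v w → TX≤X (T≤1 v w) (0≤A v w))
        M-sym (M≤1 0<m thresholds)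
        (λ v w → cong₂ _*_ (T-sym v w) (M-sym v w)) (λ v w → *-nonneg (0≤T v w) (0≤M 0<m thresholds v w)) (λ v w → TX≤X (T≤1 v w) (0≤M 0<m thresholds v w))
        (λ x v w → trans (regroup (T x v) (A x v) (T x w) (A x w) (T v w) (M v w)) (trans (cong (_* (A x v * A x w * M v w)) (T-free x v w)) (*-zeroˡ (A x v * A x w * M v w))))
        (M-form 0<m thresholds τ t⁴≤ (<⇒≤ 0<τ) 0<κ p≤κ²) (A-discrepancy 0<m thresholds)
        (*-nonneg (square-nonneg μ) 0≤π⁵) constants
        (λ v → +<+ (0<s v)) φs≡Λ
        (λ v → subst₂ _≤_ (+aₙ v) (pos-* (s v) (s v)) (+≤+ (proj₁ (proj₂ (proj₂ (sqrt v))))))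
        (λ v → subst (ν ≤_) (trans (pos-* t (s v ℕ.* s v)) (cong (τ *_) (pos-* (s v) (s v)))) (+≤+ (proj₁ (proj₂ (proj₂ (proj₂ (sqrt v)))))))
        where
        regroup : ∀ a b c d e f → a * b * (c * d) * (e * f) ≡ a * c * e * (b * d * f)
        regroup = solve-∀

      ∑s² : τ * ∑[ x ] (+ s x * + s x) ≤ τ * ∑₂ TA + + 4 * (ν * ν)
      ∑s² = begin
        τ * ∑[ x ] (+ s x * + s x)      ≡⟨ ∑-*ˡ τ (λ x → + s x * + s x) ⟨
        ∑[ x ] (τ * (+ s x * + s x))    ≤⟨ ∑-mono pointwise ⟩
        ∑[ x ] (τ * a x + + 4 * ν)      ≡⟨ trans (∑-+ (λ x → τ * a x) (λ _ → + 4 * ν)) (cong₂ _+_ (∑-*ˡ τ a) (trans (∑-const n (+ 4 * ν)) (regroup ν))) ⟩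
        τ * ∑₂ TA + + 4 * (ν * ν) ∎
        where
        open ≤-Reasoning
        regroup : ∀ ν → ν * (+ 4 * ν) ≡ + 4 * (ν * ν)
        regroup = solve-∀
        pointwise : ∀ x → τ * (+ s x * + s x) ≤ τ * a x + + 4 * ν
        pointwise x = subst₂ _≤_ (trans (pos-* t (s x ℕ.* s x)) (cong (τ *_) (pos-* (s x) (s x))))
          (cong₂ _+_ (trans (pos-* t (aₙ x)) (cong (τ *_) (+aₙ x))) (pos-* 4 n))
          (+≤+ (proj₁ (proj₂ (proj₂ (proj₂ (proj₂ (sqrt x)))))))

      bound : τ * (R * (τ * (∑₂ T - ∑₂ M))) ≤ τ * (R * ((+ 2 * μ * + K + + 4) * (ν * ν)))
      bound = from-sub (+-nonneg (sub-nonneg main) (+-nonneg (*-nonneg (*-nonneg (<⇒≤ 0<τ) (<⇒≤ 0<R)) (sub-nonneg ∑s²))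
          (+-nonneg (*-nonneg (*-nonneg (sub-nonneg 1≤τ) (*-nonneg (square-nonneg μ) (pos-nonneg {m}))) 0≤π⁵)
            (*-nonneg (*-nonneg (*-nonneg {+ 2} {τ} pos-nonneg (<⇒≤ 0<τ)) (*-nonneg (pos-nonneg {m}) (square-nonneg ν))) (sub-nonneg P≤KR)))))
        (trans (cong (λ z → τ * (R * ((+ 2 * μ * + K + + 4) * (z * z)))) +n)
          (trans (split τ R μ (+ K) π (∑₂ TA) (∑₂ TM) (∑₂ M) (∑[ x ] (+ s x * + s x)))
            (cong₂ (λ x z → τ * (R * (τ * (x - ∑₂ M)))
              + ((c₁ * z + τ * c₃ - τ * τ * R * (+ 2 * ∑₂ TA - ∑[ x ] (+ s x * + s x) + ∑₂ TM - ∑₂ M))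
                + (τ * R * (τ * ∑₂ TA + + 4 * (z * z) - τ * ∑[ x ] (+ s x * + s x))
                  + ((τ - 1ℤ) * (μ * μ * μ) * π⁵ + + 2 * τ * (μ * (z * z)) * (+ K * R - π)))))
              (trans (sym (∑₂-+ TA TM)) (∑₂-cong T-split)) (sym +n))))
        where
        1≤τ : 1ℤ ≤ τ
        1≤τ = +≤+ 0<t
        P≤KR : π ≤ + K * R
        P≤KR = subst (π ≤_) (pos-* K sA) (+≤+ P≤KsA)
        split : ∀ τ R μ K π ta tm M S → τ * (R * ((+ 2 * μ * K + + 4) * (μ * (π * π) * (μ * (π * π))))) ≡
          τ * (R * (τ * (ta + tm - M)))
              + ((μ * μ * (π * π * π) * (μ * (π * π)) + τ * (μ * μ * μ * (π * π * π * π * π)) - τ * τ * R * (+ 2 * ta - S + tm - M))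
                + (τ * R * (τ * ta + + 4 * (μ * (π * π) * (μ * (π * π))) - τ * S)
                  + ((τ - 1ℤ) * (μ * μ * μ) * (π * π * π * π * π) + + 2 * τ * (μ * (μ * (π * π) * (μ * (π * π)))) * (K * R - π))))
        split = solve-∀

  -- Primes congruent to 2 modulo 3

  product%3≢2 : ∀ ks → All (λ k → k ℕ.% 3 ≢ 2) ks → List.product ks ℕ.% 3 ≢ 2
  product%3≢2 [] [] ()
  product%3≢2 (k ∷ ks) (k≢ ∷ ks≢) eq = residues (k ℕ.% 3) (List.product ks ℕ.% 3) (ℕ.m%n<n k 3) (ℕ.m%n<n (List.product ks) 3)
    k≢ (product%3≢2 ks ks≢) (trans (sym (ℕ.%-distribˡ-* k (List.product ks) 3)) eq)
    where
    residues : ∀ a b → a ℕ.< 3 → b ℕ.< 3 → a ≢ 2 → b ≢ 2 → (a ℕ.* b) ℕ.% 3 ≢ 2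
    residues 0 b _ _ _ _ ()
    residues 1 0 _ _ _ _ ()
    residues 1 1 _ _ _ _ ()
    residues 1 2 _ _ _ b≢2 _ = b≢2 refl
    residues 2 b _ _ a≢2 _ _ = a≢2 refl
    residues 1 (suc (suc (suc b))) _ (ℕ.s≤s (ℕ.s≤s (ℕ.s≤s ())))
    residues (suc (suc (suc a))) b (ℕ.s≤s (ℕ.s≤s (ℕ.s≤s ())))

  prime-factor≡2mod3 : ∀ {N} → PrimeFactorisation N → N ℕ.% 3 ≡ 2 → Σ[ p ∈ ℕ ] (Prime p × p ℕ.∣ N × p ℕ.% 3 ≡ 2)
  prime-factor≡2mod3 {N} factorisation N%3≡2 = from-dec (Any.any? (λ k → k ℕ.% 3 ℕ.≟ 2) ps)
    where
    open PrimeFactorisation factorisation renaming (factors to ps)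
    from-dec : Dec (Any.Any (λ k → k ℕ.% 3 ≡ 2) ps) → Σ[ p ∈ ℕ ] (Prime p × p ℕ.∣ N × p ℕ.% 3 ≡ 2)
    from-dec (no none) = ⊥-elim (product%3≢2 ps (All.¬Any⇒All¬ ps none) (trans (cong (ℕ._% 3) (sym isFactorisation)) N%3≡2))
    from-dec (yes some) with find some
    ... | p , p∈ps , p%3≡2 = p , All.lookup factorsPrime p∈ps , subst (p ℕ.∣_) (sym isFactorisation) (List.∈⇒∣product p∈ps) , p%3≡2

  -- Euclid's argument with 3 b! - 1, written as 2 + (b! - 1) 3 to stay in the naturals. Residues 0
  -- and 1 are closed under multiplication, so some prime factor is 2 modulo 3, and no factor is at
  -- most b.
  prime≡2mod3-above : ∀ b → Σ[ p ∈ ℕ ] (Prime p × b ℕ.< p × p ℕ.% 3 ≡ 2)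
  prime≡2mod3-above b with prime-factor≡2mod3 (factorise (2 ℕ.+ ℕ.pred (b !) ℕ.* 3)) (ℕ.[m+kn]%n≡m%n 2 (ℕ.pred (b !)) 3)
  ... | p , p-prime , p∣N , p%3≡2 = p , p-prime , ℕ.≰⇒> p≰b , p%3≡2
    where
    N+1≡3b! : 3 ℕ.+ ℕ.pred (b !) ℕ.* 3 ≡ b ! ℕ.* 3
    N+1≡3b! = cong (ℕ._* 3) (ℕ.suc-pred (b !) {{ℕ.>-nonZero (ℕ.1≤n! b)}})
    1<p : 1 ℕ.< p
    1<p = ℕ.nonTrivial⇒n>1 p {{prime⇒nonTrivial p-prime}}
    p∣b! : ∀ q → 1 ℕ.< q → q ℕ.≤ b → q ℕ.∣ b !
    p∣b! (suc q) _ q≤b = ℕ.∣-trans (ℕ.m∣m*n (q !)) (ℕ.m≤n⇒m!∣n! q≤b)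
    p≰b : ¬ p ℕ.≤ b
    p≰b p≤b = ℕ.>⇒∤ 1<p (ℕ.∣m+n∣m⇒∣n (subst (p ℕ.∣_) (trans (sym N+1≡3b!) (ℕ.+-comm 1 (2 ℕ.+ ℕ.pred (b !) ℕ.* 3))) (ℕ.∣m⇒∣m*n 3 (p∣b! p 1<p p≤b))) p∣N)

  -- Anisotropy of x² + xy + y² modulo p

  least : ℕ → ℕ → ℕ → ℤ
  least a b c = ⟦ a ℕ.<? b ⟧ * ⟦ a ℕ.<? c ⟧

  evaluate : ∀ {α α′ β β′ γ γ′ x x′ y y′ z z′ : ℤ} → α ≡ x → α′ ≡ x′ → β ≡ y → β′ ≡ y′ → γ ≡ z → γ′ ≡ z′ →
    α * γ′ + β * α′ + γ * β′ ≡ x * z′ + y * x′ + z * y′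
  evaluate refl refl refl refl refl refl = refl

  -- Lets `least` select one member of each 3-cycle: the sum runs over the rotations of the cycle.
  -- Two of the eight sign patterns are cyclic and contradict transitivity.
  least-unique : ∀ {a b c} → a ≢ b → b ≢ c → c ≢ a → least a b c + least b c a + least c a b ≡ 1ℤ
  least-unique {a} {b} {c} a≢b b≢c c≢a with ℕ.<-cmp a b | ℕ.<-cmp b c | ℕ.<-cmp c a
  ... | tri≈ _ a≡b _ | _ | _ = ⊥-elim (a≢b a≡b)
  ... | tri< _ _ _ | tri≈ _ b≡c _ | _ = ⊥-elim (b≢c b≡c)
  ... | tri> _ _ _ | tri≈ _ b≡c _ | _ = ⊥-elim (b≢c b≡c)
  ... | tri< _ _ _ | tri< _ _ _ | tri≈ _ c≡a _ = ⊥-elim (c≢a c≡a)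
  ... | tri< _ _ _ | tri> _ _ _ | tri≈ _ c≡a _ = ⊥-elim (c≢a c≡a)
  ... | tri> _ _ _ | tri< _ _ _ | tri≈ _ c≡a _ = ⊥-elim (c≢a c≡a)
  ... | tri> _ _ _ | tri> _ _ _ | tri≈ _ c≡a _ = ⊥-elim (c≢a c≡a)
  ... | tri< x _ x′ | tri< y _ y′ | tri< z _ z′ = ⊥-elim (ℕ.<-asym (ℕ.<-trans x y) z)
  ... | tri> x′ _ x | tri> y′ _ y | tri> z′ _ z = ⊥-elim (ℕ.<-asym (ℕ.<-trans y x) z)
  ... | tri< x _ x′ | tri< y _ y′ | tri> z′ _ z = evaluate (⟦⟧-yes (a ℕ.<? b) x) (⟦⟧-no (b ℕ.<? a) x′) (⟦⟧-yes (b ℕ.<? c) y) (⟦⟧-no (c ℕ.<? b) y′) (⟦⟧-no (c ℕ.<? a) z′) (⟦⟧-yes (a ℕ.<? c) z)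
  ... | tri< x _ x′ | tri> y′ _ y | tri< z _ z′ = evaluate (⟦⟧-yes (a ℕ.<? b) x) (⟦⟧-no (b ℕ.<? a) x′) (⟦⟧-no (b ℕ.<? c) y′) (⟦⟧-yes (c ℕ.<? b) y) (⟦⟧-yes (c ℕ.<? a) z) (⟦⟧-no (a ℕ.<? c) z′)
  ... | tri< x _ x′ | tri> y′ _ y | tri> z′ _ z = evaluate (⟦⟧-yes (a ℕ.<? b) x) (⟦⟧-no (b ℕ.<? a) x′) (⟦⟧-no (b ℕ.<? c) y′) (⟦⟧-yes (c ℕ.<? b) y) (⟦⟧-no (c ℕ.<? a) z′) (⟦⟧-yes (a ℕ.<? c) z)
  ... | tri> x′ _ x | tri< y _ y′ | tri< z _ z′ = evaluate (⟦⟧-no (a ℕ.<? b) x′) (⟦⟧-yes (b ℕ.<? a) x) (⟦⟧-yes (b ℕ.<? c) y) (⟦⟧-no (c ℕ.<? b) y′) (⟦⟧-yes (c ℕ.<? a) z) (⟦⟧-no (a ℕ.<? c) z′)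
  ... | tri> x′ _ x | tri< y _ y′ | tri> z′ _ z = evaluate (⟦⟧-no (a ℕ.<? b) x′) (⟦⟧-yes (b ℕ.<? a) x) (⟦⟧-yes (b ℕ.<? c) y) (⟦⟧-no (c ℕ.<? b) y′) (⟦⟧-no (c ℕ.<? a) z′) (⟦⟧-yes (a ℕ.<? c) z)
  ... | tri> x′ _ x | tri> y′ _ y | tri< z _ z′ = evaluate (⟦⟧-no (a ℕ.<? b) x′) (⟦⟧-yes (b ℕ.<? a) x) (⟦⟧-no (b ℕ.<? c) y′) (⟦⟧-yes (c ℕ.<? b) y) (⟦⟧-yes (c ℕ.<? a) z) (⟦⟧-no (a ℕ.<? c) z′)

  -- If u² + u + 1 ≡ 0, multiplication by u permutes the nonzero residues in cycles of length 3,
  -- so 3 divides p - 1.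
  module _ {p : ℕ} (p-prime : Prime p) (p%3≡2 : p ℕ.% 3 ≡ 2) where

    private instance
      p≢0 : ℕ.NonZero p
      p≢0 = prime⇒nonZero p-prime

    p∤1 : ¬ (+ p ∣ 1ℤ)
    p∤1 d = ℕ.>⇒∤ (ℕ.nonTrivial⇒n>1 p {{prime⇒nonTrivial p-prime}}) (∣⇒∣ᵤ d)

    p∤3 : ¬ (+ p ∣ + 3)
    p∤3 d = small p p%3≡2 (∣⇒∣ᵤ d)
      where
      small : ∀ q → q ℕ.% 3 ≡ 2 → ¬ (q ℕ.∣ 3)
      small 0 ()
      small 1 ()
      small 2 _ d = toWitnessFalse {a? = 2 ℕ.∣? 3} _ d
      small 3 ()
      small (suc (suc (suc (suc q)))) _ d = ℕ.>⇒∤ (ℕ.s≤s (ℕ.s≤s (ℕ.s≤s (ℕ.s≤s ℕ.z≤n)))) d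

    scale : ℕ → Fin p → Fin p
    scale k z = fromℕ< (ℕ.m%n<n (k ℕ.* toℕ z) p)

    scale-∣ : ∀ k z → + p ∣ + toℕ (scale k z) - + k * + toℕ z
    scale-∣ k z = subst (λ x → + p ∣ + toℕ (scale k z) - x) (pos-* k (toℕ z))
      (%-≡⇒∣ (toℕ (scale k z)) (k ℕ.* toℕ z) p
        (trans (cong (ℕ._% p) (toℕ-fromℕ< (ℕ.m%n<n (k ℕ.* toℕ z) p))) (ℕ.m%n%n≡m%n (k ℕ.* toℕ z) p)))

    ∣⇒≡ : ∀ (x y : Fin p) → + p ∣ + toℕ x - + toℕ y → x ≡ y
    ∣⇒≡ x y d with x ≟ y
    ... | yes x≡y = x≡y
    ... | no x≢y = ⊥-elim (Fin-∤ x y x≢y d)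

    scale-injective : ∀ k → ¬ (+ p ∣ + k) → ∀ {z z′} → scale k z ≡ scale k z′ → z ≡ z′
    scale-injective k p∤k {z} {z′} eq = Sum.[ (λ d → ⊥-elim (p∤k d)) , ∣⇒≡ z z′ ]′
      (∣-prime p-prime (+ k) (+ toℕ z - + toℕ z′)
        (subst (+ p ∣_) (regroup (+ toℕ (scale k z)) (+ k) (+ toℕ z) (+ toℕ z′))
          (∣m∣n⇒∣m-n (subst (λ x → + p ∣ + toℕ x - + k * + toℕ z′) (sym eq) (scale-∣ k z′)) (scale-∣ k z))))
      where
      regroup : ∀ s k z z′ → (s - k * z′) - (s - k * z) ≡ k * (z - z′)
      regroup = solve-∀

    -- Serves as division modulo p. By `∑-injective` the preimages of `x` number exactly one, so
    -- there cannot be none.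
    scale-surjective : ∀ k → ¬ (+ p ∣ + k) → ∀ x → Σ[ z ∈ Fin p ] scale k z ≡ x
    scale-surjective k p∤k x = from-dec (Fin.any? (λ z → scale k z ≟ x))
      where
      hits : ∑[ z ] ⟦ scale k z ≟ x ⟧ ≡ 1ℤ
      hits = trans (∑-injective (scale k) (scale-injective k p∤k) (λ z → ⟦ z ≟ x ⟧))
        (trans (∑-cong (λ z → ⟦⟧-⇔ (z ≟ x) (x ≟ z) sym sym)) (∑-δ1 x))
      0≢1 : 0ℤ ≢ 1ℤ
      0≢1 ()
      from-dec : Dec (Σ[ z ∈ Fin p ] scale k z ≡ x) → Σ[ z ∈ Fin p ] scale k z ≡ x
      from-dec (yes hit) = hit
      from-dec (no miss) = ⊥-elim (0≢1 (trans (sym (∑-0 {f = λ z → ⟦ scale k z ≟ x ⟧} (λ z → ⟦⟧-no (scale k z ≟ x) (λ eq → miss (z , eq))))) hits))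

    no-cube-root : ∀ u → ¬ (+ p ∣ + u * + u + + u + 1ℤ)
    no-cube-root u d = p%3≢1 (begin
      p ℕ.% 3                        ≡⟨ cong (ℕ._% 3) (+-injective (trans count (cong (_+_ 1ℤ) (trans (cong (+ 3 *_) (sym (0≤i⇒+∣i∣≡i 0≤L))) (sym (pos-* 3 ∣ L ∣)))))) ⟩
      (1 ℕ.+ 3 ℕ.* ∣ L ∣) ℕ.% 3      ≡⟨ cong (λ z → (1 ℕ.+ z) ℕ.% 3) (ℕ.*-comm 3 ∣ L ∣) ⟩
      (1 ℕ.+ ∣ L ∣ ℕ.* 3) ℕ.% 3      ≡⟨ ℕ.[m+kn]%n≡m%n 1 ∣ L ∣ 3 ⟩
      1                              ∎)
      where
      open ≡-Reasoning
      p%3≢1 : p ℕ.% 3 ≢ 1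
      p%3≢1 eq with () ← trans (sym p%3≡2) eq
      p∤u : ¬ (+ p ∣ + u)
      p∤u du = p∤1 (∣m+n∣m⇒∣n d (∣m∣n⇒∣m+n (∣m⇒∣m*n (+ u) du) du))
      p∤u-1 : ¬ (+ p ∣ + u - 1ℤ)
      p∤u-1 du = p∤3 (subst (+ p ∣_) (reduce (+ u)) (∣m∣n⇒∣m-n d (∣m⇒∣m*n (+ u + + 2) du)))
        where
        reduce : ∀ u → (u * u + u + 1ℤ) - (u - 1ℤ) * (u + + 2) ≡ + 3
        reduce = solve-∀
      g : Fin p → Fin p
      g = scale u
      g-inj : ∀ {z z′} → g z ≡ g z′ → z ≡ z′
      g-inj = scale-injective u p∤u
      o : Fin p
      o = fromℕ< (ℕ.>-nonZero⁻¹ p)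
      +o : + toℕ o ≡ 0ℤ
      +o = cong +_ (toℕ-fromℕ< (ℕ.>-nonZero⁻¹ p))
      -- The factorisation u³ - 1 = (u - 1)(u² + u + 1), applied to the three successive reductions
      -- modulo p.
      g³ : ∀ z → g (g (g z)) ≡ z
      g³ z = ∣⇒≡ (g (g (g z))) z (subst (+ p ∣_) (telescope (+ u) (+ toℕ z) (+ toℕ (g z)) (+ toℕ (g (g z))) (+ toℕ (g (g (g z)))))
        (∣m∣n⇒∣m+n (∣m∣n⇒∣m+n (scale-∣ u (g (g z))) (∣n⇒∣m*n (+ u) (scale-∣ u (g z))))
          (∣m∣n⇒∣m+n (∣n⇒∣m*n (+ u * + u) (scale-∣ u z)) (∣m⇒∣m*n ((+ u - 1ℤ) * + toℕ z) d))))
        where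
        telescope : ∀ u z a b c → ((c - u * b) + u * (b - u * a)) + (u * u * (a - u * z) + (u * u + u + 1ℤ) * ((u - 1ℤ) * z)) ≡ c - z
        telescope = solve-∀
      g-fixed : ∀ z → g z ≡ z → z ≡ o
      g-fixed z eq = Sum.[ (λ du → ⊥-elim (p∤u-1 du)) , (λ dz → ∣⇒≡ z o (subst (+ p ∣_) (sym (trans (cong (λ y → + toℕ z - y) +o) (+-identityʳ (+ toℕ z)))) dz)) ]′
        (∣-prime p-prime (+ u - 1ℤ) (+ toℕ z) (subst (+ p ∣_) (regroup (+ u) (+ toℕ z))
          (∣m⇒∣-m (subst (λ y → + p ∣ + toℕ y - + u * + toℕ z) eq (scale-∣ u z)))))
        where
        regroup : ∀ u z → - (z - u * z) ≡ (u - 1ℤ) * z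
        regroup = solve-∀
      go≡o : g o ≡ o
      go≡o = ∣⇒≡ (g o) o (subst (+ p ∣_) (trans (cong (λ y → + toℕ (g o) - + u * y) +o) (trans (vanish (+ toℕ (g o)) (+ u)) (cong (λ y → + toℕ (g o) - y) (sym +o)))) (scale-∣ u o))
        where
        vanish : ∀ x u → x - u * 0ℤ ≡ x - 0ℤ
        vanish = solve-∀
      ℓ : Fin p → ℤ
      ℓ z = least (toℕ z) (toℕ (g z)) (toℕ (g (g z)))
      L : ℤ
      L = ∑ ℓ
      0≤L : 0ℤ ≤ L
      0≤L = ∑-nonneg (λ z → *-nonneg (⟦⟧-nonneg (toℕ z ℕ.<? toℕ (g z))) (⟦⟧-nonneg (toℕ z ℕ.<? toℕ (g (g z)))))
      least-refl : ∀ a c → least a a c ≡ 0ℤ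
      least-refl a c = trans (cong (_* ⟦ a ℕ.<? c ⟧) (⟦⟧-no (a ℕ.<? a) (ℕ.<-irrefl refl))) (*-zeroˡ ⟦ a ℕ.<? c ⟧)
      -- Each residue is either 0 or lies in a 3-cycle with exactly one least member. Summed over
      -- `z`, where each rotation of `ℓ` has the same sum, this counts p = 1 + 3 L.
      orbit : ∀ z → ⟦ o ≟ z ⟧ + (ℓ z + ℓ (g z) + ℓ (g (g z))) ≡ 1ℤ
      orbit z with o ≟ z
      ... | yes refl = cong (_+_ 1ℤ) (trans (cong₂ (λ x y → ℓ o + x + y) (cong ℓ go≡o) (cong ℓ (trans (cong g go≡o) go≡o)))
              (cong (λ x → x + x + x) (trans (cong (λ x → least (toℕ o) (toℕ x) (toℕ (g (g o)))) go≡o) (least-refl (toℕ o) (toℕ (g (g o)))))))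
      ... | no o≢z = trans (+-identityˡ _) (trans
              (cong₂ (λ x y → ℓ z + x + y) (cong (λ y → least (toℕ (g z)) (toℕ (g (g z))) (toℕ y)) (g³ z))
                (cong₂ (λ x y → least (toℕ (g (g z))) (toℕ x) (toℕ y)) (g³ z) (cong g (g³ z))))
              (least-unique z≢gz gz≢ggz ggz≢z))
        where
        gz≢z : g z ≢ z
        gz≢z eq = o≢z (sym (g-fixed z eq))
        z≢gz : toℕ z ≢ toℕ (g z)
        z≢gz eq = gz≢z (sym (toℕ-injective eq))
        gz≢ggz : toℕ (g z) ≢ toℕ (g (g z))
        gz≢ggz eq = gz≢z (sym (g-inj (toℕ-injective eq)))
        ggz≢z : toℕ (g (g z)) ≢ toℕ z
        ggz≢z eq = gz≢z (trans (sym (cong g (toℕ-injective eq))) (g³ z))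
      count : + p ≡ 1ℤ + + 3 * L
      count = begin
        + p
          ≡⟨ trans (∑-const p 1ℤ) (*-identityʳ (+ p)) ⟨
        ∑ {p} (λ _ → 1ℤ)
          ≡⟨ ∑-cong orbit ⟨
        ∑[ z ] (⟦ o ≟ z ⟧ + (ℓ z + ℓ (g z) + ℓ (g (g z))))
          ≡⟨ ∑-+ (λ z → ⟦ o ≟ z ⟧) (λ z → ℓ z + ℓ (g z) + ℓ (g (g z))) ⟩
        ∑[ z ] ⟦ o ≟ z ⟧ + ∑[ z ] (ℓ z + ℓ (g z) + ℓ (g (g z)))
          ≡⟨ cong₂ _+_ (∑-δ1 o) (trans (∑-+ (λ z → ℓ z + ℓ (g z)) (λ z → ℓ (g (g z)))) (cong₂ _+_ (trans (∑-+ ℓ (λ z → ℓ (g z)))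
               (cong (_+_ L) (∑-injective g g-inj ℓ))) (trans (∑-injective g g-inj (λ z → ℓ (g z))) (∑-injective g g-inj ℓ)))) ⟩
        1ℤ + (L + L + L)
          ≡⟨ triple L ⟩
        1ℤ + + 3 * L ∎
        where
        triple : ∀ x → 1ℤ + (x + x + x) ≡ 1ℤ + + 3 * x
        triple = solve-∀

    residue : ∀ x → + p ∣ x - + (x %ℕ p)
    residue x = divides (x /ℕ p) (trans (cong (_- + (x %ℕ p)) (a≡a%ℕn+[a/ℕn]*n x p)) (cancel (+ (x %ℕ p)) (x /ℕ p * + p)))
      where
      cancel : ∀ x y → (x + y) - x ≡ y
      cancel = solve-∀

    -- A residue u with u y ≡ x turns the form into y² (u² + u + 1), so a zero would produce a root
    -- excluded by `no-cube-root`.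
    anisotropic : ∀ x y → ¬ (+ p ∣ y) → ¬ (+ p ∣ x * x + x * y + y * y)
    anisotropic x y p∤y d with scale-surjective (y %ℕ p) (λ k → p∤y (subst (+ p ∣_) (rejoin y (+ (y %ℕ p))) (∣m∣n⇒∣m+n (residue y) k)))
        (fromℕ< (n%ℕd<d x p))
      where
      rejoin : ∀ x y → (x - y) + y ≡ x
      rejoin = solve-∀
    ... | z , eq = Sum.[ (λ dy² → Sum.[ p∤y , p∤y ]′ (∣-prime p-prime y y dy²)) , no-cube-root (toℕ z) ]′
      (∣-prime p-prime (y * y) (u * u + u + 1ℤ) (subst (+ p ∣_) (reduce x y u) (∣m∣n⇒∣m-n d (∣m⇒∣m*n (x + u * y + y) p∣x-uy))))
      where
      u x̄ ȳ : ℤ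
      u = + toℕ z
      x̄ = + (x %ℕ p)
      ȳ = + (y %ℕ p)
      p∣x̄-ȳu : + p ∣ x̄ - ȳ * u
      p∣x̄-ȳu = subst (λ w → + p ∣ + w - ȳ * u) (trans (cong toℕ eq) (toℕ-fromℕ< (n%ℕd<d x p))) (scale-∣ (y %ℕ p) z)
      p∣x-uy : + p ∣ x - u * y
      p∣x-uy = subst (+ p ∣_) (assemble x x̄ y ȳ u) (∣m∣n⇒∣m-n (∣m∣n⇒∣m+n (residue x) p∣x̄-ȳu) (∣n⇒∣m*n u (residue y)))
        where
        assemble : ∀ x x̄ y ȳ u → ((x - x̄) + (x̄ - ȳ * u)) - u * (y - ȳ) ≡ x - u * y
        assemble = solve-∀
      reduce : ∀ x y u → (x * x + x * y + y * y) - (x - u * y) * (x + u * y + y) ≡ y * y * (u * u + u + 1ℤ)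
      reduce = solve-∀

  -- Triangle-freeness of the planar Cayley graph

  module _ {p : ℕ} (p-prime : Prime p) (p%3≡2 : p ℕ.% 3 ≡ 2) (p∤2 : ¬ (+ p ∣ + 2)) (c₀ κ : ℕ) where

    open Clusters p-prime p∤2 c₀ κ

    private instance
      p≢0 : ℕ.NonZero p
      p≢0 = prime⇒nonZero p-prime

    private
      a b : Fin m → ℤ
      a i = + toℕ (coord₁ i)
      b i = + toℕ (coord₂ i)

      Arc : Fin m → Fin m → Set
      Arc i j = + p ∣ (a i - a j) * (a i - a j) + b i - b j

      arc⇒∣ : ∀ i j → rot (dist² (coord₁ j) (coord₁ i)) (coord₂ i) ≡ coord₂ j → Arc i j
      arc⇒∣ i j eq = subst (λ x → + p ∣ x + b i - b j) (trans (dist²-ℤ (coord₁ j) (coord₁ i)) (flip (a j) (a i)))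
        (%-≡⇒∣ (dist² (coord₁ j) (coord₁ i) ℕ.+ toℕ (coord₂ i)) (toℕ (coord₂ j)) p
          (trans (sym (toℕ-rot _ (coord₂ i))) (trans (cong toℕ eq) (sym (ℕ.m<n⇒m%n≡m (toℕ<n (coord₂ j)))))))
        where
        flip : ∀ x y → (x - y) * (x - y) ≡ (y - x) * (y - x)
        flip = solve-∀

      E⇒same-copy : ∀ i j → 0 ℕ.< E i j → copy i ≡ copy j
      E⇒same-copy i j 0<E with copy i ≟ copy j
      ... | yes eq = eq

      E⇒Arc : ∀ i j → 0 ℕ.< E i j → Arc i j ⊎ Arc j i
      E⇒Arc i j 0<E with copy i ≟ copy j | arc? i j | arc? j i
      ... | yes _ | yes x | _     = inj₁ (arc⇒∣ i j x)
      ... | yes _ | no _  | yes y = inj₂ (arc⇒∣ j i y)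

      -- If the first coordinates agree, the arc relation in either direction reduces to agreement
      -- of the second ones, and the two vertices coincide.
      E⇒a≢ : ∀ i j → i ≢ j → 0 ℕ.< E i j → ¬ (+ p ∣ a i - a j)
      E⇒a≢ i j i≢j 0<E da = i≢j (cluster-injective (E⇒same-copy i j 0<E) (∣⇒≡ p-prime p%3≡2 _ _ da) (∣⇒≡ p-prime p%3≡2 _ _ (db (E⇒Arc i j 0<E))))
        where
        drop₁ : ∀ x y z → (x * x + y - z) - x * x ≡ y - z
        drop₁ = solve-∀
        drop₂ : ∀ x y u v → - (((y - x) * (y - x) + v - u) - (x - y) * (x - y)) ≡ u - v
        drop₂ = solve-∀
        db : Arc i j ⊎ Arc j i → + p ∣ b i - b j
        db (inj₁ d) = subst (+ p ∣_) (drop₁ (a i - a j) (b i) (b j)) (∣m∣n⇒∣m-n d (∣m⇒∣m*n (a i - a j) da))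
        db (inj₂ d) = subst (+ p ∣_) (drop₂ (a i) (a j) (b i) (b j)) (∣m⇒∣-m (∣m∣n⇒∣m-n d (∣m⇒∣m*n (a i - a j) da)))

    -- The three b-differences add up to 0. With x and y the a-differences along ij and jk this makes
    -- ± x² ± y² ± (x + y)² divisible by p, and this form is 2(x² + xy + y²) or ± 2 times a product of
    -- two of x, y, x + y.
    E-triangle-free : ∀ i j k → i ≢ j → j ≢ k → i ≢ k → 0 ℕ.< E i j → 0 ℕ.< E j k → 0 ℕ.< E i k → ⊥
    E-triangle-free i j k i≢j j≢k i≢k ij jk ik = signs (E⇒Arc i j ij) (E⇒Arc j k jk) (E⇒Arc i k ik)
      where
      x y : ℤ
      x = a i - a j
      y = a j - a k
      p∤x = E⇒a≢ i j i≢j ij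
      p∤y = E⇒a≢ j k j≢k jk
      p∤x+y : ¬ (+ p ∣ x + y)
      p∤x+y d = E⇒a≢ i k i≢k ik (subst (+ p ∣_) (telescope (a i) (a j) (a k)) d)
        where
        telescope : ∀ i j k → (i - j) + (j - k) ≡ i - k
        telescope = solve-∀
      mixed : ∀ z w → ¬ (+ p ∣ z) → ¬ (+ p ∣ w) → ¬ (+ p ∣ + 2 * (z * w))
      mixed z w p∤z p∤w d = Sum.[ p∤2 , (λ d → Sum.[ p∤z , p∤w ]′ (∣-prime p-prime z w d)) ]′ (∣-prime p-prime (+ 2) (z * w) d)
      definite : ¬ (+ p ∣ + 2 * (x * x + x * y + y * y))
      definite d = Sum.[ p∤2 , anisotropic p-prime p%3≡2 x y p∤y ]′ (∣-prime p-prime (+ 2) (x * x + x * y + y * y) d)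
      signs : Arc i j ⊎ Arc j i → Arc j k ⊎ Arc k j → Arc i k ⊎ Arc k i → ⊥
      signs (inj₁ d) (inj₁ e) (inj₁ f) = mixed x y p∤x p∤y (subst (+ p ∣_) (identity (a i) (a j) (a k) (b i) (b j) (b k)) (∣m∣n⇒∣m-n f (∣m∣n⇒∣m+n d e)))
        where
        identity : ∀ i j k u v w → ((i - k) * (i - k) + u - w) - (((i - j) * (i - j) + u - v) + ((j - k) * (j - k) + v - w)) ≡ + 2 * ((i - j) * (j - k))
        identity = solve-∀
      signs (inj₁ d) (inj₁ e) (inj₂ f) = definite (subst (+ p ∣_) (identity (a i) (a j) (a k) (b i) (b j) (b k)) (∣m∣n⇒∣m+n f (∣m∣n⇒∣m+n d e)))
        where
        identity : ∀ i j k u v w → ((k - i) * (k - i) + w - u) + (((i - j) * (i - j) + u - v) + ((j - k) * (j - k) + v - w))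
          ≡ + 2 * ((i - j) * (i - j) + (i - j) * (j - k) + (j - k) * (j - k))
        identity = solve-∀
      signs (inj₁ d) (inj₂ e) (inj₁ f) = mixed y (x + y) p∤y p∤x+y (subst (+ p ∣_) (identity (a i) (a j) (a k) (b i) (b j) (b k)) (∣m∣n⇒∣m-n (∣m∣n⇒∣m+n f e) d))
        where
        identity : ∀ i j k u v w → (((i - k) * (i - k) + u - w) + ((k - j) * (k - j) + w - v)) - ((i - j) * (i - j) + u - v) ≡ + 2 * ((j - k) * ((i - j) + (j - k)))
        identity = solve-∀
      signs (inj₁ d) (inj₂ e) (inj₂ f) = mixed x (x + y) p∤x p∤x+y (subst (+ p ∣_) (identity (a i) (a j) (a k) (b i) (b j) (b k)) (∣m∣n⇒∣m-n (∣m∣n⇒∣m+n f d) e))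
        where
        identity : ∀ i j k u v w → (((k - i) * (k - i) + w - u) + ((i - j) * (i - j) + u - v)) - ((k - j) * (k - j) + w - v) ≡ + 2 * ((i - j) * ((i - j) + (j - k)))
        identity = solve-∀
      signs (inj₂ d) (inj₁ e) (inj₁ f) = mixed x (x + y) p∤x p∤x+y (subst (+ p ∣_) (identity (a i) (a j) (a k) (b i) (b j) (b k)) (∣m∣n⇒∣m-n (∣m∣n⇒∣m+n f d) e))
        where
        identity : ∀ i j k u v w → (((i - k) * (i - k) + u - w) + ((j - i) * (j - i) + v - u)) - ((j - k) * (j - k) + v - w) ≡ + 2 * ((i - j) * ((i - j) + (j - k)))
        identity = solve-∀
      signs (inj₂ d) (inj₁ e) (inj₂ f) = mixed y (x + y) p∤y p∤x+y (subst (+ p ∣_) (identity (a i) (a j) (a k) (b i) (b j) (b k)) (∣m∣n⇒∣m-n (∣m∣n⇒∣m+n f e) d))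
        where
        identity : ∀ i j k u v w → (((k - i) * (k - i) + w - u) + ((j - k) * (j - k) + v - w)) - ((j - i) * (j - i) + v - u) ≡ + 2 * ((j - k) * ((i - j) + (j - k)))
        identity = solve-∀
      signs (inj₂ d) (inj₂ e) (inj₁ f) = definite (subst (+ p ∣_) (identity (a i) (a j) (a k) (b i) (b j) (b k)) (∣m∣n⇒∣m+n f (∣m∣n⇒∣m+n d e)))
        where
        identity : ∀ i j k u v w → ((i - k) * (i - k) + u - w) + (((j - i) * (j - i) + v - u) + ((k - j) * (k - j) + w - v))
          ≡ + 2 * ((i - j) * (i - j) + (i - j) * (j - k) + (j - k) * (j - k))
        identity = solve-∀
      signs (inj₂ d) (inj₂ e) (inj₂ f) = mixed x y p∤x p∤y (subst (+ p ∣_) (identity (a i) (a j) (a k) (b i) (b j) (b k)) (∣m∣n⇒∣m-n f (∣m∣n⇒∣m+n d e)))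
        where
        identity : ∀ i j k u v w → ((k - i) * (k - i) + w - u) - (((j - i) * (j - i) + v - u) + ((k - j) * (k - j) + w - v)) ≡ + 2 * ((i - j) * (j - k))
        identity = solve-∀

  -- Counting lists

  sumL : ∀ {X : Set} → (X → ℤ) → List X → ℤ
  sumL f = foldr (λ x y → f x + y) 0ℤ

  sumL-++ : ∀ {X : Set} (f : X → ℤ) xs ys → sumL f (xs ++ ys) ≡ sumL f xs + sumL f ys
  sumL-++ f [] ys = sym (+-identityˡ _)
  sumL-++ f (x ∷ xs) ys = trans (cong (_+_ (f x)) (sumL-++ f xs ys)) (sym (+-assoc (f x) _ _))

  sumL-map : ∀ {X Y : Set} (f : Y → ℤ) (g : X → Y) xs → sumL f (map g xs) ≡ sumL (f ∘ g) xs
  sumL-map f g [] = refl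
  sumL-map f g (x ∷ xs) = cong (_+_ (f (g x))) (sumL-map f g xs)

  sumL-tabulate : ∀ {X : Set} {n} (f : X → ℤ) (g : Fin n → X) → sumL f (tabulate g) ≡ ∑[ i ] f (g i)
  sumL-tabulate {n = zero}  f g = sym (∑-zero _)
  sumL-tabulate {n = suc n} f g = trans (cong (_+_ (f (g zero))) (sumL-tabulate f (g ∘ suc))) (sym (∑-suc (λ i → f (g i))))

  sumL-cartesianProduct : ∀ {X Y : Set} (f : X × Y → ℤ) xs ys → sumL f (cartesianProduct xs ys) ≡ sumL (λ x → sumL (λ y → f (x , y)) ys) xs
  sumL-cartesianProduct f [] ys = refl
  sumL-cartesianProduct f (x ∷ xs) ys = trans (sumL-++ f (map (x ,_) ys) (cartesianProduct xs ys))
    (cong₂ _+_ (sumL-map f (x ,_) ys) (sumL-cartesianProduct f xs ys))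

  length-filter : ∀ {X : Set} {P : X → Set} (P? : U.Decidable P) xs → + length (filter P? xs) ≡ sumL (λ x → ⟦ P? x ⟧) xs
  length-filter P? [] = refl
  length-filter P? (x ∷ xs) with P? x
  ... | yes _ = cong (_+_ 1ℤ) (length-filter P? xs)
  ... | no _  = trans (length-filter P? xs) (sym (+-identityˡ _))

  sublists-All : ∀ {X : Set} {Q : X → Set} {xs} → All Q xs → All (All Q) (sublists xs)
  sublists-All [] = [] ∷ []
  sublists-All (q ∷ qs) = All.++⁺ (All.map⁺ (All.map (q ∷_) (sublists-All qs))) (sublists-All qs)

  -- Edges, triangle covers and triangle packings

  module _ {n : ℕ} (G : Graph n) where

    open Graph G renaming (sym to Adj-sym)

    adj : Fin n → Fin n → ℤ
    adj v w = ⟦ adj? v w ⟧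

    -- `isEdge?` accepts one orientation of each edge; adding the transposed sum restores the other.
    ∑-edges : ∀ (ω : Fin n → Fin n → ℤ) → (∀ v w → ω v w ≡ ω w v) →
      + 2 * ∑₂ (λ v w → ⟦ isEdge? G (v , w) ⟧ * ω v w) ≡ ∑₂ (λ v w → adj v w * ω v w)
    ∑-edges ω ω-sym = begin
      + 2 * ∑₂ e
        ≡⟨ double (∑₂ e) ⟩
      ∑₂ e + ∑₂ e
        ≡⟨ cong (_+_ (∑₂ e)) (∑-comm e) ⟩
      ∑₂ e + ∑₂ (λ v w → e w v)
        ≡⟨ ∑₂-+ e (λ v w → e w v) ⟨
      ∑₂ (λ v w → e v w + e w v)
        ≡⟨ ∑₂-cong (λ v w → trans (cong (λ z → e v w + ⟦ isEdge? G (w , v) ⟧ * z) (ω-sym w v))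
             (trans (sym (*-distribʳ-+ (ω v w) ⟦ isEdge? G (v , w) ⟧ ⟦ isEdge? G (w , v) ⟧)) (cong (_* ω v w) (orient v w)))) ⟩
      ∑₂ (λ v w → adj v w * ω v w) ∎
      where
      open ≡-Reasoning
      e : Fin n → Fin n → ℤ
      e v w = ⟦ isEdge? G (v , w) ⟧ * ω v w
      double : ∀ x → + 2 * x ≡ x + x
      double = solve-∀
      orient : ∀ v w → ⟦ isEdge? G (v , w) ⟧ + ⟦ isEdge? G (w , v) ⟧ ≡ adj v w
      orient v w with Fin.<-cmp v w
      ... | tri< v<w _ w≮v = trans (cong₂ _+_ (⟦⟧-⇔ (isEdge? G (v , w)) (adj? v w) proj₂ (v<w ,_)) (⟦⟧-no (isEdge? G (w , v)) (λ (w<v , _) → w≮v w<v))) (+-identityʳ _)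
      ... | tri> v≮w _ w<v = trans (cong₂ _+_ (⟦⟧-no (isEdge? G (v , w)) (λ (v<w , _) → v≮w v<w)) (⟦⟧-⇔ (isEdge? G (w , v)) (adj? v w) (λ (_ , a) → Adj-sym a) (λ a → w<v , Adj-sym a))) (+-identityˡ _)
      ... | tri≈ v≮w refl w≮v = trans (cong₂ _+_ (⟦⟧-no (isEdge? G (v , w)) (λ (v<w , _) → v≮w v<w)) (⟦⟧-no (isEdge? G (w , v)) (λ (w<v , _) → w≮v w<v)))
              (sym (⟦⟧-no (adj? v v) (irrefl refl)))

    2*numEdges : + 2 * + numEdges G ≡ ∑₂ adj
    2*numEdges = begin
      + 2 * + numEdges G
        ≡⟨ cong (+ 2 *_) (trans (length-filter (isEdge? G) (cartesianProduct (allFin n) (allFin n)))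
             (trans (sumL-cartesianProduct (λ e → ⟦ isEdge? G e ⟧) (allFin n) (allFin n))
               (trans (sumL-tabulate (λ x → sumL (λ y → ⟦ isEdge? G (x , y) ⟧) (allFin n)) id)
                 (∑-cong (λ v → sumL-tabulate (λ w → ⟦ isEdge? G (v , w) ⟧) id))))) ⟩
      + 2 * ∑₂ (λ v w → ⟦ isEdge? G (v , w) ⟧)
        ≡⟨ cong (+ 2 *_) (∑₂-cong (λ v w → *-identityʳ ⟦ isEdge? G (v , w) ⟧)) ⟨
      + 2 * ∑₂ (λ v w → ⟦ isEdge? G (v , w) ⟧ * 1ℤ)
        ≡⟨ ∑-edges (λ _ _ → 1ℤ) (λ _ _ → refl) ⟩
      ∑₂ (λ v w → adj v w * 1ℤ)
        ≡⟨ ∑₂-cong (λ v w → *-identityʳ (adj v w)) ⟩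
      ∑₂ adj ∎
      where open ≡-Reasoning

    triangle-∈ : ∀ {t} → IsTriangle G t → t ∈ triangles G
    triangle-∈ {i , j , k} tri = ∈-filter⁺ (isTriangle? G)
      (∈-cartesianProduct⁺ (∈-allFin i) (∈-cartesianProduct⁺ (∈-allFin j) (∈-allFin k))) tri

    -- A property of the number `τ` rather than of a cover, so that it can be carried to the
    -- minimum. Sums run over ordered pairs, hence the factor 2 in front of `τ`.
    record TriangleFreePart (τ : ℕ) : Set where
      field
        T             : Fin n → Fin n → ℤ
        T-sym         : ∀ v w → T v w ≡ T w v
        0≤T           : ∀ v w → 0ℤ ≤ T v w
        T≤adj         : ∀ v w → T v w ≤ adj v w
        T²≡T          : ∀ v w → T v w * T v w ≡ T v w
        triangle-free : ∀ x v w → T x v * T x w * T v w ≡ 0ℤ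
        ∑T            : ∑₂ adj - + 2 * + τ ≤ ∑₂ T

    private
      open DecMembership (_≟ₚ_ {n}) using (_∈?_)

      -- An inequality because `F` may list a pair more than once.
      count-list : ∀ (F : List (Pair n)) → ∑₂ (λ v w → ⟦ (v , w) ∈? F ⟧) ≤ + length F
      count-list [] = ≤-reflexive (∑-0 (λ v → ∑-0 (λ w → ⟦⟧-no ((v , w) ∈? []) (λ ()))))
      count-list ((a , b) ∷ F) = begin
        ∑₂ (λ v w → ⟦ (v , w) ∈? ((a , b) ∷ F) ⟧)
          ≤⟨ ∑₂-mono head-or-tail ⟩
        ∑₂ (λ v w → ⟦ a ≟ v ⟧ * ⟦ b ≟ w ⟧ + ⟦ (v , w) ∈? F ⟧)
          ≡⟨ ∑₂-+ (λ v w → ⟦ a ≟ v ⟧ * ⟦ b ≟ w ⟧) (λ v w → ⟦ (v , w) ∈? F ⟧) ⟩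
        ∑₂ (λ v w → ⟦ a ≟ v ⟧ * ⟦ b ≟ w ⟧) + ∑₂ (λ v w → ⟦ (v , w) ∈? F ⟧)
          ≤⟨ +-mono-≤ (≤-reflexive (trans (∑-prod (λ v → ⟦ a ≟ v ⟧) (λ w → ⟦ b ≟ w ⟧)) (cong₂ _*_ (∑-δ1 a) (∑-δ1 b)))) (count-list F) ⟩
        1ℤ + + length F ∎
        where
        open ≤-Reasoning
        head-or-tail : ∀ v w → ⟦ (v , w) ∈? ((a , b) ∷ F) ⟧ ≤ ⟦ a ≟ v ⟧ * ⟦ b ≟ w ⟧ + ⟦ (v , w) ∈? F ⟧
        head-or-tail v w with a ≟ v | b ≟ w
        ... | yes refl | yes refl = ≤-trans (⟦⟧≤1 ((v , w) ∈? ((a , b) ∷ F))) (+-monoʳ-≤ 1ℤ (⟦⟧-nonneg ((v , w) ∈? F)))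
        ... | yes refl | no b≢w = ≤-trans (⟦⟧-mono ((v , w) ∈? ((a , b) ∷ F)) ((v , w) ∈? F)
                (λ { (here eq) → ⊥-elim (b≢w (sym (,-injectiveʳ eq))) ; (there e∈F) → e∈F })) (≤-reflexive (sym (+-identityˡ _)))
        ... | no a≢v | _ = ≤-trans (⟦⟧-mono ((v , w) ∈? ((a , b) ∷ F)) ((v , w) ∈? F)
                (λ { (here eq) → ⊥-elim (a≢v (sym (,-injectiveˡ eq))) ; (there e∈F) → e∈F })) (≤-reflexive (sym (+-identityˡ _)))

      module Remove (F : List (Pair n)) (cover : IsTriangleCover G F) where

        Kept : Fin n → Fin n → Set
        Kept v w = Adj v w × ¬ ((v , w) ∈ F) × ¬ ((w , v) ∈ F)

        kept? : ∀ v w → Dec (Kept v w)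
        kept? v w = adj? v w ×-dec (¬? ((v , w) ∈? F) ×-dec ¬? ((w , v) ∈? F))

        Kept-sym : ∀ {v w} → Kept v w → Kept w v
        Kept-sym (a , x , y) = Adj-sym a , y , x

        no-increasing : ∀ {i j k} → i Fin.< j → j Fin.< k → Kept i j → Kept i k → Kept j k → ⊥
        no-increasing i<j j<k (a , x , _) (b , y , _) (c , z , _)
          with All.lookup cover (triangle-∈ ((i<j , a) ∷ (Fin.<-trans i<j j<k , b) ∷ (j<k , c) ∷ []))
        ... | here ij∈F                 = x ij∈F
        ... | there (here ik∈F)         = y ik∈F
        ... | there (there (here jk∈F)) = z jk∈F

        Kept≢ : ∀ {v w} → Kept v w → v ≢ w
        Kept≢ (a , _) refl = irrefl refl a

        -- A cover speaks only about triples listed increasingly, so each of the six orders of the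
        -- vertices is sorted first.
        no-triangle : ∀ {i j k} → Kept i j → Kept i k → Kept j k → ⊥
        no-triangle {i} {j} {k} x y z with Fin.<-cmp i j | Fin.<-cmp j k | Fin.<-cmp i k
        ... | tri≈ _ eq _ | _ | _ = Kept≢ x eq
        ... | _ | tri≈ _ eq _ | _ = Kept≢ z eq
        ... | _ | _ | tri≈ _ eq _ = Kept≢ y eq
        ... | tri< i<j _ _ | tri< j<k _ _ | _            = no-increasing i<j j<k x y z
        ... | tri< i<j _ _ | tri> _ _ k<j | tri< i<k _ _ = no-increasing i<k k<j y x (Kept-sym z)
        ... | tri< i<j _ _ | tri> _ _ k<j | tri> _ _ k<i = no-increasing k<i i<j (Kept-sym y) (Kept-sym z) x
        ... | tri> _ _ j<i | tri< j<k _ _ | tri< i<k _ _ = no-increasing j<i i<k (Kept-sym x) z y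
        ... | tri> _ _ j<i | tri< j<k _ _ | tri> _ _ k<i = no-increasing j<k k<i z (Kept-sym x) (Kept-sym y)
        ... | tri> _ _ j<i | tri> _ _ k<j | _            = no-increasing k<j j<i (Kept-sym z) (Kept-sym y) (Kept-sym x)

        part : TriangleFreePart (length F)
        part = record
          { T             = λ v w → ⟦ kept? v w ⟧
          ; T-sym         = λ v w → ⟦⟧-⇔ (kept? v w) (kept? w v) Kept-sym Kept-sym
          ; 0≤T           = λ v w → ⟦⟧-nonneg (kept? v w)
          ; T≤adj         = λ v w → ⟦⟧-mono (kept? v w) (adj? v w) proj₁
          ; T²≡T          = λ v w → idempotent (kept? v w)
          ; triangle-free = λ x v w → triangle (kept? x v) (kept? x w) (kept? v w)
          ; ∑T            = total
          }
          where
          idempotent : ∀ {X : Set} (d : Dec X) → ⟦ d ⟧ * ⟦ d ⟧ ≡ ⟦ d ⟧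
          idempotent (yes _) = refl
          idempotent (no _)  = refl
          triangle : ∀ {x v w} (d : Dec (Kept x v)) (e : Dec (Kept x w)) (f : Dec (Kept v w)) → ⟦ d ⟧ * ⟦ e ⟧ * ⟦ f ⟧ ≡ 0ℤ
          triangle (no _)  _       f       = *-zeroˡ ⟦ f ⟧
          triangle (yes _) (no _)  f       = *-zeroˡ ⟦ f ⟧
          triangle (yes _) (yes _) (no _)  = refl
          triangle (yes x) (yes y) (yes z) = ⊥-elim (no-triangle x y z)
          excluded : ∀ {X Y Z : Set} (d : Dec X) (e : Dec Y) (f : Dec Z) → ⟦ d ⟧ ≤ ⟦ d ×-dec (¬? e ×-dec ¬? f) ⟧ + (⟦ e ⟧ + ⟦ f ⟧)
          excluded (no _)  e       f       = +-nonneg {0ℤ} ≤-refl (+-nonneg (⟦⟧-nonneg e) (⟦⟧-nonneg f))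
          excluded (yes _) (no _)  (no _)  = ≤-refl
          excluded (yes _) (no _)  (yes _) = ≤-refl
          excluded (yes _) (yes _) f       = ≤-trans (+-monoʳ-≤ 1ℤ (⟦⟧-nonneg f)) (≤-reflexive (sym (+-identityˡ (1ℤ + ⟦ f ⟧))))
          total : ∑₂ adj - + 2 * + length F ≤ ∑₂ (λ v w → ⟦ kept? v w ⟧)
          total = from-sub (+-nonneg (sub-nonneg (∑₂-mono (λ v w → excluded (adj? v w) ((v , w) ∈? F) ((w , v) ∈? F))))
              (*-nonneg {+ 2} pos-nonneg (sub-nonneg (count-list F))))
            (trans (regroup (∑₂ adj) (∑₂ (λ v w → ⟦ kept? v w ⟧)) C (+ length F))
              (cong (λ z → ∑₂ adj - + 2 * + length F + (z - ∑₂ adj + + 2 * (+ length F - C))) (sym (trans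
                (∑₂-+ (λ v w → ⟦ kept? v w ⟧) (λ v w → ⟦ (v , w) ∈? F ⟧ + ⟦ (w , v) ∈? F ⟧))
                (cong (_+_ (∑₂ (λ v w → ⟦ kept? v w ⟧))) (trans (∑₂-+ (λ v w → ⟦ (v , w) ∈? F ⟧) (λ v w → ⟦ (w , v) ∈? F ⟧))
                  (cong (_+_ C) (∑-comm (λ v w → ⟦ (w , v) ∈? F ⟧)))))))))
            where
            C = ∑₂ (λ v w → ⟦ (v , w) ∈? F ⟧)
            regroup : ∀ a k c l → k ≡ a - + 2 * l + (k + (c + c) - a + + 2 * (l - c))
            regroup = solve-∀

    -- `argmin-all` passes a property of the default and of all candidates to the minimum; the
    -- default `numEdges G` corresponds to deleting every edge.
    triangle-free-part : TriangleFreePart (τ₃ G)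
    triangle-free-part = argmin-all id {P = TriangleFreePart} everything-removed
      (All.map⁺ (All.map (λ {F} → Remove.part F) (All.all-filter (isTriangleCover? G) (sublists (edges G)))))
      where
      everything-removed : TriangleFreePart (numEdges G)
      everything-removed = record
        { T             = λ _ _ → 0ℤ
        ; T-sym         = λ _ _ → refl
        ; 0≤T           = λ _ _ → ≤-refl
        ; T≤adj         = λ v w → ⟦⟧-nonneg (adj? v w)
        ; T²≡T          = λ _ _ → refl
        ; triangle-free = λ _ _ _ → refl
        ; ∑T            = ≤-reflexive (trans (cong (_-_ (∑₂ adj)) 2*numEdges) (trans (+-inverseʳ (∑₂ adj)) (sym (∑-0 {n} (λ _ → ∑-0 {n} (λ _ → refl))))))
        }

    module _ (ω : Fin n → Fin n → ℤ) (ω-sym : ∀ v w → ω v w ≡ ω w v) (0≤ω : ∀ v w → 0ℤ ≤ ω v w)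
      (2≤ω : ∀ i j k → Adj i j → Adj i k → Adj j k → + 2 ≤ ω i j + ω i k + ω j k) where

      private
        mult : Triple n → Pair n → ℤ
        mult (i , j , k) e = ⟦ (i , j) ≟ₚ e ⟧ + ⟦ (i , k) ≟ₚ e ⟧ + ⟦ (j , k) ≟ₚ e ⟧

        mult≤1 : ∀ {t} e → IsTriangle G t → mult t e ≤ 1ℤ
        mult≤1 {i , j , k} e ((i<j , _) ∷ _ ∷ (j<k , _) ∷ []) with (i , j) ≟ₚ e | (i , k) ≟ₚ e | (j , k) ≟ₚ e
        ... | no _     | no _     | d        = ≤-trans (≤-reflexive (+-identityˡ ⟦ d ⟧)) (⟦⟧≤1 d)
        ... | yes _    | no _     | no _     = ≤-refl
        ... | no _     | yes _    | no _     = ≤-refl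
        ... | yes refl | yes eq   | _        = ⊥-elim (Fin.<⇒≢ j<k (sym (,-injectiveʳ eq)))
        ... | yes refl | no _     | yes eq   = ⊥-elim (Fin.<⇒≢ i<j (sym (,-injectiveˡ eq)))
        ... | no _     | yes refl | yes eq   = ⊥-elim (Fin.<⇒≢ i<j (sym (,-injectiveˡ eq)))

        mult-∉ : ∀ {t} e → ¬ (e ∈ tripleEdges t) → mult t e ≡ 0ℤ
        mult-∉ {i , j , k} e e∉t = cong₂ _+_ (cong₂ _+_ (⟦⟧-no ((i , j) ≟ₚ e) (λ eq → e∉t (here (sym eq))))
          (⟦⟧-no ((i , k) ≟ₚ e) (λ eq → e∉t (there (here (sym eq)))))) (⟦⟧-no ((j , k) ≟ₚ e) (λ eq → e∉t (there (there (here (sym eq))))))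

        sumL-mult-∉ : ∀ {t} e Ts → e ∈ tripleEdges t → All (EdgeDisjoint t) Ts → sumL (λ t → mult t e) Ts ≡ 0ℤ
        sumL-mult-∉ e [] e∈t [] = refl
        sumL-mult-∉ e (t′ ∷ Ts) e∈t (d ∷ ds) = cong₂ _+_ (mult-∉ {t′} e (λ e∈t′ → d (e∈t , e∈t′))) (sumL-mult-∉ e Ts e∈t ds)

        -- Once a triangle contains `e`, disjointness makes all later contributions vanish, and
        -- `mult≤1` holds because an increasing triple has three distinct edges.
        packing-mult : ∀ Ts → All (IsTriangle G) Ts → IsTrianglePacking Ts → ∀ e → sumL (λ t → mult t e) Ts ≤ ⟦ isEdge? G e ⟧
        packing-mult [] _ _ e = ⟦⟧-nonneg (isEdge? G e)
        packing-mult (t ∷ Ts) (tri ∷ tris) (disj ∷ pack) e with e ∈? tripleEdges t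
        ... | no e∉t = subst (_≤ ⟦ isEdge? G e ⟧) (sym (trans (cong (λ z → z + sumL (λ t → mult t e) Ts) (mult-∉ {t} e e∉t)) (+-identityˡ _)))
                (packing-mult Ts tris pack e)
        ... | yes e∈t = ≤-trans (≤-reflexive (trans (cong (_+_ (mult t e)) (sumL-mult-∉ {t} e Ts e∈t disj)) (+-identityʳ (mult t e))))
                (≤-trans (mult≤1 e tri) (≤-reflexive (sym (⟦⟧-yes (isEdge? G e) (All.lookup tri e∈t)))))

        ∑₂-mult : ∀ i j k → ∑₂ (λ v w → mult (i , j , k) (v , w) * ω v w) ≡ ω i j + ω i k + ω j k
        ∑₂-mult i j k = trans (∑₂-cong (λ v w → distribute ⟦ (i , j) ≟ₚ (v , w) ⟧ ⟦ (i , k) ≟ₚ (v , w) ⟧ ⟦ (j , k) ≟ₚ (v , w) ⟧ (ω v w)))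
          (trans (∑₂-+ (λ v w → ⟦ (i , j) ≟ₚ (v , w) ⟧ * ω v w + ⟦ (i , k) ≟ₚ (v , w) ⟧ * ω v w) (λ v w → ⟦ (j , k) ≟ₚ (v , w) ⟧ * ω v w))
            (cong₂ _+_ (trans (∑₂-+ (λ v w → ⟦ (i , j) ≟ₚ (v , w) ⟧ * ω v w) (λ v w → ⟦ (i , k) ≟ₚ (v , w) ⟧ * ω v w))
              (cong₂ _+_ (single i j) (single i k))) (single j k)))
          where
          distribute : ∀ a b c x → (a + b + c) * x ≡ a * x + b * x + c * x
          distribute = solve-∀
          pair-δ : ∀ a b v w → ⟦ (a , b) ≟ₚ (v , w) ⟧ ≡ ⟦ a ≟ v ⟧ * ⟦ b ≟ w ⟧
          pair-δ a b v w = product ((a , b) ≟ₚ (v , w)) (a ≟ v) (b ≟ w)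
            where
            product : (d : Dec ((a , b) ≡ (v , w))) (e : Dec (a ≡ v)) (f : Dec (b ≡ w)) → ⟦ d ⟧ ≡ ⟦ e ⟧ * ⟦ f ⟧
            product d (yes refl) (yes refl) = ⟦⟧-yes d refl
            product d (yes refl) (no b≢w)   = ⟦⟧-no d (λ eq → b≢w (,-injectiveʳ eq))
            product d (no a≢v)   f          = trans (⟦⟧-no d (λ eq → a≢v (,-injectiveˡ eq))) (sym (*-zeroˡ ⟦ f ⟧))
          single : ∀ a b → ∑₂ (λ v w → ⟦ (a , b) ≟ₚ (v , w) ⟧ * ω v w) ≡ ω a b
          single a b = trans (∑-cong (λ v → trans (∑-cong (λ w → trans (cong (_* ω v w) (pair-δ a b v w)) (*-assoc ⟦ a ≟ v ⟧ ⟦ b ≟ w ⟧ (ω v w))))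
            (trans (∑-*ˡ ⟦ a ≟ v ⟧ (λ w → ⟦ b ≟ w ⟧ * ω v w)) (cong (⟦ a ≟ v ⟧ *_) (∑-δ b (ω v)))))) (∑-δ a (λ v → ω v b))

        packing-weight : ∀ Ts → All (IsTriangle G) Ts → + 2 * + length Ts ≤ ∑₂ (λ v w → sumL (λ t → mult t (v , w)) Ts * ω v w)
        packing-weight [] [] = ≤-reflexive (sym (∑-0 (λ v → ∑-0 (λ w → *-zeroˡ (ω v w)))))
        packing-weight ((i , j , k) ∷ Ts) (((_ , a) ∷ (_ , b) ∷ (_ , c) ∷ []) ∷ tris) = begin
          + 2 * + suc (length Ts)
            ≡⟨ *-distribˡ-+ (+ 2) 1ℤ (+ length Ts) ⟩
          + 2 + + 2 * + length Ts
            ≤⟨ +-mono-≤ (2≤ω i j k a b c) (packing-weight Ts tris) ⟩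
          (ω i j + ω i k + ω j k) + ∑₂ (λ v w → sumL (λ t → mult t (v , w)) Ts * ω v w)
            ≡⟨ cong (λ z → z + ∑₂ (λ v w → sumL (λ t → mult t (v , w)) Ts * ω v w)) (∑₂-mult i j k) ⟨
          ∑₂ (λ v w → mult (i , j , k) (v , w) * ω v w) + ∑₂ (λ v w → sumL (λ t → mult t (v , w)) Ts * ω v w)
            ≡⟨ ∑₂-+ (λ v w → mult (i , j , k) (v , w) * ω v w) (λ v w → sumL (λ t → mult t (v , w)) Ts * ω v w) ⟨
          ∑₂ (λ v w → mult (i , j , k) (v , w) * ω v w + sumL (λ t → mult t (v , w)) Ts * ω v w)
            ≡⟨ ∑₂-cong (λ v w → sym (*-distribʳ-+ (ω v w) (mult (i , j , k) (v , w)) (sumL (λ t → mult t (v , w)) Ts))) ⟩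
          ∑₂ (λ v w → sumL (λ t → mult t (v , w)) ((i , j , k) ∷ Ts) * ω v w) ∎
          where open ≤-Reasoning

        Bound : ℕ → Set
        Bound ν = + 4 * + ν ≤ ∑₂ ω

        packing-bound : ∀ {Ts} → All (IsTriangle G) Ts → IsTrianglePacking Ts → Bound (length Ts)
        packing-bound {Ts} tris pack = begin
          + 4 * + length Ts
            ≡⟨ *-assoc (+ 2) (+ 2) (+ length Ts) ⟩
          + 2 * (+ 2 * + length Ts)
            ≤⟨ *-monoˡ (+ 2) pos-nonneg (packing-weight Ts tris) ⟩
          + 2 * ∑₂ (λ v w → sumL (λ t → mult t (v , w)) Ts * ω v w)
            ≤⟨ *-monoˡ (+ 2) pos-nonneg (∑₂-mono (λ v w → subst₂ _≤_ (*-comm (ω v w) _) (*-comm (ω v w) _)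
                 (*-monoˡ (ω v w) (0≤ω v w) (packing-mult Ts tris pack (v , w))))) ⟩
          + 2 * ∑₂ (λ v w → ⟦ isEdge? G (v , w) ⟧ * ω v w)
            ≡⟨ ∑-edges ω ω-sym ⟩
          ∑₂ (λ v w → adj v w * ω v w)
            ≤⟨ ∑₂-mono (λ v w → subst₂ _≤_ (*-comm (ω v w) _) (*-identityʳ (ω v w)) (*-monoˡ (ω v w) (0≤ω v w) (⟦⟧≤1 (adj? v w)))) ⟩
          ∑₂ ω ∎
          where open ≤-Reasoning

      -- ω / 2 is a fractional triangle cover, and ∑₂ ω runs over ordered pairs.
      4ν₃≤∑ω : + 4 * + ν₃ G ≤ ∑₂ ω
      4ν₃≤∑ω = argmax-all id {P = Bound} (∑₂-nonneg 0≤ω)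
        (All.map⁺ (All.map (λ (tris , pack) → packing-bound tris pack)
          (All.zip (All.filter⁺ isTrianglePacking? (sublists-All (All.all-filter (isTriangle? G) (cartesianProduct (allFin n) (cartesianProduct (allFin n) (allFin n)))))
            , All.all-filter isTrianglePacking? (sublists (triangles G))))))

  -- The graph

  module Construction {p : ℕ} (p-prime : Prime p) (p%3≡2 : p ℕ.% 3 ≡ 2) (p∤2 : ¬ (+ p ∣ + 2)) (c₀ κ : ℕ)
    {P : ℕ} (P-prime : Prime P) (u : ℕ) where

    open Matrices p-prime p∤2 c₀ κ P-prime u public

    threshold : Fin n → Fin n → ℕ
    threshold v w = sA ℕ.+ sM (cl v) (cl w)

    G : Graph n
    G = record
      { Adj    = λ v w → v ≢ w × toℕ (col v w) ℕ.< threshold v w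
      ; adj?   = λ v w → ¬? (v ≟ w) ×-dec (toℕ (col v w) ℕ.<? threshold v w)
      ; sym    = λ {v} {w} (v≢w , lt) → v≢w ∘ sym , subst₂ ℕ._<_ (cong toℕ (col-sym v w)) (threshold-sym v w) lt
      ; irrefl = λ v≡w (v≢w , _) → v≢w v≡w
      }
      where
      threshold-sym : ∀ v w → threshold v w ≡ threshold w v
      threshold-sym v w = cong (λ k → sA ℕ.+ u ℕ.* m ℕ.* k) (weight-sym (cl v) (cl w))

    open Graph G using (Adj; adj?)

    adj≤AM : ∀ v w → adj G v w ≤ AM v w
    adj≤AM v w = ⟦⟧-mono (adj? v w) (toℕ (col v w) ℕ.<? threshold v w) proj₂

    -- The colour rule also admits pairs on the diagonal; dropping them costs at most n, which is
    -- negligible against n².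
    ∑AM≤∑adj+n : ∑₂ AM ≤ ∑₂ (adj G) + + n
    ∑AM≤∑adj+n = ≤-trans (∑₂-mono (λ v w → loops (v ≟ w) (toℕ (col v w) ℕ.<? threshold v w)))
      (≤-reflexive (trans (∑₂-+ (adj G) (λ v w → ⟦ v ≟ w ⟧)) (cong (_+_ (∑₂ (adj G)))
        (trans (∑-cong ∑-δ1) (trans (∑-const n 1ℤ) (*-identityʳ (+ n)))))))
      where
      loops : ∀ {X Y : Set} (d : Dec X) (e : Dec Y) → ⟦ e ⟧ ≤ ⟦ ¬? d ×-dec e ⟧ + ⟦ d ⟧
      loops (yes _) e = ≤-trans (⟦⟧≤1 e) (≤-reflexive (sym (+-identityˡ 1ℤ)))
      loops (no _)  e = ≤-reflexive (sym (+-identityʳ ⟦ e ⟧))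

    paths : Fin m → Fin m → ℤ
    paths i j = ∑[ k ] (+ E i k * + E k j)

    -- twice the fractional cover: 1/2 on A, raised on pairs of clusters joined by a path of length two
    -- of E, 0 on edges of M between clusters and 1 on edges of M inside clusters
    ω : Fin n → Fin n → ℤ
    ω v w = A v w * (1ℤ + paths (cl v) (cl w)) + + 2 * (M v w * ⟦ cl v ≟ cl w ⟧)

    0≤A : ∀ v w → 0ℤ ≤ A v w
    0≤A v w = ⟦⟧-nonneg (toℕ (col v w) ℕ.<? sA)

    0≤paths : ∀ i j → 0ℤ ≤ paths i j
    0≤paths i j = ∑-nonneg (λ k → *-nonneg (pos-nonneg {E i k}) (pos-nonneg {E k j}))

    ω-sym : ∀ v w → ω v w ≡ ω w v
    ω-sym v w = cong₂ (λ x y → x + + 2 * y) (cong₂ (λ x y → x * (1ℤ + y)) A-sym (∑-cong (λ k →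
        trans (*-comm (+ E (cl v) k) (+ E k (cl w))) (cong₂ (λ x y → + x * + y) (E-sym k (cl w)) (E-sym (cl v) k)))))
      (cong₂ _*_ (cong₂ _-_ (cong₂ (λ s z → below (sA ℕ.+ u ℕ.* m ℕ.* s) z) (weight-sym (cl v) (cl w)) (col-sym v w)) A-sym)
        (⟦⟧-⇔ (cl v ≟ cl w) (cl w ≟ cl v) sym sym))
      where
      A-sym : A v w ≡ A w v
      A-sym = cong (below sA) (col-sym v w)

    module _ (0<m : 0 ℕ.< m) (thresholds : u ℕ.* (ρ ℕ.+ m ℕ.* (2 ℕ.* κ ℕ.+ 2)) ℕ.≤ P) where

      0≤ω : ∀ v w → 0ℤ ≤ ω v w
      0≤ω v w = +-nonneg (*-nonneg (0≤A v w) (+-nonneg {1ℤ} pos-nonneg (0≤paths (cl v) (cl w))))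
        (*-nonneg {+ 2} pos-nonneg (*-nonneg (0≤M 0<m thresholds v w) (⟦⟧-nonneg (cl v ≟ cl w))))

      private
        IsB : Fin n → Fin n → Set
        IsB v w = cl v ≢ cl w × 0 ℕ.< E (cl v) (cl w)

        loop≡0 : ∀ i j → i ≢ j → loop i j ≡ 0
        loop≡0 i j i≢j with copy i ≟ copy j | coord₁ i ≟ coord₁ j | coord₂ i ≟ coord₂ j
        ... | no _  | _     | _     = refl
        ... | yes _ | no _  | _     = refl
        ... | yes _ | yes _ | no _  = refl
        ... | yes x | yes y | yes z = ⊥-elim (i≢j (cluster-injective x y z))

        -- Outside `A`, an edge needs positive `weight` between its clusters. If these differ,
        -- `loop` vanishes, so the weight comes from `E`.
        classify : ∀ v w → Adj v w → A v w ≡ 1ℤ ⊎ (+ 2 ≤ ω v w) ⊎ IsB v w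
        classify v w (_ , lt) = by-colour (toℕ (col v w) ℕ.<? sA) (cl v ≟ cl w)
          where
          by-colour : Dec (toℕ (col v w) ℕ.< sA) → Dec (cl v ≡ cl w) → A v w ≡ 1ℤ ⊎ (+ 2 ≤ ω v w) ⊎ IsB v w
          by-colour (yes in-A) _ = inj₁ (⟦⟧-yes (toℕ (col v w) ℕ.<? sA) in-A)
          by-colour (no ∉A) (yes same) = inj₂ (inj₁ (≤-reflexive (sym (trans
            (cong₂ (λ x y → x * (1ℤ + paths (cl v) (cl w)) + + 2 * y) A≡0 (cong₂ _*_
              (cong₂ _-_ (⟦⟧-yes (toℕ (col v w) ℕ.<? threshold v w) lt) A≡0) (⟦⟧-yes (cl v ≟ cl w) same)))
            (cong (λ z → z + + 2) (*-zeroˡ (1ℤ + paths (cl v) (cl w))))))))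
            where
            A≡0 : A v w ≡ 0ℤ
            A≡0 = ⟦⟧-no (toℕ (col v w) ℕ.<? sA) ∉A
          by-colour (no ∉A) (no differ) = inj₂ (inj₂ (differ , ℕ.n≢0⇒n>0 λ E≡0 → ℕ.<⇒≱ lt (begin
            sA ℕ.+ u ℕ.* m ℕ.* (2 ℕ.* κ ℕ.* loop (cl v) (cl w) ℕ.+ E (cl v) (cl w))
              ≡⟨ cong₂ (λ x y → sA ℕ.+ u ℕ.* m ℕ.* (2 ℕ.* κ ℕ.* x ℕ.+ y)) (loop≡0 (cl v) (cl w) differ) E≡0 ⟩
            sA ℕ.+ u ℕ.* m ℕ.* (2 ℕ.* κ ℕ.* 0 ℕ.+ 0)
              ≡⟨ vanish sA (u ℕ.* m) κ ⟩
            sA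
              ≤⟨ ℕ.≮⇒≥ ∉A ⟩
            toℕ (col v w) ∎)))
            where
            open ℕ.≤-Reasoning
            vanish : ∀ s x k → s ℕ.+ x ℕ.* (2 ℕ.* k ℕ.* 0 ℕ.+ 0) ≡ s
            vanish = ℕSolver.solve-∀

        ω-A : ∀ v w → A v w ≡ 1ℤ → 1ℤ + paths (cl v) (cl w) ≤ ω v w
        ω-A v w A≡1 = from-sub (*-nonneg {+ 2} pos-nonneg (*-nonneg (0≤M 0<m thresholds v w) (⟦⟧-nonneg (cl v ≟ cl w))))
          (cong (λ z → z + + 2 * (M v w * ⟦ cl v ≟ cl w ⟧)) (trans (cong (_* (1ℤ + paths (cl v) (cl w))) A≡1) (*-identityˡ (1ℤ + paths (cl v) (cl w)))))

        1≤ω : ∀ v w → A v w ≡ 1ℤ → 1ℤ ≤ ω v w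
        1≤ω v w A≡1 = ≤-trans (+-monoʳ-≤ 1ℤ (0≤paths (cl v) (cl w))) (ω-A v w A≡1)

        path≥1 : ∀ i k j → 0 ℕ.< E i k → 0 ℕ.< E k j → 1ℤ ≤ paths i j
        path≥1 i k j ik kj = ≤-trans (*-mono {1ℤ} {+ E i k} {1ℤ} {+ E k j} pos-nonneg pos-nonneg (+≤+ ik) (+≤+ kj))
          (term≤∑ (λ k → + E i k * + E k j) (λ k → *-nonneg (pos-nonneg {E i k}) (pos-nonneg {E k j})) k)

        2≤ω-path : ∀ v x w → A v w ≡ 1ℤ → 0 ℕ.< E (cl v) (cl x) → 0 ℕ.< E (cl x) (cl w) → + 2 ≤ ω v w
        2≤ω-path v x w A≡1 vx xw = ≤-trans (+-monoʳ-≤ 1ℤ (path≥1 (cl v) (cl x) (cl w) vx xw)) (ω-A v w A≡1)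

        flip : ∀ i j → 0 ℕ.< E i j → 0 ℕ.< E j i
        flip i j = subst (0 ℕ.<_) (E-sym i j)

        sum≥2 : ∀ {x y z a b c} → a ≤ x → b ≤ y → c ≤ z → + 2 ≤ a + b + c → + 2 ≤ x + y + z
        sum≥2 a≤x b≤y c≤z h = ≤-trans h (+-mono-≤ (+-mono-≤ a≤x b≤y) c≤z)

      -- A C-edge has weight 2 by itself, and two A-edges have weight 1 each. One A-edge with two
      -- B-edges closes a path in `E`, which raises it to 2. Three B-edges would be a triangle in
      -- `E`.
      2≤ω-triangle : ∀ i j k → Adj i j → Adj i k → Adj j k → + 2 ≤ ω i j + ω i k + ω j k
      2≤ω-triangle i j k ij ik jk = combine-kinds (classify i j ij) (classify i k ik) (classify j k jk)
        where
        Kind : Fin n → Fin n → Set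
        Kind v w = A v w ≡ 1ℤ ⊎ (+ 2 ≤ ω v w) ⊎ IsB v w
        combine-kinds : Kind i j → Kind i k → Kind j k → + 2 ≤ ω i j + ω i k + ω j k
        combine-kinds (inj₂ (inj₁ c)) _ _ = sum≥2 c (0≤ω i k) (0≤ω j k) ≤-refl
        combine-kinds (inj₁ _) (inj₂ (inj₁ c)) _ = sum≥2 (0≤ω i j) c (0≤ω j k) ≤-refl
        combine-kinds (inj₂ (inj₂ _)) (inj₂ (inj₁ c)) _ = sum≥2 (0≤ω i j) c (0≤ω j k) ≤-refl
        combine-kinds (inj₁ _) (inj₁ _) (inj₂ (inj₁ c)) = sum≥2 (0≤ω i j) (0≤ω i k) c ≤-refl
        combine-kinds (inj₁ _) (inj₂ (inj₂ _)) (inj₂ (inj₁ c)) = sum≥2 (0≤ω i j) (0≤ω i k) c ≤-refl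
        combine-kinds (inj₂ (inj₂ _)) (inj₁ _) (inj₂ (inj₁ c)) = sum≥2 (0≤ω i j) (0≤ω i k) c ≤-refl
        combine-kinds (inj₂ (inj₂ _)) (inj₂ (inj₂ _)) (inj₂ (inj₁ c)) = sum≥2 (0≤ω i j) (0≤ω i k) c ≤-refl
        combine-kinds (inj₁ x) (inj₁ y) _ = sum≥2 (1≤ω i j x) (1≤ω i k y) (0≤ω j k) ≤-refl
        combine-kinds (inj₁ x) _ (inj₁ z) = sum≥2 (1≤ω i j x) (0≤ω i k) (1≤ω j k z) ≤-refl
        combine-kinds _ (inj₁ y) (inj₁ z) = sum≥2 (0≤ω i j) (1≤ω i k y) (1≤ω j k z) ≤-refl
        combine-kinds (inj₁ x) (inj₂ (inj₂ (_ , y))) (inj₂ (inj₂ (_ , z))) =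
          sum≥2 (2≤ω-path i k j x y (flip (cl j) (cl k) z)) (0≤ω i k) (0≤ω j k) ≤-refl
        combine-kinds (inj₂ (inj₂ (_ , x))) (inj₁ y) (inj₂ (inj₂ (_ , z))) =
          sum≥2 (0≤ω i j) (2≤ω-path i j k y x z) (0≤ω j k) ≤-refl
        combine-kinds (inj₂ (inj₂ (_ , x))) (inj₂ (inj₂ (_ , y))) (inj₁ z) =
          sum≥2 (0≤ω i j) (0≤ω i k) (2≤ω-path j i k z (flip (cl i) (cl j) x) y) ≤-refl
        combine-kinds (inj₂ (inj₂ (i≢j , x))) (inj₂ (inj₂ (i≢k , y))) (inj₂ (inj₂ (j≢k , z))) =
          ⊥-elim (E-triangle-free p-prime p%3≡2 p∤2 c₀ κ (cl i) (cl j) (cl k) i≢j j≢k i≢k x z y)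

      ∑-paths : ∑₂ paths ≡ + m * (+ 2 * + p * (+ 2 * + p))
      ∑-paths = begin
        ∑[ i ] ∑[ j ] ∑[ k ] (+ E i k * + E k j)
          ≡⟨ ∑-cong (λ i → ∑-comm (λ j k → + E i k * + E k j)) ⟩
        ∑[ i ] ∑[ k ] ∑[ j ] (+ E i k * + E k j)
          ≡⟨ ∑-cong (λ i → ∑-cong (λ k → trans (∑-*ˡ (+ E i k) (λ j → + E k j)) (cong (+ E i k *_) (∑-E k)))) ⟩
        ∑[ i ] ∑[ k ] (+ E i k * (+ 2 * + p))
          ≡⟨ ∑-cong (λ i → trans (∑-*ʳ (+ 2 * + p) (λ k → + E i k)) (cong (_* (+ 2 * + p)) (∑-E i))) ⟩
        ∑ {m} (λ _ → + 2 * + p * (+ 2 * + p))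
          ≡⟨ ∑-const m (+ 2 * + p * (+ 2 * + p)) ⟩
        + m * (+ 2 * + p * (+ 2 * + p)) ∎
        where open ≡-Reasoning

      -- Every vertex has exactly P `sA` partners under `A` in each cluster, so `A` is spread evenly
      -- over the pairs of clusters counted by `paths`.
      ∑-A-paths : ∑₂ (λ v w → A v w * paths (cl v) (cl w)) ≡ + P * + P * (+ P * + sA) * (+ m * (+ 2 * + p * (+ 2 * + p)))
      ∑-A-paths = begin
        ∑₂ (λ v w → A v w * paths (cl v) (cl w))
          ≡⟨ ∑-cong row ⟩
        ∑[ v ] (+ P * + sA * ∑ (paths (cl v)))
          ≡⟨ trans (∑-vertex (λ v → + P * + sA * ∑ (paths (cl v)))) (∑-cong (λ i → trans
               (∑₂-cong (λ x₁ x₂ → cong (λ k → + P * + sA * ∑ (paths k)) (cl-vertex i x₁ x₂))) (∑₂-const P P (+ P * + sA * ∑ (paths i))))) ⟩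
        ∑[ i ] (+ P * (+ P * (+ P * + sA * ∑ (paths i))))
          ≡⟨ trans (∑-cong (λ i → regroup (+ P) (+ P * + sA) (∑ (paths i)))) (∑-*ˡ (+ P * + P * (+ P * + sA)) (λ i → ∑ (paths i))) ⟩
        + P * + P * (+ P * + sA) * ∑₂ paths
          ≡⟨ cong (+ P * + P * (+ P * + sA) *_) ∑-paths ⟩
        + P * + P * (+ P * + sA) * (+ m * (+ 2 * + p * (+ 2 * + p))) ∎
        where
        open ≡-Reasoning
        regroup : ∀ P s x → P * (P * (s * x)) ≡ P * P * s * x
        regroup = solve-∀
        row : ∀ v → ∑[ w ] (A v w * paths (cl v) (cl w)) ≡ + P * + sA * ∑ (paths (cl v))
        row v = trans (∑-vertex (λ w → A v w * paths (cl v) (cl w))) (trans (∑-cong (λ j → trans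
          (∑₂-cong (λ y₁ y₂ → trans (cong₂ (λ z k → below sA z * paths (cl v) k) (col-to v j y₁ y₂) (cl-vertex j y₁ y₂))
            (*-comm (below sA (colour (point₁ v) (point₂ v) y₁ y₂)) (paths (cl v) j))))
          (trans (∑₂-*ˡ (paths (cl v) j) (λ y₁ y₂ → below sA (colour (point₁ v) (point₂ v) y₁ y₂)))
            (trans (cong (paths (cl v) j *_) (trans (∑-colour (below sA) (point₁ v) (point₂ v)) (cong (+ P *_) (∑-threshold sA (sA≤P 0<m thresholds (cl v))))))
              (*-comm (paths (cl v) j) (+ P * + sA)))))) (∑-*ˡ (+ P * + sA) (paths (cl v))))

      ∑-C : ∑₂ (λ v w → M v w * ⟦ cl v ≟ cl w ⟧) ≤ + n * (+ P * + (u ℕ.* m ℕ.* (2 ℕ.* κ ℕ.+ 2)))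
      ∑-C = begin
        ∑₂ (λ v w → M v w * ⟦ cl v ≟ cl w ⟧)
          ≡⟨ ∑-cong row ⟩
        ∑[ v ] (+ P * + sM (cl v) (cl v))
          ≤⟨ ∑-mono (λ v → *-monoˡ (+ P) pos-nonneg (+≤+ (ℕ.*-monoʳ-≤ (u ℕ.* m) (weight≤ (cl v) (cl v))))) ⟩
        ∑ {n} (λ _ → + P * + (u ℕ.* m ℕ.* (2 ℕ.* κ ℕ.+ 2)))
          ≡⟨ ∑-const n _ ⟩
        + n * (+ P * + (u ℕ.* m ℕ.* (2 ℕ.* κ ℕ.+ 2))) ∎
        where
        open ≤-Reasoning
        row : ∀ v → ∑[ w ] (M v w * ⟦ cl v ≟ cl w ⟧) ≡ + P * + sM (cl v) (cl v)
        row v = trans (∑-vertex (λ w → M v w * ⟦ cl v ≟ cl w ⟧)) (trans (∑-cong (λ j → trans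
          (∑₂-cong (λ y₁ y₂ → trans (cong₂ (λ z k → (below (sA ℕ.+ sM (cl v) k) z - below sA z) * ⟦ cl v ≟ k ⟧) (col-to v j y₁ y₂) (cl-vertex j y₁ y₂))
            (*-comm _ ⟦ cl v ≟ j ⟧)))
          (trans (∑₂-*ˡ ⟦ cl v ≟ j ⟧ (λ y₁ y₂ → g j (colour (point₁ v) (point₂ v) y₁ y₂)))
            (cong (⟦ cl v ≟ j ⟧ *_) (trans (∑-colour (g j) (point₁ v) (point₂ v)) (cong (+ P *_) (M-density 0<m thresholds (cl v) j)))))))
          (∑-δ (cl v) (λ j → + P * + sM (cl v) j)))
          where
          g : Fin m → Fin P → ℤ
          g j z = below (sA ℕ.+ sM (cl v) j) z - below sA z

      ∑-ω : ∑₂ ω ≤ ∑₂ A + + P * + P * (+ P * + sA) * (+ m * (+ 2 * + p * (+ 2 * + p))) + + 2 * (+ n * (+ P * + (u ℕ.* m ℕ.* (2 ℕ.* κ ℕ.+ 2))))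
      ∑-ω = begin
        ∑₂ ω
          ≡⟨ ∑₂-+ (λ v w → A v w * (1ℤ + paths (cl v) (cl w))) (λ v w → + 2 * (M v w * ⟦ cl v ≟ cl w ⟧)) ⟩
        ∑₂ (λ v w → A v w * (1ℤ + paths (cl v) (cl w))) + ∑₂ (λ v w → + 2 * (M v w * ⟦ cl v ≟ cl w ⟧))
          ≡⟨ cong₂ _+_ (trans (∑₂-cong (λ v w → distribute (A v w) (paths (cl v) (cl w)))) (trans (∑₂-+ A (λ v w → A v w * paths (cl v) (cl w)))
               (cong (_+_ (∑₂ A)) ∑-A-paths))) (∑₂-*ˡ (+ 2) (λ v w → M v w * ⟦ cl v ≟ cl w ⟧)) ⟩
        ∑₂ A + + P * + P * (+ P * + sA) * (+ m * (+ 2 * + p * (+ 2 * + p))) + + 2 * ∑₂ (λ v w → M v w * ⟦ cl v ≟ cl w ⟧)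
          ≤⟨ +-monoʳ-≤ (∑₂ A + + P * + P * (+ P * + sA) * (+ m * (+ 2 * + p * (+ 2 * + p)))) (*-monoˡ (+ 2) pos-nonneg ∑-C) ⟩
        ∑₂ A + + P * + P * (+ P * + sA) * (+ m * (+ 2 * + p * (+ 2 * + p))) + + 2 * (+ n * (+ P * + (u ℕ.* m ℕ.* (2 ℕ.* κ ℕ.+ 2)))) ∎
        where
        open ≤-Reasoning
        distribute : ∀ a s → a * (1ℤ + s) ≡ a + a * s
        distribute = solve-∀

  -- Choice of the parameters

  record BaseParameters (q : ℕ) : Set where
    field
      p κ       : ℕ
      p-prime   : Prime p
      p%3≡2     : p ℕ.% 3 ≡ 2
      p∤2       : ¬ (+ p ∣ + 2)
      0<p       : 0 ℕ.< p
      0<κ       : 0 ℕ.< κ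
      p≤κ²      : p ℕ.≤ κ ℕ.* κ
      -- C-edges lie in a 1 / m fraction of the blocks, with threshold at most u m (2 κ + 2) against
      -- u ρ for `A`; this inequality makes their contribution to `∑₂ ω` at most a fraction 1/(4q)
      -- of `∑₂ A`.
      8q[κ+1]≤p : 8 ℕ.* q ℕ.* (κ ℕ.+ 1) ℕ.≤ p

  base-parameters : ∀ q → BaseParameters q
  base-parameters q with prime≡2mod3-above ((2 ℕ.* (8 ℕ.* q) ℕ.+ 2) ℕ.* (2 ℕ.* (8 ℕ.* q) ℕ.+ 2))
  ... | p , p-prime , p-large , p%3≡2 with ceil-sqrt p
  ...   | κ , p≤κ² , κ²≤ , _ = record
    { p = p ; κ = κ ; p-prime = p-prime ; p%3≡2 = p%3≡2 ; p∤2 = p∤2 ; 0<p = 0<p ; 0<κ = 0<κ ; p≤κ² = p≤κ² ; 8q[κ+1]≤p = D[κ+1]≤p }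
    where
    D = 8 ℕ.* q
    p∤2 : ¬ (+ p ∣ + 2)
    p∤2 d = ℕ.>⇒∤ (ℕ.<-trans (ℕ.<-≤-trans (ℕ.s≤s (ℕ.s≤s (ℕ.s≤s ℕ.z≤n))) (ℕ.*-mono-≤ 2≤ 2≤)) p-large) (∣⇒∣ᵤ d)
      where
      2≤ : 2 ℕ.≤ 2 ℕ.* D ℕ.+ 2
      2≤ = ℕ.m≤n+m 2 (2 ℕ.* D)
    0<p : 0 ℕ.< p
    0<p = ℕ.≤-<-trans ℕ.z≤n p-large
    0<κ : 0 ℕ.< κ
    0<κ = ℕ.n≢0⇒n>0 λ κ≡0 → ℕ.<⇒≱ 0<p (ℕ.≤-trans p≤κ² (ℕ.≤-reflexive (cong (λ k → k ℕ.* k) κ≡0)))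
    -- Otherwise κ² ≤ p + 2 κ ≤ (2 D + 2) κ, so κ ≤ 2 D + 2 and p ≤ κ² would not exceed (2 D + 2)².
    D[κ+1]≤p : D ℕ.* (κ ℕ.+ 1) ℕ.≤ p
    D[κ+1]≤p = ℕ.≮⇒≥ λ p<D[κ+1] → ℕ.<⇒≱ p-large (ℕ.≤-trans p≤κ² (ℕ.*-mono-≤ (κ≤ p<D[κ+1]) (κ≤ p<D[κ+1])))
      where
      κ≤ : p ℕ.< D ℕ.* (κ ℕ.+ 1) → κ ℕ.≤ 2 ℕ.* D ℕ.+ 2
      κ≤ p<D[κ+1] = ℕ.*-cancelʳ-≤ κ (2 ℕ.* D ℕ.+ 2) κ {{ℕ.>-nonZero 0<κ}} (begin
        κ ℕ.* κ                                ≤⟨ κ²≤ ⟩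
        p ℕ.+ 2 ℕ.* κ                          ≤⟨ ℕ.+-monoˡ-≤ (2 ℕ.* κ) (ℕ.<⇒≤ p<D[κ+1]) ⟩
        D ℕ.* (κ ℕ.+ 1) ℕ.+ 2 ℕ.* κ            ≤⟨ ℕ.+-monoˡ-≤ (2 ℕ.* κ) (ℕ.*-monoʳ-≤ D (ℕ.+-monoʳ-≤ κ 0<κ)) ⟩
        D ℕ.* (κ ℕ.+ κ) ℕ.+ 2 ℕ.* κ            ≡⟨ regroup D κ ⟩
        (2 ℕ.* D ℕ.+ 2) ℕ.* κ                  ∎)
        where
        open ℕ.≤-Reasoning
        regroup : ∀ D k → D ℕ.* (k ℕ.+ k) ℕ.+ 2 ℕ.* k ≡ (2 ℕ.* D ℕ.+ 2) ℕ.* k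
        regroup = ℕSolver.solve-∀

  module Parameters (q : ℕ) (0<q : 0 ℕ.< q) (parameters : BaseParameters q) where

    open BaseParameters parameters

    -- The entries of `paths` add up to m (2p)² = (4 / c₀) m², so 16 q copies make the increase of
    -- the weight on `A` a fraction 1/(4q).
    c₀ : ℕ
    c₀ = 16 ℕ.* q

    open Clusters p-prime p∤2 c₀ κ public using (m; ρ)

    0<m : 0 ℕ.< m
    0<m = ℕ.*-mono-< (ℕ.*-mono-< {0} {16} (ℕ.s≤s ℕ.z≤n) 0<q) (ℕ.*-mono-< 0<p 0<p)

    0<ρ : 0 ℕ.< ρ
    0<ρ = ℕ.*-mono-< {0} {2} (ℕ.s≤s ℕ.z≤n) (ℕ.<-≤-trans 0<p (ℕ.m≤m+n p κ))

    -- A bound, per unit `u`, for the number of colours used between two clusters; hence u = P / Q.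
    -- The factor 2 in `K` absorbs the rounding of this quotient in P ≤ K `sA`.
    Q : ℕ
    Q = ρ ℕ.+ m ℕ.* (2 ℕ.* κ ℕ.+ 2)

    0<Q : 0 ℕ.< Q
    0<Q = ℕ.<-≤-trans 0<ρ (ℕ.m≤m+n ρ _)

    instance
      Q≢0 : ℕ.NonZero Q
      Q≢0 = ℕ.>-nonZero 0<Q

    K : ℕ
    K = 2 ℕ.* Q

    0<K : 0 ℕ.< K
    0<K = ℕ.*-mono-< {0} {2} (ℕ.s≤s ℕ.z≤n) 0<Q

    -- The constant 2 m K + 4 of `triangle-free-total`, plus one for the missing loops, times the
    -- factor 2 K that converts n² into edges.
    C : ℕ
    C = (2 ℕ.* m ℕ.* K ℕ.+ 5) ℕ.* K′
      where
      K′ = 2 ℕ.* K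

    module Level (t : ℕ) (0<t : 0 ℕ.< t) {P : ℕ} (P-prime : Prime P)
      -- `t⁴` makes the discrepancies small, 9 secures 9 t² ≤ n for the square roots, `Q` keeps `u`
      -- positive, and `K * (q + 1)` makes n missing loops negligible.
      (P-large : t ℕ.* t ℕ.* t ℕ.* t ℕ.+ (9 ℕ.+ (Q ℕ.+ K ℕ.* (q ℕ.+ 1))) ℕ.≤ P) where

      t⁴≤P : t ℕ.* t ℕ.* t ℕ.* t ℕ.≤ P
      t⁴≤P = ℕ.m+n≤o⇒m≤o (t ℕ.* t ℕ.* t ℕ.* t) P-large

      9≤P : 9 ℕ.≤ P
      9≤P = ℕ.m+n≤o⇒m≤o 9 (ℕ.m+n≤o⇒n≤o (t ℕ.* t ℕ.* t ℕ.* t) P-large)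

      Q≤P : Q ℕ.≤ P
      Q≤P = ℕ.m+n≤o⇒m≤o Q (ℕ.m+n≤o⇒n≤o 9 (ℕ.m+n≤o⇒n≤o (t ℕ.* t ℕ.* t ℕ.* t) P-large))

      K[q+1]<P : K ℕ.* (q ℕ.+ 1) ℕ.< P
      K[q+1]<P = ℕ.≤-trans (ℕ.+-monoˡ-≤ (K ℕ.* (q ℕ.+ 1)) 0<Q) (ℕ.m+n≤o⇒n≤o 9 (ℕ.m+n≤o⇒n≤o (t ℕ.* t ℕ.* t ℕ.* t) P-large))

      0<P : 0 ℕ.< P
      0<P = ℕ.<-≤-trans (ℕ.s≤s ℕ.z≤n) 9≤P

      u : ℕ
      u = P ℕ./ Q

      thresholds : u ℕ.* Q ℕ.≤ P
      thresholds = ℕ.m/n*n≤m P Q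

      0<u : 0 ℕ.< u
      0<u = ℕ.m≥n⇒m/n>0 Q≤P

      open Construction p-prime p%3≡2 p∤2 c₀ κ P-prime u public hiding (m; ρ)

      P≤K*sA : P ℕ.≤ K ℕ.* sA
      P≤K*sA = begin
        P                               ≡⟨ ℕ.m≡m%n+[m/n]*n P Q ⟩
        P ℕ.% Q ℕ.+ u ℕ.* Q             ≤⟨ ℕ.+-monoˡ-≤ (u ℕ.* Q) (ℕ.<⇒≤ (ℕ.m%n<n P Q)) ⟩
        Q ℕ.+ u ℕ.* Q                   ≤⟨ ℕ.+-monoˡ-≤ (u ℕ.* Q) (ℕ.m≤n*m Q u {{ℕ.>-nonZero 0<u}}) ⟩
        u ℕ.* Q ℕ.+ u ℕ.* Q             ≡⟨ regroup u Q ⟩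
        2 ℕ.* Q ℕ.* u                   ≤⟨ ℕ.*-monoʳ-≤ (2 ℕ.* Q) (ℕ.m≤m*n u ρ {{ℕ.>-nonZero 0<ρ}}) ⟩
        K ℕ.* sA                        ∎
        where
        open ℕ.≤-Reasoning
        regroup : ∀ u Q → u ℕ.* Q ℕ.+ u ℕ.* Q ≡ 2 ℕ.* Q ℕ.* u
        regroup = ℕSolver.solve-∀

      P≤n : P ℕ.≤ n
      P≤n = ℕ.≤-trans (ℕ.m≤m*n P P {{ℕ.>-nonZero 0<P}}) (ℕ.m≤n*m (P ℕ.* P) m {{ℕ.>-nonZero 0<m}})

      t≤n : t ℕ.≤ n
      t≤n = ℕ.≤-trans (ℕ.m≤m*n t (t ℕ.* t ℕ.* t) {{ℕ.>-nonZero (ℕ.*-mono-< (ℕ.*-mono-< 0<t 0<t) 0<t)}}) (ℕ.≤-trans (ℕ.≤-reflexive (regroup t)) (ℕ.≤-trans t⁴≤P P≤n))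
        where
        regroup : ∀ t → t ℕ.* (t ℕ.* t ℕ.* t) ≡ t ℕ.* t ℕ.* t ℕ.* t
        regroup = ℕSolver.solve-∀

      e τ ν : ℕ
      e = numEdges G
      τ = τ₃ G
      ν = ν₃ G

      private
        -- `X` is the common value of `∑₂ A` and `∑₂ M`; up to the loops, it is the number of edges
        -- of `G`.
        X N π : ℤ
        X = + n * (+ m * (+ P * + sA))
        N = + n
        π = + P

        0<N : 0ℤ < N
        0<N = +<+ (ℕ.<-≤-trans 0<P P≤n)

        +n : N ≡ + m * (π * π)
        +n = trans (pos-* m (P ℕ.* P)) (cong (+ m *_) (pos-* P P))

        +m : + m ≡ + 16 * + q * (+ p * + p)
        +m = trans (pos-* (16 ℕ.* q) (p ℕ.* p)) (cong₂ _*_ (pos-* 16 q) (pos-* p p))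

        2X≡∑AM : + 2 * X ≡ ∑₂ AM
        2X≡∑AM = trans (double X) (trans (cong₂ _+_ (sym (∑₂-A 0<m thresholds)) (sym (∑₂-M 0<m thresholds)))
          (trans (sym (∑₂-+ A M)) (∑₂-cong (λ v w → rejoin (A v w) (AM v w)))))
          where
          double : ∀ x → + 2 * x ≡ x + x
          double = solve-∀
          rejoin : ∀ a x → a + (x - a) ≡ x
          rejoin = solve-∀

        2X≤2e+n : + 2 * X ≤ + 2 * + e + N
        2X≤2e+n = ≤-trans (≤-reflexive 2X≡∑AM) (≤-trans ∑AM≤∑adj+n (≤-reflexive (cong (λ z → z + N) (sym (2*numEdges G)))))

        n²≤KX : N * N ≤ + K * X
        n²≤KX = from-sub (*-nonneg (*-nonneg (*-nonneg (pos-nonneg {n}) (pos-nonneg {m})) (pos-nonneg {P})) (sub-nonneg P≤KsA))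
          (trans (split N (+ m) π (+ K) (+ sA)) (cong (λ z → N * z + N * + m * π * (+ K * + sA - π)) (sym +n)))
          where
          P≤KsA : π ≤ + K * + sA
          P≤KsA = subst (π ≤_) (pos-* K sA) (+≤+ P≤K*sA)
          split : ∀ N m P K s → K * (N * (m * (P * s))) ≡ N * (m * (P * P)) + N * m * P * (K * s - P)
          split = solve-∀

        [q+1]n<X : (+ q + 1ℤ) * N < X
        [q+1]n<X = *-cancelˡ-<-nonNeg (+ K) (<-≤-trans
          (subst (_< N * N) (trans (cong (_* N) (trans (pos-* K (q ℕ.+ 1)) refl)) (*-assoc (+ K) (+ q + 1ℤ) N))
            (*-monoʳ-<-pos N {{positive 0<N}} (+<+ (ℕ.<-≤-trans K[q+1]<P P≤n)))) n²≤KX)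

        2n≤X : + 2 * N ≤ X
        2n≤X = ≤-trans (subst₂ _≤_ (*-comm N (+ 2)) (*-comm N (+ q + 1ℤ)) (*-monoˡ N pos-nonneg (+-monoˡ-≤ 1ℤ (+≤+ 0<q)))) (<⇒≤ [q+1]n<X)

        n≤e : N ≤ + e
        n≤e = *-cancel {+ 2} (+<+ (ℕ.s≤s ℕ.z≤n)) (from-sub
          (+-nonneg (sub-nonneg 2X≤2e+n) (+-nonneg (*-nonneg {+ 2} pos-nonneg (sub-nonneg 2n≤X)) (pos-nonneg {n}))) (split X N (+ e)))
          where
          split : ∀ X N e → + 2 * e ≡ + 2 * N + ((+ 2 * e + N - + 2 * X) + (+ 2 * (X - + 2 * N) + N))
          split = solve-∀

        X≤e+n : X ≤ + e + N
        X≤e+n = *-cancel {+ 2} (+<+ (ℕ.s≤s ℕ.z≤n)) (from-sub (+-nonneg (sub-nonneg 2X≤2e+n) (pos-nonneg {n})) (split X N (+ e)))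
          where
          split : ∀ X N e → + 2 * (e + N) ≡ + 2 * X + ((+ 2 * e + N - + 2 * X) + N)
          split = solve-∀

        n²≤2Ke : N * N ≤ + 2 * + K * + e
        n²≤2Ke = from-sub (+-nonneg (sub-nonneg n²≤KX) (*-nonneg (pos-nonneg {K}) (+-nonneg (sub-nonneg X≤e+n) (sub-nonneg n≤e))))
          (split N (+ K) X (+ e))
          where
          split : ∀ N K X e → + 2 * K * e ≡ N * N + ((K * X - N * N) + K * ((e + N - X) + (e - N)))
          split = solve-∀

      0<e : 0 ℕ.< e
      0<e = drop‿+<+ (<-≤-trans 0<N n≤e)

      edge-density : n ℕ.* n ℕ.≤ 2 ℕ.* K ℕ.* e
      edge-density = drop‿+≤+ (subst₂ _≤_ (sym (pos-* n n)) (sym (trans (pos-* (2 ℕ.* K) e) (cong (_* + e) (pos-* 2 K)))) n²≤2Ke)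

      private
        open TriangleFreePart (triangle-free-part G)

        ∑T-bound : + t * (∑₂ T - ∑₂ M) ≤ (+ 2 * + m * + K + + 4) * (N * N)
        ∑T-bound = triangle-free-total p-prime p∤2 c₀ κ P-prime u 0<m thresholds 0<κ p≤κ² t 0<t t⁴≤P 9≤P K P≤K*sA
          T T-sym 0≤T (λ v w → ≤-trans (T≤adj v w) (adj≤AM v w)) T²≡T triangle-free

        2e-2τ≤∑T : + 2 * + e - + 2 * + τ ≤ ∑₂ T
        2e-2τ≤∑T = subst (λ z → z - + 2 * + τ ≤ ∑₂ T) (sym (2*numEdges G)) ∑T

      -- A minimum cover leaves `∑₂ T` at least 2 e - 2 τ, while `∑₂ M` is at most e + n. `∑T-bound`
      -- compares the two, and t n ≤ n² absorbs the loops.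
      cover-bound : t ℕ.* e ℕ.≤ C ℕ.* e ℕ.+ 2 ℕ.* t ℕ.* τ
      cover-bound = drop‿+≤+ (subst₂ _≤_ (sym (pos-* t e)) +rhs (from-sub
        (+-nonneg (sub-nonneg ∑T-bound) (+-nonneg (*-nonneg (pos-nonneg {t}) (+-nonneg (sub-nonneg 2e-2τ≤∑T) (sub-nonneg X≤e+n)))
          (+-nonneg (*-nonneg (pos-nonneg {n}) (sub-nonneg (+≤+ t≤n))) (*-nonneg (+-nonneg (*-nonneg (*-nonneg {+ 2} pos-nonneg (pos-nonneg {m})) (pos-nonneg {K})) (pos-nonneg {5})) (sub-nonneg n²≤2Ke)))))
        (trans (split (+ t) (+ e) (+ τ) (+ m) (+ K) N X (∑₂ T))
          (cong (λ z → + t * + e + (((+ 2 * + m * + K + + 4) * (N * N) - + t * (∑₂ T - z)) + (+ t * ((∑₂ T - (+ 2 * + e - + 2 * + τ)) + (+ e + N - X))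
            + (N * (N - + t) + (+ 2 * + m * + K + + 5) * (+ 2 * + K * + e - N * N))))) (sym (∑₂-M 0<m thresholds))))))
        where
        +C : + C ≡ (+ 2 * + m * + K + + 5) * (+ 2 * + K)
        +C = trans (pos-* (2 ℕ.* m ℕ.* K ℕ.+ 5) (2 ℕ.* K)) (cong₂ _*_ (cong (λ z → z + + 5) (trans (pos-* (2 ℕ.* m) K) (cong (_* + K) (pos-* 2 m)))) (pos-* 2 K))
        +rhs : (+ 2 * + m * + K + + 5) * (+ 2 * + K) * + e + + 2 * + t * + τ ≡ + (C ℕ.* e ℕ.+ 2 ℕ.* t ℕ.* τ)
        +rhs = sym (cong₂ _+_ (trans (pos-* C e) (cong (_* + e) +C)) (trans (pos-* (2 ℕ.* t) τ) (cong (_* + τ) (pos-* 2 t))))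
        split : ∀ t e τ m K N X T → (+ 2 * m * K + + 5) * (+ 2 * K) * e + + 2 * t * τ ≡
          t * e + (((+ 2 * m * K + + 4) * (N * N) - t * (T - X)) + (t * ((T - (+ 2 * e - + 2 * τ)) + (e + N - X))
            + (N * (N - t) + (+ 2 * m * K + + 5) * (+ 2 * K * e - N * N))))
        split = solve-∀

      private
        S₂ S₃ : ℤ
        S₂ = π * π * (π * + sA) * (+ m * (+ 2 * + p * (+ 2 * + p)))
        S₃ = + 2 * (N * (π * + (u ℕ.* m ℕ.* (2 ℕ.* κ ℕ.+ 2))))

        4ν≤ : + 4 * + ν ≤ X + S₂ + S₃
        4ν≤ = ≤-trans (4ν₃≤∑ω G ω ω-sym (0≤ω 0<m thresholds) (2≤ω-triangle 0<m thresholds)) (≤-trans (∑-ω 0<m thresholds)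
          (≤-reflexive (cong (λ z → z + S₂ + S₃) (∑₂-A 0<m thresholds))))

        4qS₂≡X : + 4 * + q * S₂ ≡ X
        4qS₂≡X = trans (regroup π (+ sA) (+ m) (+ p) (+ q)) (trans (cong (λ z → + m * (π * π) * (z * (π * + sA))) (sym +m)) (cong (λ z → z * (+ m * (π * + sA))) (sym +n)))
          where
          regroup : ∀ P s m p q → + 4 * q * (P * P * (P * s) * (m * (+ 2 * p * (+ 2 * p)))) ≡ m * (P * P) * (+ 16 * q * (p * p) * (P * s))
          regroup = solve-∀

        4qS₃≤X : + 4 * + q * S₃ ≤ X
        4qS₃≤X = from-sub (*-nonneg (*-nonneg (*-nonneg (*-nonneg (pos-nonneg {n}) (pos-nonneg {m})) (pos-nonneg {P})) (pos-nonneg {u}))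
            (*-nonneg {+ 2} pos-nonneg (+-nonneg (sub-nonneg D≤) (pos-nonneg {κ}))))
          (trans (cong (λ z → N * (+ m * (π * z))) (trans (pos-* u ρ) (cong (+ u *_) (pos-* 2 (p ℕ.+ κ)))))
            (trans (split N (+ m) π (+ u) (+ p) (+ κ) (+ q)) (cong (λ z → + 4 * + q * (+ 2 * (N * (π * z))) + N * + m * π * + u * (+ 2 * ((+ p - + 8 * + q * (+ κ + 1ℤ)) + + κ)))
              (sym (trans (pos-* (u ℕ.* m) (2 ℕ.* κ ℕ.+ 2)) (cong₂ _*_ (pos-* u m) (cong (λ z → z + + 2) (pos-* 2 κ))))))))
          where
          D≤ : + 8 * + q * (+ κ + 1ℤ) ≤ + p
          D≤ = subst (_≤ + p) (trans (pos-* (8 ℕ.* q) (κ ℕ.+ 1)) (cong (_* (+ κ + 1ℤ)) (pos-* 8 q))) (+≤+ 8q[κ+1]≤p)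
          split : ∀ N m P u p κ q → N * (m * (P * (u * (+ 2 * (p + κ))))) ≡
            + 4 * q * (+ 2 * (N * (P * (u * m * (+ 2 * κ + + 2))))) + N * m * P * u * (+ 2 * ((p - + 8 * q * (κ + 1ℤ)) + κ))
          split = solve-∀

        -- Both corrections `S₂` and `S₃` are at most X / (4q), so 4 ν ≤ X (1 + 1/(2q)).
        8qν≤[2q+1]X : + 8 * + q * + ν ≤ (+ 2 * + q + 1ℤ) * X
        8qν≤[2q+1]X = *-cancel {+ 2} (+<+ (ℕ.s≤s ℕ.z≤n)) (from-sub
          (+-nonneg (*-nonneg (*-nonneg {+ 4} pos-nonneg (pos-nonneg {q})) (sub-nonneg 4ν≤)) (sub-nonneg 4qS₃≤X))
          (trans (split (+ q) (+ ν) X S₂ S₃) (trans (cong (λ z → + 2 * (+ 8 * + q * + ν) + (+ 4 * + q * (X + S₂ + S₃ - + 4 * + ν) + (X - + 4 * + q * S₃)) + (X - z)) 4qS₂≡X) (drop (+ 2 * (+ 8 * + q * + ν) + (+ 4 * + q * (X + S₂ + S₃ - + 4 * + ν) + (X - + 4 * + q * S₃))) X))))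
          where
          split : ∀ q ν X S₂ S₃ → + 2 * ((+ 2 * q + 1ℤ) * X) ≡ + 2 * (+ 8 * q * ν) + (+ 4 * q * (X + S₂ + S₃ - + 4 * ν) + (X - + 4 * q * S₃)) + (X - + 4 * q * S₂)
          split = solve-∀
          drop : ∀ x y → x + (y - y) ≡ x
          drop = solve-∀

      -- The allowance 1/q exceeds the 1/(2q) already spent; the surplus `X`, larger than (q + 1) n,
      -- pays for the loops in 2 X ≤ 2 e + n and makes the inequality strict.
      packing-bound : 4 ℕ.* q ℕ.* ν ℕ.< (q ℕ.+ 1) ℕ.* e
      packing-bound = drop‿+<+ (subst₂ _<_ (sym (trans (pos-* (4 ℕ.* q) ν) (cong (_* + ν) (pos-* 4 q)))) (sym (pos-* (q ℕ.+ 1) e))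
        (*-cancelˡ-<-nonNeg (+ 2) (begin-strict
          + 2 * (+ 4 * + q * + ν)                        ≡⟨ regroup (+ q) (+ ν) ⟩
          + 8 * + q * + ν                                ≤⟨ 8qν≤[2q+1]X ⟩
          (+ 2 * + q + 1ℤ) * X                           ≡⟨ split (+ q) X ⟩
          (+ q + 1ℤ) * (+ 2 * X) - X                     <⟨ +-monoʳ-< ((+ q + 1ℤ) * (+ 2 * X)) (neg-mono-< [q+1]n<X) ⟩
          (+ q + 1ℤ) * (+ 2 * X) - (+ q + 1ℤ) * N        ≤⟨ +-monoˡ-≤ (- ((+ q + 1ℤ) * N)) (*-monoˡ (+ q + 1ℤ) pos-nonneg 2X≤2e+n) ⟩
          (+ q + 1ℤ) * (+ 2 * + e + N) - (+ q + 1ℤ) * N  ≡⟨ collect (+ q) (+ e) N ⟩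
          + 2 * ((+ q + 1ℤ) * + e)                       ∎)))
        where
        open ≤-Reasoning
        regroup : ∀ q ν → + 2 * (+ 4 * q * ν) ≡ + 8 * q * ν
        regroup = solve-∀
        split : ∀ q X → (+ 2 * q + 1ℤ) * X ≡ (q + 1ℤ) * (+ 2 * X) - X
        split = solve-∀
        collect : ∀ q e N → (q + 1ℤ) * (+ 2 * e + N) - (q + 1ℤ) * N ≡ + 2 * ((q + 1ℤ) * e)
        collect = solve-∀

  record ExtremalGraph (q K C t : ℕ) : Set₁ where
    field
      {n}           : ℕ
      G             : Graph n
      t≤n           : t ℕ.≤ n
      0<e           : 0 ℕ.< numEdges G
      edge-density  : n ℕ.* n ℕ.≤ K ℕ.* numEdges G
      cover-bound   : t ℕ.* numEdges G ℕ.≤ C ℕ.* numEdges G ℕ.+ 2 ℕ.* t ℕ.* τ₃ G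
      packing-bound : 4 ℕ.* q ℕ.* ν₃ G ℕ.< (q ℕ.+ 1) ℕ.* numEdges G

  -- The quantifier order carries the asymptotics: the density constant `K` and the constant `C` of
  -- the error C / t are fixed before `t`.
  ExtremalFamily : ℕ → Set₁
  ExtremalFamily q = Σ[ K ∈ ℕ ] Σ[ C ∈ ℕ ] (0 ℕ.< K × (∀ t → 0 ℕ.< t → ExtremalGraph q K C t))

  family-over : ∀ q → 0 ℕ.< q → BaseParameters q → ExtremalFamily q
  family-over q 0<q parameters = 2 ℕ.* K , C , ℕ.*-mono-< {0} {2} (ℕ.s≤s ℕ.z≤n) 0<K
    , λ t 0<t → graph t 0<t (prime≡2mod3-above (t ℕ.* t ℕ.* t ℕ.* t ℕ.+ (9 ℕ.+ (Q ℕ.+ K ℕ.* (q ℕ.+ 1)))))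
    where
    open Parameters q 0<q parameters
    graph : ∀ t → 0 ℕ.< t → Σ[ P ∈ ℕ ] (Prime P × t ℕ.* t ℕ.* t ℕ.* t ℕ.+ (9 ℕ.+ (Q ℕ.+ K ℕ.* (q ℕ.+ 1))) ℕ.< P × P ℕ.% 3 ≡ 2) → ExtremalGraph q (2 ℕ.* K) C t
    graph t 0<t (P , P-prime , P-large , _) = record
      { G = L.G ; t≤n = L.t≤n ; 0<e = L.0<e ; edge-density = L.edge-density ; cover-bound = L.cover-bound ; packing-bound = L.packing-bound }
      where module L = Level t 0<t P-prime (ℕ.<⇒≤ P-large)

  opaque
    extremal-family : ∀ q → 0 ℕ.< q → ExtremalFamily q
    extremal-family q 0<q = family-over q 0<q (base-parameters q)

open Integral using (ExtremalGraph; ExtremalFamily; extremal-family)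

open import Data.Nat.Base as ℕ using (ℕ; zero; suc)
import Data.Nat.Properties as ℕ
open import Data.Nat.Combinatorics using (_C_; nC1≡n; nCk+nC[k+1]≡[n+1]C[k+1])
import Data.Nat.Tactic.RingSolver as ℕSolver
open import Data.Integer.Base as ℤ using (+_; -[1+_])
import Data.Integer.Properties as ℤ
open import Data.Rational.Base using (ℚ; mkℚ; 0ℚ; 1ℚ; _+_; _-_; -_; _*_; _/_; _≤_; _≥_; _<_; _>_; *<*; 1/_; toℚᵘ; ∣_∣; positive; nonNegative)
open import Data.Rational.Properties
open import Data.Rational.Unnormalised.Base as ℚᵘ using (mkℚᵘ; *≡*; *≤*)
import Data.Rational.Unnormalised.Properties as ℚᵘ
open import Data.Rational.Solver using (module +-*-Solver)
open import Data.Product.Base using (Σ-syntax; _×_; _,_; proj₁; proj₂)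

-- From integer to rational inequalities

toℚᵘ-fromℕ : ∀ k → toℚᵘ (fromℕ k) ℚᵘ.≃ mkℚᵘ (+ k) 0
toℚᵘ-fromℕ k = toℚᵘ-fromℚᵘ (mkℚᵘ (+ k) 0)

fromℕ-mono-≤ : ∀ {a b} → a ℕ.≤ b → fromℕ a ≤ fromℕ b
fromℕ-mono-≤ {a} {b} a≤b = toℚᵘ-cancel-≤ (begin
  toℚᵘ (fromℕ a)  ≃⟨ toℚᵘ-fromℕ a ⟩
  mkℚᵘ (+ a) 0    ≤⟨ *≤* (ℤ.*-monoʳ-≤-nonNeg (+ 1) (ℤ.+≤+ a≤b)) ⟩
  mkℚᵘ (+ b) 0    ≃⟨ toℚᵘ-fromℕ b ⟨
  toℚᵘ (fromℕ b)  ∎)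
  where open ℚᵘ.≤-Reasoning

fromℕ-mono-< : ∀ {a b} → a ℕ.< b → fromℕ a < fromℕ b
fromℕ-mono-< {a} {b} a<b = toℚᵘ-cancel-< (begin-strict
  toℚᵘ (fromℕ a)  ≃⟨ toℚᵘ-fromℕ a ⟩
  mkℚᵘ (+ a) 0    <⟨ ℚᵘ.*<* (ℤ.*-monoʳ-<-pos (+ 1) (ℤ.+<+ a<b)) ⟩
  mkℚᵘ (+ b) 0    ≃⟨ toℚᵘ-fromℕ b ⟨
  toℚᵘ (fromℕ b)  ∎)
  where open ℚᵘ.≤-Reasoning

fromℕ-+ : ∀ a b → fromℕ (a ℕ.+ b) ≡ fromℕ a + fromℕ b
fromℕ-+ a b = toℚᵘ-injective (begin
  toℚᵘ (fromℕ (a ℕ.+ b))                 ≈⟨ toℚᵘ-fromℕ (a ℕ.+ b) ⟩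
  mkℚᵘ (+ (a ℕ.+ b)) 0                   ≈⟨ *≡* (cong (ℤ._* + 1) (cong₂ ℤ._+_ (ℤ.*-identityʳ (+ a)) (ℤ.*-identityʳ (+ b)))) ⟨
  mkℚᵘ (+ a) 0 ℚᵘ.+ mkℚᵘ (+ b) 0         ≈⟨ ℚᵘ.+-cong (toℚᵘ-fromℕ a) (toℚᵘ-fromℕ b) ⟨
  toℚᵘ (fromℕ a) ℚᵘ.+ toℚᵘ (fromℕ b)     ≈⟨ toℚᵘ-homo-+ (fromℕ a) (fromℕ b) ⟨
  toℚᵘ (fromℕ a + fromℕ b)               ∎)
  where open import Relation.Binary.Reasoning.Setoid ℚᵘ.≃-setoid

fromℕ-* : ∀ a b → fromℕ (a ℕ.* b) ≡ fromℕ a * fromℕ b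
fromℕ-* a b = toℚᵘ-injective (begin
  toℚᵘ (fromℕ (a ℕ.* b))                 ≈⟨ toℚᵘ-fromℕ (a ℕ.* b) ⟩
  mkℚᵘ (+ (a ℕ.* b)) 0                   ≈⟨ *≡* (cong (ℤ._* + 1) (ℤ.pos-* a b)) ⟩
  mkℚᵘ (+ a) 0 ℚᵘ.* mkℚᵘ (+ b) 0         ≈⟨ ℚᵘ.*-cong (toℚᵘ-fromℕ a) (toℚᵘ-fromℕ b) ⟨
  toℚᵘ (fromℕ a) ℚᵘ.* toℚᵘ (fromℕ b)     ≈⟨ toℚᵘ-homo-* (fromℕ a) (fromℕ b) ⟨
  toℚᵘ (fromℕ a * fromℕ b)               ∎)
  where open import Relation.Binary.Reasoning.Setoid ℚᵘ.≃-setoid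

fromℕ-pos : ∀ {a} → 0 ℕ.< a → 0ℚ < fromℕ a
fromℕ-pos {a} = fromℕ-mono-< {0} {a}

fromℕ-nonneg : ∀ a → 0ℚ ≤ fromℕ a
fromℕ-nonneg a = fromℕ-mono-≤ {0} {a} ℕ.z≤n

-- The denominator of δ is a witness: multiplying by it leaves the positive numerator.
archimedean : ∀ {δ} → 0ℚ < δ → Σ[ q ∈ ℕ ] (0 ℕ.< q × 1ℚ ≤ fromℕ q * δ)
archimedean {mkℚ (+ zero) d c} (*<* (ℤ.+<+ ()))
archimedean {mkℚ -[1+ k ] d c} (*<* ())
archimedean {δ@(mkℚ (+ suc k) d c)} _ = suc d , ℕ.s≤s ℕ.z≤n , toℚᵘ-cancel-≤ (begin
  mkℚᵘ (+ 1) 0                            ≤⟨ *≤* (subst₂ ℤ._≤_ (lhs d) (rhs d k) (ℤ.+≤+ (ℕ.m≤m*n (suc d) (suc k)))) ⟩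
  mkℚᵘ (+ suc d) 0 ℚᵘ.* mkℚᵘ (+ suc k) d  ≃⟨ ℚᵘ.*-congʳ {mkℚᵘ (+ suc k) d} (toℚᵘ-fromℕ (suc d)) ⟨
  toℚᵘ (fromℕ (suc d)) ℚᵘ.* toℚᵘ δ        ≃⟨ toℚᵘ-homo-* (fromℕ (suc d)) δ ⟨
  toℚᵘ (fromℕ (suc d) * δ)                ∎)
  where
  open ℚᵘ.≤-Reasoning
  lhs : ∀ d → + suc d ≡ + 1 ℤ.* + suc (d ℕ.+ 0)
  lhs d = trans (cong (λ z → + suc z) (sym (ℕ.+-identityʳ d))) (sym (ℤ.*-identityˡ (+ suc (d ℕ.+ 0))))
  rhs : ∀ d k → + (suc d ℕ.* suc k) ≡ (+ suc d ℤ.* + suc k) ℤ.* + 1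
  rhs d k = trans (ℤ.pos-* (suc d) (suc k)) (sym (ℤ.*-identityʳ (+ suc d ℤ.* + suc k)))

reciprocal : ∀ {k} → 0 ℕ.< k → Σ[ r ∈ ℚ ] (0ℚ < r × fromℕ k * r ≡ 1ℚ)
reciprocal {k} 0<k = 1/ fromℕ k , positive⁻¹ (1/ fromℕ k) {{1/pos⇒pos (fromℕ k)}} , *-inverseʳ (fromℕ k)
  where
  instance
    k-pos = positive (fromℕ-pos 0<k)
    k≢0 = pos⇒nonZero (fromℕ k)

*-cancel-< : ∀ {r p q} → 0ℚ < r → r * p < r * q → p < q
*-cancel-< {r} {p} {q} 0<r = *-cancelˡ-<-nonNeg r {{nonNegative (<⇒≤ 0<r)}}

*-cancel-≤ : ∀ {r p q} → 0ℚ < r → r * p ≤ r * q → p ≤ q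
*-cancel-≤ {r} {p} {q} 0<r = *-cancelˡ-≤-pos r {{positive 0<r}}

nC2≤n² : ∀ n → n C 2 ℕ.≤ n ℕ.* n
nC2≤n² zero    = ℕ.z≤n
nC2≤n² (suc n) = begin
  suc n C 2          ≡⟨ nCk+nC[k+1]≡[n+1]C[k+1] n 1 ⟨
  n C 1 ℕ.+ n C 2    ≤⟨ ℕ.+-mono-≤ (ℕ.≤-reflexive (nC1≡n n)) (nC2≤n² n) ⟩
  n ℕ.+ n ℕ.* n      ≤⟨ ℕ.m≤m+n (n ℕ.+ n ℕ.* n) (suc n) ⟩
  n ℕ.+ n ℕ.* n ℕ.+ suc n  ≡⟨ regroup n ⟩
  suc n ℕ.* suc n    ∎
  where
  open ℕ.≤-Reasoning
  regroup : ∀ n → n ℕ.+ n ℕ.* n ℕ.+ suc n ≡ suc n ℕ.* suc n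
  regroup = ℕSolver.solve-∀

density-bound : ∀ {n K e β} → 0 ℕ.< K → fromℕ K * β ≡ 1ℚ → n ℕ.* n ℕ.≤ K ℕ.* e → β * fromℕ (n C 2) ≤ fromℕ e
density-bound {n} {K} {e} {β} 0<K Kβ≡1 n²≤Ke = *-cancel-≤ (fromℕ-pos 0<K) (begin
  fromℕ K * (β * fromℕ (n C 2))  ≡⟨ trans (sym (*-assoc (fromℕ K) β (fromℕ (n C 2)))) (trans (cong (_* fromℕ (n C 2)) Kβ≡1) (*-identityˡ (fromℕ (n C 2)))) ⟩
  fromℕ (n C 2)                  ≤⟨ fromℕ-mono-≤ (ℕ.≤-trans (nC2≤n² n) n²≤Ke) ⟩
  fromℕ (K ℕ.* e)                ≡⟨ fromℕ-* K e ⟩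
  fromℕ K * fromℕ e              ∎)
  where open ≤-Reasoning

-- `suc k` in place of `k` leaves a surplus of `e`, which makes the inequality strict.
cover-bound-ℚ : ∀ {t k e τ r} → 0 ℕ.< t → 0 ℕ.< e → fromℕ t * r ≡ 1ℚ → t ℕ.* e ℕ.≤ k ℕ.* e ℕ.+ 2 ℕ.* t ℕ.* τ →
  (1ℚ - fromℕ (suc k) * r) * fromℕ e * (+ 1 / 2) < fromℕ τ
cover-bound-ℚ {t} {k} {e} {τ} {r} 0<t 0<e tr≡1 te≤ = *-cancel-< (fromℕ-pos {2 ℕ.* t} (ℕ.*-mono-< {0} {2} (ℕ.s≤s ℕ.z≤n) 0<t)) (begin-strict
  fromℕ (2 ℕ.* t) * ((1ℚ - fromℕ (suc k) * r) * fromℕ e * (+ 1 / 2))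
    ≡⟨ cong (_* ((1ℚ - fromℕ (suc k) * r) * fromℕ e * (+ 1 / 2))) (fromℕ-* 2 t) ⟩
  fromℕ 2 * fromℕ t * ((1ℚ - fromℕ (suc k) * r) * fromℕ e * (+ 1 / 2))
    ≡⟨ expand (fromℕ t) (fromℕ (suc k)) r (fromℕ e) ⟩
  fromℕ t * fromℕ e - fromℕ (suc k) * fromℕ e * (fromℕ t * r)
    ≡⟨ trans (cong (λ z → fromℕ t * fromℕ e - fromℕ (suc k) * fromℕ e * z) tr≡1)
         (cong₂ (λ x y → x - y) (sym (fromℕ-* t e)) (trans (*-identityʳ _) (sym (fromℕ-* (suc k) e)))) ⟩
  fromℕ (t ℕ.* e) - fromℕ (suc k ℕ.* e)
    <⟨ +-monoˡ-< (- fromℕ (suc k ℕ.* e)) (fromℕ-mono-< (ℕ.≤-<-trans te≤ (ℕ.+-monoˡ-< (2 ℕ.* t ℕ.* τ) (ℕ.m<n+m (k ℕ.* e) 0<e)))) ⟩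
  fromℕ (suc k ℕ.* e ℕ.+ 2 ℕ.* t ℕ.* τ) - fromℕ (suc k ℕ.* e)
    ≡⟨ trans (cong (_- fromℕ (suc k ℕ.* e)) (fromℕ-+ (suc k ℕ.* e) (2 ℕ.* t ℕ.* τ))) (cancel (fromℕ (suc k ℕ.* e)) (fromℕ (2 ℕ.* t ℕ.* τ))) ⟩
  fromℕ (2 ℕ.* t ℕ.* τ)
    ≡⟨ fromℕ-* (2 ℕ.* t) τ ⟩
  fromℕ (2 ℕ.* t) * fromℕ τ ∎)
  where
  open ≤-Reasoning
  open +-*-Solver
  expand : ∀ t c r e → fromℕ 2 * t * ((1ℚ - c * r) * e * (+ 1 / 2)) ≡ t * e - c * e * (t * r)
  expand = solve 4 (λ t c r e → con (fromℕ 2) :* t :* ((con 1ℚ :- c :* r) :* e :* con (+ 1 / 2)) := t :* e :- c :* e :* (t :* r)) refl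
  cancel : ∀ x y → (x + y) - x ≡ y
  cancel = solve 2 (λ x y → (x :+ y) :- x := y) refl

packing-bound-ℚ : ∀ {q e ν α} → 0 ℕ.< q → 1ℚ ≤ fromℕ q * α → 4 ℕ.* q ℕ.* ν ℕ.< (q ℕ.+ 1) ℕ.* e →
  fromℕ ν < (1ℚ + α) * fromℕ e * (+ 1 / 4)
packing-bound-ℚ {q} {e} {ν} {α} 0<q 1≤qα 4qν< = *-cancel-< (fromℕ-pos {4 ℕ.* q} (ℕ.*-mono-< {0} {4} (ℕ.s≤s ℕ.z≤n) 0<q)) (begin-strict
  fromℕ (4 ℕ.* q) * fromℕ ν
    ≡⟨ fromℕ-* (4 ℕ.* q) ν ⟨
  fromℕ (4 ℕ.* q ℕ.* ν)
    <⟨ fromℕ-mono-< 4qν< ⟩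
  fromℕ ((q ℕ.+ 1) ℕ.* e)
    ≡⟨ trans (fromℕ-* (q ℕ.+ 1) e) (cong (_* fromℕ e) (fromℕ-+ q 1)) ⟩
  (fromℕ q + 1ℚ) * fromℕ e
    ≤⟨ *-monoʳ-≤-nonNeg (fromℕ e) {{nonNegative (fromℕ-nonneg e)}} (+-monoʳ-≤ (fromℕ q) 1≤qα) ⟩
  (fromℕ q + fromℕ q * α) * fromℕ e
    ≡⟨ expand (fromℕ q) α (fromℕ e) ⟩
  fromℕ 4 * fromℕ q * ((1ℚ + α) * fromℕ e * (+ 1 / 4))
    ≡⟨ cong (_* ((1ℚ + α) * fromℕ e * (+ 1 / 4))) (fromℕ-* 4 q) ⟨
  fromℕ (4 ℕ.* q) * ((1ℚ + α) * fromℕ e * (+ 1 / 4)) ∎)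
  where
  open ≤-Reasoning
  open +-*-Solver
  expand : ∀ q α e → (q + q * α) * e ≡ fromℕ 4 * q * ((1ℚ + α) * e * (+ 1 / 4))
  expand = solve 3 (λ q α e → (q :+ q :* α) :* e := con (fromℕ 4) :* q :* ((con 1ℚ :+ α) :* e :* con (+ 1 / 4))) refl

-- With 1 ≤ q δ and j ≥ c q, one has c ≤ c q δ < (j + 1) δ.
harmonic→0 : ∀ c (r : ℕ → ℚ) → (∀ j → 0ℚ < r j × fromℕ (suc j) * r j ≡ 1ℚ) → TendsToZero (λ j → fromℕ c * r j)
harmonic→0 c r r-spec δ 0<δ with archimedean 0<δ
... | q , 0<q , 1≤qδ = c ℕ.* q , λ j cq≤j → subst (_< δ) (sym (0≤p⇒∣p∣≡p (0≤cr j))) (*-cancel-< (fromℕ-pos {suc j} (ℕ.s≤s ℕ.z≤n)) (begin-strict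
  fromℕ (suc j) * (fromℕ c * r j)
    ≡⟨ trans (regroup (fromℕ (suc j)) (fromℕ c) (r j)) (trans (cong (fromℕ c *_) (proj₂ (r-spec j))) (*-identityʳ (fromℕ c))) ⟩
  fromℕ c
    ≡⟨ *-identityʳ (fromℕ c) ⟨
  fromℕ c * 1ℚ
    ≤⟨ *-monoˡ-≤-nonNeg (fromℕ c) {{nonNegative (fromℕ-nonneg c)}} 1≤qδ ⟩
  fromℕ c * (fromℕ q * δ)
    ≡⟨ trans (sym (*-assoc (fromℕ c) (fromℕ q) δ)) (cong (_* δ) (sym (fromℕ-* c q))) ⟩
  fromℕ (c ℕ.* q) * δ
    <⟨ *-monoˡ-<-pos δ {{positive 0<δ}} (fromℕ-mono-< (ℕ.s≤s cq≤j)) ⟩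
  fromℕ (suc j) * δ ∎))
  where
  open ≤-Reasoning
  open +-*-Solver
  regroup : ∀ t c r → t * (c * r) ≡ c * (t * r)
  regroup = solve 3 (λ t c r → t :* (c :* r) := c :* (t :* r)) refl
  0≤cr : ∀ j → 0ℚ ≤ fromℕ c * r j
  0≤cr j = subst (_≤ fromℕ c * r j) (*-zeroʳ (fromℕ c)) (*-monoˡ-≤-nonNeg (fromℕ c) {{nonNegative (fromℕ-nonneg c)}} (<⇒≤ (proj₁ (r-spec j))))

TightSequence : ℚ → Set₁
TightSequence α =
    Σ[ β ∈ ℚ ] β > 0ℚ ×
    (Σ[ n ∈ (ℕ → ℕ) ] Σ[ G ∈ ((j : ℕ) → Graph (n j)) ]
    TendsToInfinity n ×
    (∀ j → fromℕ (numEdges (G j)) ≥ β * fromℕ (n j C 2)) ×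
    (Σ[ ε ∈ (ℕ → ℚ) ] TendsToZero ε ×
    (∀ j → fromℕ (τ₃ (G j)) > (1ℚ - ε j) * fromℕ (numEdges (G j)) * (+ 1 / 2))) ×
    (∀ j → fromℕ (ν₃ (G j)) < (1ℚ + α) * fromℕ (numEdges (G j)) * (+ 1 / 4)))

-- Term j is the graph of level t = j + 1, with β = 1 / K and ε j = (k + 1) / (j + 1); t ≤ n makes
-- the number of vertices unbounded.
tight-sequence : ∀ {q α} → 0 ℕ.< q → 1ℚ ≤ fromℕ q * α → ExtremalFamily q → TightSequence α
tight-sequence {q} 0<q 1≤qα (K , k , 0<K , graph) =
  β , proj₁ (proj₂ (reciprocal 0<K)) , (λ j → n (X j)) , (λ j → G (X j))
  , (λ M → M , λ j M≤j → ℕ.≤-trans M≤j (ℕ.≤-trans (ℕ.n≤1+n j) (t≤n (X j))))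
  , (λ j → density-bound {n (X j)} {K} {numEdges (G (X j))} 0<K (proj₂ (proj₂ (reciprocal 0<K))) (edge-density (X j)))
  , ((λ j → fromℕ (suc k) * r j) , harmonic→0 (suc k) r r-spec
    , λ j → cover-bound-ℚ {suc j} {k} {numEdges (G (X j))} {τ₃ (G (X j))} (ℕ.s≤s ℕ.z≤n) (0<e (X j)) (proj₂ (r-spec j)) (cover-bound (X j)))
  , λ j → packing-bound-ℚ {q} {numEdges (G (X j))} {ν₃ (G (X j))} 0<q 1≤qα (packing-bound (X j))
  where
  open ExtremalGraph
  X : ∀ j → ExtremalGraph q K k (suc j)
  X j = graph (suc j) (ℕ.s≤s ℕ.z≤n)
  β = proj₁ (reciprocal 0<K)
  r : ℕ → ℚ
  r j = proj₁ (reciprocal {suc j} (ℕ.s≤s ℕ.z≤n))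
  r-spec : ∀ j → 0ℚ < r j × fromℕ (suc j) * r j ≡ 1ℚ
  r-spec j = proj₂ (reciprocal {suc j} (ℕ.s≤s ℕ.z≤n))

mainTheorem1 : (α : ℚ) → α > 0ℚ →
    Σ[ β ∈ ℚ ] β > 0ℚ ×
    (Σ[ n ∈ (ℕ → ℕ) ] Σ[ G ∈ ((j : ℕ) → Graph (n j)) ]
    TendsToInfinity n ×
    (∀ j → fromℕ (numEdges (G j)) ≥ β * fromℕ (n j C 2)) ×
    (Σ[ ε ∈ (ℕ → ℚ) ] TendsToZero ε ×
    (∀ j → fromℕ (τ₃ (G j)) > (1ℚ - ε j) * fromℕ (numEdges (G j)) * (+ 1 / 2))) ×
    (∀ j → fromℕ (ν₃ (G j)) < (1ℚ + α) * fromℕ (numEdges (G j)) * (+ 1 / 4)))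
mainTheorem1 α α>0 = from-archimedean (archimedean α>0)
  where
  from-archimedean : Σ[ q ∈ ℕ ] (0 ℕ.< q × 1ℚ ≤ fromℕ q * α) → TightSequence α
  from-archimedean (q , 0<q , 1≤qα) = tight-sequence 0<q 1≤qα (extremal-family q 0<q)
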